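{- For every odd integer $m$, there exists a symmetric Bush-type Hadamard matrix of order $4m^4$.
   Context: A Hadamard matrix of order $N$ is an $N\times N$ matrix $H$ with entries $\pm 1$ such that $HH^{\top}=N I_N$. For a positive integer $n$, let $J_{2n}$ denote the $2n\times 2n$ all-ones matrix. A Hadamard matrix $H$ of order $4n^2$, partitioned into $2n\times 2n$ blocks as $H=(H_{ij})_{1\le i,j\le 2n}$ (each $H_{ij}$ being a $2n\times 2n$ matrix), is said to be of Bush-type if $H_{ii}=J_{2n}$ for all $1\le i\le 2n$, and $H_{ij}J_{2n}=J_{2n}H_{ij}=0$ for all $i\ne j$, $1\le i,j\le 2n$. It is symmetric if $H=H^{\top}$. (For order $4m^4$ one has $n=m^2$.) -}

module Defs where

open import Algebra.Properties.Monoid.Sum using (sum)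
open import Data.Bool.Base using (if_then_else_)
open import Data.Fin.Base using (Fin; cast; combine)
open import Data.Fin.Properties using (_≟_)
open import Data.Integer.Base using (ℤ; +_; 0ℤ; 1ℤ; -1ℤ; _+_; _*_)
open import Data.Integer.Properties using (+-0-monoid)
open import Data.Nat.Base as ℕ using (ℕ; NonZero)
open import Data.Product.Base using (∃-syntax)
open import Data.Sum.Base using (_⊎_)
open import Relation.Binary.PropositionalEquality.Core using (_≡_; _≢_)
open import Relation.Nullary.Decidable.Core using (does)

Odd : ℤ → Set
Odd m = ∃[ k ] m ≡ + 2 * k + 1ℤ

SquareMatrix : ℕ → Set
SquareMatrix N = Fin N → Fin N → ℤ

-- Matrices are functions, so their equality is entrywise: propositional
-- equality would need function extensionality.
infix 4 _≈_
_≈_ : ∀ {N} → SquareMatrix N → SquareMatrix N → Set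
A ≈ B = ∀ i j → A i j ≡ B i j

infixl 7 _⊗_
_⊗_ : ∀ {N} → SquareMatrix N → SquareMatrix N → SquareMatrix N
(A ⊗ B) i j = sum +-0-monoid (λ k → A i k * B k j)

infixr 7 _·_
_·_ : ∀ {N} → ℤ → SquareMatrix N → SquareMatrix N
(c · A) i j = c * A i j

infix 8 _ᵀ
_ᵀ : ∀ {N} → SquareMatrix N → SquareMatrix N
(A ᵀ) i j = A j i

I : ∀ N → SquareMatrix N
I N i j = if does (i ≟ j) then 1ℤ else 0ℤ

J : ∀ N → SquareMatrix N
J N i j = 1ℤ

O : ∀ N → SquareMatrix N
O N i j = 0ℤ

record IsHadamard {N : ℕ} (H : SquareMatrix N) : Set where
  field
    entries    : ∀ i j → H i j ≡ 1ℤ ⊎ H i j ≡ -1ℤ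
    orthogonal : H ⊗ H ᵀ ≈ (+ N) · I N

Symmetric : ∀ {N} → SquareMatrix N → Set
Symmetric H = H ≈ H ᵀ

-- `combine i a` is the index i * b + a, so the blocks are contiguous.
block : ∀ {N r b} → .(r ℕ.* b ≡ N) → SquareMatrix N → Fin r → Fin r → SquareMatrix b
block eq H i j a c = H (cast eq (combine i a)) (cast eq (combine j c))

-- The order N is 4n², with 2n × 2n blocks. It is kept as an index with a
-- proof so that it may be written in any form.
record IsBushType (n : ℕ) {N : ℕ} (H : SquareMatrix N) : Set where
  field
    positive   : NonZero n
    order      : (2 ℕ.* n) ℕ.* (2 ℕ.* n) ≡ N
    isHadamard : IsHadamard H
    diagonal   : ∀ (i : Fin (2 ℕ.* n)) → block order H i i ≈ J (2 ℕ.* n)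
    rowSums    : ∀ (i j : Fin (2 ℕ.* n)) → i ≢ j → block order H i j ⊗ J (2 ℕ.* n) ≈ O (2 ℕ.* n)
    columnSums : ∀ (i j : Fin (2 ℕ.* n)) → i ≢ j → J (2 ℕ.* n) ⊗ block order H i j ≈ O (2 ℕ.* n)

{-# OPTIONS --safe #-}
module Submission where

-- Index the four ±1 matrices A_uv of order n² by u, v ∈ ℤ/2, let them be symmetric and commuting
-- with Σ A_uv A_(u+s)(v+t) = 4n² [s = t = 0] I.  Then the matrix with blocks A_(u+u′)(v+v′) is a
-- symmetric Hadamard matrix of order 4n², and it is of Bush type as soon as A_00, A_10 are 1 on the
-- diagonal n × n blocks, A_00 + A_10 has vanishing row sums in the other blocks, and A_01 + A_11 has
-- vanishing row sums in all blocks.  Turyn's product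
--   C_uv = ½ (A_u0 + A_u1) ⊗ B_0v + ½ (A_u0 − A_u1) ⊗ B_1v
-- preserves all of this, so it suffices to treat n = p² for an odd prime p.
--
-- Let 𝕂 be the field with p² elements, η its quadratic character and w ∈ 𝕂 a nonsquare.  The
-- matrices are translation invariant on 𝕂²: p times the defining function is a combination of η ∘ ℓ_j
-- and of the indicators of the lines ℓ_j = 0, where ℓ_j runs over the p² + 1 directions.  Functions
-- of ℓ_i and of ℓ_j with i ≠ j convolve to a constant, so the orthogonality relations become
-- identities between the coefficients at each j separately.  The slopes are written x + y w with
-- x, y in the prime field; since η is 1 on the prime field and −1 at w, the sums of η over the two
-- families of parallel lines x = const and y = const are explicit, with opposite signs.  Combining a
-- ±1 function of x and one of y, each of total 1, therefore gives coefficients in {0, ±1} whose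
-- combination is again ±p or 0 on each line, with the complementary support.

open import Defs

-- Two obstacles shape the case n = p². A combination of p² + 1 line functions has in general values
-- of many sizes, whereas here every value must be exactly ±p. Up to constants, functions of x alone
-- and of y alone are eigenfunctions of convolution with η on 𝕂, with eigenvalues -p and p. Hence
-- half the difference of two such sign functions turns into p times half their sum, which vanishes
-- exactly where the difference does not; the indicators of the lines fill this gap. The second
-- obstacle is the origin, which lies on all lines at once, so that the indicator weights need total
-- ±1. Half of them carry an extra sign ν(x) ν(y) for this purpose. The choice of p² elements has
-- two further effects: -1 is a square, which makes the matrices symmetric, and the weight p of an
-- indicator is the square root of the field size, so that indicators and η contribute alike to
-- convolutions. The sums of A_01 + A_11 must vanish in the diagonal blocks too because in the
-- product they multiply the differences of B_0v and B_1v, over which nothing is known.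

module Construction where

  import Algebra.Properties.CommutativeMonoid.Sum as CMSum
  import Algebra.Properties.Semiring.Sum as SRSum
  import Algebra.Solver.Ring as RingSolver
  open import Algebra.Bundles using (CommutativeRing; RawRing)
  open import Algebra.Solver.Ring.AlmostCommutativeRing
    using (AlmostCommutativeRing; fromCommutativeRing; _-Raw-AlmostCommutative⟶_)
  open import Algebra.Structures using (IsCommutativeRing)
  open import Data.Bool.Base using (Bool; true; false; _xor_; if_then_else_; _∨_)
  open import Data.Fin.Base as Fin using (Fin; zero; suc; toℕ; fromℕ<; cast; combine)
  open import Data.Fin.Properties as Fin
    using (*↔×; 2↔Bool; 1↔⊤; cast-is-id; remQuot-combine; toℕ-injective; toℕ-fromℕ<; toℕ<n)
  open import Data.Integer.Base as ℤ using (ℤ; +_; 0ℤ; 1ℤ; -1ℤ; _+_; _*_; _-_; -_; _≤_; ∣_∣)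
  open import Data.Integer.DivMod using (_%ℕ_; _/ℕ_; n%ℕd<d; a≡a%ℕn+[a/ℕn]*n)
  import Data.Integer.Divisibility.Signed as Signed
  open import Data.Integer.Properties as ℤP hiding (_≟_)
  open import Data.Integer.Tactic.RingSolver using (solve-∀)
  open import Data.List.Base using ([]; _∷_)
  open import Data.List.Relation.Unary.All using (All; []; _∷_)
  open import Data.Maybe.Base as Maybe using (Maybe; just; nothing)
  open import Data.Nat.Base as ℕ using (ℕ; NonZero)
  open import Data.Nat.Coprimality using (prime⇒coprime; coprime-Bézout)
  open import Data.Nat.Divisibility using (_∣_; divides; ∣m⇒∣m*n; ∣n⇒∣m*n)
  open import Data.Nat.DivMod using (m<n⇒m%n≡m)
  open import Data.Nat.GCD using (module Bézout)
  open import Data.Nat.ListAction using (product)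
  open import Data.Nat.Primality using (Prime; prime⇒nonZero; ¬prime[1])
  open import Data.Nat.Primality.Factorisation using (PrimeFactorisation; factorise)
  import Data.Nat.Properties as ℕP
  import Data.Nat.Tactic.RingSolver as ℕSolver
  open import Data.Product.Base using (_×_; _,_; proj₁; proj₂; ∃; ∃-syntax)
  open import Data.Product.Function.NonDependent.Propositional using (_×-↔_)
  open import Data.Sum.Base using (_⊎_; inj₁; inj₂)
  open import Data.Unit.Base using (⊤; tt)
  open import Function.Base using (_∘_; id)
  open import Function.Bundles using (_↔_; Inverse; mk↔ₛ′)
  open import Function.Construct.Composition using (_↔-∘_)
  open import Function.Construct.Symmetry using (↔-sym)
  open import Relation.Binary.Definitions using (DecidableEquality)
  open import Relation.Binary.PropositionalEquality hiding ([_])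
  open import Relation.Nullary.Decidable
    using (Dec; yes; no; does; map′; dec-true; dec-false; dec⇒maybe; True; toWitness; _×-dec_; _⊎-dec_)
  open import Relation.Nullary.Negation using (contradiction; ¬_)

  -- Sums over finite types

  module ΣC = CMSum +-0-commutativeMonoid
  module ΣS = SRSum +-*-semiring

  record Finite (A : Set) : Set where
    no-eta-equality
    pattern
    constructor finite
    field
      {size} : ℕ
      enum   : Fin size ↔ A

  open Finite public

  opaque
    size-of : (A : Set) {{F : Finite A}} → ℤ
    size-of A {{F}} = + size F

    size-of-def : {A : Set} {{F : Finite A}} → size-of A ≡ + size F
    size-of-def = refl

  module _ {A : Set} {{F : Finite A}} where
    private
      at : Fin (size F) → A
      at = Inverse.to (enum F)

      at⁻¹ : A → Fin (size F)
      at⁻¹ = Inverse.from (enum F)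

      at-at⁻¹ : ∀ x → at (at⁻¹ x) ≡ x
      at-at⁻¹ = Inverse.strictlyInverseˡ (enum F)

    infix 4 _≟_
    _≟_ : DecidableEquality A
    x ≟ y = map′ (λ e → trans (sym (at-at⁻¹ x)) (trans (cong at e) (at-at⁻¹ y)))
                 (cong at⁻¹) (at⁻¹ x Fin.≟ at⁻¹ y)

    search : {P : A → Set} → (∀ x → Dec (P x)) → Dec (∃ P)
    search {P} P? = map′ (λ (i , p) → at i , p)
      (λ (x , p) → at⁻¹ x , subst P (sym (at-at⁻¹ x)) p)
      (Fin.any? (P? ∘ at))

    opaque
      ∑ : (A → ℤ) → ℤ
      ∑ f = ΣC.sum (f ∘ at)

      δ : A → A → ℤ
      δ x y = if does (x ≟ y) then 1ℤ else 0ℤ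

      ∑-def : ∀ f → ∑ f ≡ ΣC.sum (f ∘ at)
      ∑-def f = refl

      δ-≡ : ∀ {x y} → x ≡ y → δ x y ≡ 1ℤ
      δ-≡ {x} {y} e rewrite dec-true (x ≟ y) e = refl

      δ-≢ : ∀ {x y} → x ≢ y → δ x y ≡ 0ℤ
      δ-≢ {x} {y} e rewrite dec-false (x ≟ y) e = refl

      ∑-cong : ∀ {f g : A → ℤ} → (∀ x → f x ≡ g x) → ∑ f ≡ ∑ g
      ∑-cong e = ΣC.sum-cong-≗ (e ∘ at)

      ∑-+ : ∀ (f g : A → ℤ) → ∑ (λ x → f x + g x) ≡ ∑ f + ∑ g
      ∑-+ f g = ΣC.∑-distrib-+ (f ∘ at) (g ∘ at)

      ∑-*ˡ : ∀ c (f : A → ℤ) → ∑ (λ x → c * f x) ≡ c * ∑ f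
      ∑-*ˡ c f = sym (ΣS.*-distribˡ-sum c (f ∘ at))

      ∑-*ʳ : ∀ c (f : A → ℤ) → ∑ (λ x → f x * c) ≡ ∑ f * c
      ∑-*ʳ c f = sym (ΣS.*-distribʳ-sum c (f ∘ at))

      ∑-const : ∀ c → ∑ (λ (_ : A) → c) ≡ size-of A * c
      ∑-const c = trans (go (size F)) (cong (_* c) (sym size-of-def))
        where
        go : ∀ k → ΣC.sum {k} (λ _ → c) ≡ + k * c
        go ℕ.zero    = sym (*-zeroˡ c)
        go (ℕ.suc k) = trans (cong (λ z → c + z) (go k)) (sym (suc-* (+ k) c))

      ∑-single : ∀ a (f : A → ℤ) → (∀ x → x ≢ a → f x ≡ 0ℤ) → ∑ f ≡ f a
      ∑-single a f e = trans (go (f ∘ at) (at⁻¹ a) off) (cong f (at-at⁻¹ a))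
        where
        off : ∀ i → i ≢ at⁻¹ a → f (at i) ≡ 0ℤ
        off i i≢a = e (at i) λ { refl → i≢a (sym (Inverse.strictlyInverseʳ (enum F) i)) }
        zeros : ∀ {k} (g : Fin k → ℤ) → (∀ i → g i ≡ 0ℤ) → ΣC.sum g ≡ 0ℤ
        zeros {ℕ.zero}  g h = refl
        zeros {ℕ.suc k} g h = cong₂ _+_ (h zero) (zeros (g ∘ suc) (h ∘ suc))
        go : ∀ {k} (g : Fin k → ℤ) i → (∀ j → j ≢ i → g j ≡ 0ℤ) → ΣC.sum g ≡ g i
        go g zero    h = trans (cong (λ z → g zero + z) (zeros (g ∘ suc) λ j → h (suc j) λ ())) (+-identityʳ (g zero))
        go g (suc i) h = trans (cong₂ _+_ (h zero λ ()) (go (g ∘ suc) i λ j j≢i → h (suc j) (j≢i ∘ Fin.suc-injective)))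
                               (+-identityˡ (g (suc i)))

      ∑-mono : ∀ {f g : A → ℤ} → (∀ x → f x ≤ g x) → ∑ f ≤ ∑ g
      ∑-mono h = go (h ∘ at)
        where
        go : ∀ {k} {f g : Fin k → ℤ} → (∀ i → f i ≤ g i) → ΣC.sum f ≤ ΣC.sum g
        go {ℕ.zero}  h = ≤-refl
        go {ℕ.suc k} h = +-mono-≤ (h zero) (go (h ∘ suc))

    ∑-1 : ∑ (λ (_ : A) → 1ℤ) ≡ size-of A
    ∑-1 = trans (∑-const 1ℤ) (*-identityʳ (size-of A))

    ∑-neg : ∀ (f : A → ℤ) → ∑ (λ x → - f x) ≡ - ∑ f
    ∑-neg f = trans (∑-cong (λ x → sym (-1*i≡-i (f x)))) (trans (∑-*ˡ -1ℤ f) (-1*i≡-i (∑ f)))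

    ∑-minus : ∀ (f g : A → ℤ) → ∑ (λ x → f x - g x) ≡ ∑ f - ∑ g
    ∑-minus f g = trans (∑-+ f (λ x → - g x)) (cong (λ z → ∑ f + z) (∑-neg g))

    ∑-zero : ∀ {f : A → ℤ} → (∀ x → f x ≡ 0ℤ) → ∑ f ≡ 0ℤ
    ∑-zero e = trans (∑-cong e) (trans (∑-const 0ℤ) (*-zeroʳ (size-of A)))

    ∑-δ : ∀ a (f : A → ℤ) → ∑ (λ x → δ x a * f x) ≡ f a
    ∑-δ a f = trans (∑-single a _ λ x x≢a → trans (cong (_* f x) (δ-≢ x≢a)) (*-zeroˡ (f x)))
                    (trans (cong (_* f a) (δ-≡ refl)) (*-identityˡ (f a)))

    ∑-δ₁ : ∀ a → ∑ (λ x → δ x a) ≡ 1ℤ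
    ∑-δ₁ a = trans (∑-single a _ λ x → δ-≢) (δ-≡ refl)

    -- A single term is a `δ`-weighted sum, hence bounded by the total. For η this replaces counting
    -- arguments: a function of one sign with total zero vanishes.
    ∑-nonneg-zero : ∀ (f : A → ℤ) → (∀ x → 0ℤ ≤ f x) → ∑ f ≡ 0ℤ → ∀ x → f x ≡ 0ℤ
    ∑-nonneg-zero f pos e x = ≤-antisym (subst₂ _≤_ (∑-δ x f) e (∑-mono (λ y → bound y (y ≟ x)))) (pos x)
      where
      bound : ∀ y → Dec (y ≡ x) → δ y x * f y ≤ f y
      bound y (yes y≡x) = ≤-reflexive (trans (cong (_* f y) (δ-≡ y≡x)) (*-identityˡ (f y)))
      bound y (no y≢x)  = subst (_≤ f y) (sym (trans (cong (_* f y) (δ-≢ y≢x)) (*-zeroˡ (f y)))) (pos y)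

    δ-sym : ∀ x y → δ x y ≡ δ y x
    δ-sym x y with x ≟ y
    ... | yes e = trans (δ-≡ e) (sym (δ-≡ (sym e)))
    ... | no ¬e = trans (δ-≢ ¬e) (sym (δ-≢ (¬e ∘ sym)))

  module _ {A B : Set} {{F : Finite A}} {{G : Finite B}} where
    opaque
      unfolding ∑

      ∑-reindex : (π : A ↔ B) (f : B → ℤ) → ∑ (f ∘ Inverse.to π) ≡ ∑ f
      ∑-reindex π f = trans
        (ΣC.sum-cong-≗ λ (i : Fin (size F)) → cong f (sym (Inverse.strictlyInverseˡ (enum G) (Inverse.to π (Inverse.to (enum F) i)))))
        (sym (ΣC.sum-permute (f ∘ Inverse.to (enum G)) (↔-sym (enum G) ↔-∘ (π ↔-∘ enum F))))

      ∑-comm : ∀ (f : A → B → ℤ) → ∑ (λ x → ∑ (f x)) ≡ ∑ (λ y → ∑ (λ x → f x y))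
      ∑-comm f = ΣC.∑-comm (λ i j → f (Inverse.to (enum F) i) (Inverse.to (enum G) j))

    ∑-∑-* : ∀ (f : A → ℤ) (g : B → ℤ) → ∑ (λ x → ∑ (λ y → f x * g y)) ≡ ∑ f * ∑ g
    ∑-∑-* f g = trans (∑-cong λ x → ∑-*ˡ (f x) g) (∑-*ʳ (∑ g) f)

  opaque
    instance
      Bool-finite : Finite Bool
      Bool-finite = finite 2↔Bool

      ×-finite : {A B : Set} → {{Finite A}} → {{Finite B}} → Finite (A × B)
      ×-finite {{F}} {{G}} = finite ((enum F ×-↔ enum G) ↔-∘ *↔×)

      Maybe-finite : {A : Set} → {{Finite A}} → Finite (Maybe A)
      Maybe-finite {A} {{F}} = finite (mk↔ₛ′ to′ from′ to-from from-to)
        where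
        to′ : Fin (ℕ.suc (size F)) → Maybe A
        to′ zero    = nothing
        to′ (suc i) = just (Inverse.to (enum F) i)
        from′ : Maybe A → Fin (ℕ.suc (size F))
        from′ nothing  = zero
        from′ (just x) = suc (Inverse.from (enum F) x)
        to-from : ∀ x → to′ (from′ x) ≡ x
        to-from nothing  = refl
        to-from (just x) = cong just (Inverse.strictlyInverseˡ (enum F) x)
        from-to : ∀ i → from′ (to′ i) ≡ i
        from-to zero    = refl
        from-to (suc i) = cong suc (Inverse.strictlyInverseʳ (enum F) i)

  sum-++ : ∀ m {n} (f : Fin (m ℕ.+ n) → ℤ) → ΣC.sum f ≡ ΣC.sum (f ∘ (Fin._↑ˡ n)) + ΣC.sum (f ∘ (m Fin.↑ʳ_))
  sum-++ ℕ.zero    f = sym (+-identityˡ _)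
  sum-++ (ℕ.suc m) f = trans (cong (λ z → f zero + z) (sum-++ m (f ∘ suc))) (sym (+-assoc (f zero) _ _))

  sum-combine : ∀ m {n} (f : Fin (m ℕ.* n) → ℤ) → ΣC.sum f ≡ ΣC.sum {m} (λ i → ΣC.sum {n} (λ j → f (Fin.combine i j)))
  sum-combine ℕ.zero        f = refl
  sum-combine (ℕ.suc m) {n} f = trans (sum-++ n f)
    (cong (λ z → ΣC.sum (f ∘ (Fin._↑ˡ (m ℕ.* n))) + z) (sum-combine m (f ∘ (n Fin.↑ʳ_))))

  opaque
    unfolding ∑ ×-finite Maybe-finite Bool-finite

    ∑-× : {A B : Set} {{F : Finite A}} {{G : Finite B}} (f : A × B → ℤ) →
          ∑ f ≡ ∑ (λ x → ∑ (λ y → f (x , y)))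
    ∑-× {A} {B} {{F}} {{G}} f = trans (sum-combine (size F) _)
      (ΣC.sum-cong-≗ λ i → ΣC.sum-cong-≗ λ j → cong (λ (k , l) → f (Inverse.to (enum F) k , Inverse.to (enum G) l)) (Fin.remQuot-combine i j))

    ∑-Bool : ∀ (f : Bool → ℤ) → ∑ f ≡ f false + f true
    ∑-Bool f = cong (λ z → f false + z) (+-identityʳ (f true))

    ∑-Maybe : {A : Set} {{F : Finite A}} (f : Maybe A → ℤ) → ∑ f ≡ f nothing + ∑ (λ x → f (just x))
    ∑-Maybe f = refl

  -- Finite fields and the quadratic character

  -- The map `fromℤ` is part of the structure so that the ring solver can interpret integer
  -- constants; `𝟘` and `𝟙` are its values, so their preservation is definitional.
  record FiniteField : Set₁ where
    infixl 7 _⊙_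
    infixl 6 _⊕_
    infix  8 ⊖_
    field
      Carrier           : Set
      _⊕_ _⊙_           : Carrier → Carrier → Carrier
      ⊖_                : Carrier → Carrier
      fromℤ             : ℤ → Carrier

    𝟘 : Carrier
    𝟘 = fromℤ 0ℤ

    𝟙 : Carrier
    𝟙 = fromℤ 1ℤ

    field
      isCommutativeRing : IsCommutativeRing _≡_ _⊕_ _⊙_ ⊖_ 𝟘 𝟙
      fromℤ-+           : ∀ a b → fromℤ (a + b) ≡ fromℤ a ⊕ fromℤ b
      fromℤ-*           : ∀ a b → fromℤ (a * b) ≡ fromℤ a ⊙ fromℤ b
      fromℤ-neg         : ∀ a → fromℤ (- a) ≡ ⊖ fromℤ a
      carrier-finite    : Finite Carrier
      inverse           : ∀ {x} → x ≢ 𝟘 → ∃[ y ] x ⊙ y ≡ 𝟙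
      𝟙≢𝟘               : 𝟙 ≢ 𝟘
      char≢2            : 𝟙 ⊕ 𝟙 ≢ 𝟘

  module FieldProperties (𝔽 : FiniteField) where
    open FiniteField 𝔽 public

    private instance
      Carrier-finite : Finite Carrier
      Carrier-finite = carrier-finite

    almostCommutativeRing : AlmostCommutativeRing _ _
    almostCommutativeRing = fromCommutativeRing (record { isCommutativeRing = isCommutativeRing })

    coefficients : RawRing _ _
    coefficients = CommutativeRing.rawRing +-*-commutativeRing

    fromℤ-homomorphism : coefficients -Raw-AlmostCommutative⟶ almostCommutativeRing
    fromℤ-homomorphism = record
      { ⟦_⟧ = fromℤ ; +-homo = fromℤ-+ ; *-homo = fromℤ-* ; -‿homo = fromℤ-neg ; 0-homo = refl ; 1-homo = refl }

    coefficient≟ : ∀ a b → Maybe (fromℤ a ≡ fromℤ b)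
    coefficient≟ a b = Maybe.map (cong fromℤ) (dec⇒maybe (a ℤP.≟ b))

    open RingSolver coefficients almostCommutativeRing fromℤ-homomorphism coefficient≟ public

    𝟘⊙ : ∀ x → 𝟘 ⊙ x ≡ 𝟘
    𝟘⊙ = solve 1 (λ x → con 0ℤ :* x := con 0ℤ) refl

    𝟙⊙ : ∀ x → 𝟙 ⊙ x ≡ x
    𝟙⊙ = solve 1 (λ x → con 1ℤ :* x := x) refl

    ⊙-comm : ∀ x y → x ⊙ y ≡ y ⊙ x
    ⊙-comm = solve 2 (λ x y → x :* y := y :* x) refl

    ⊖-≡𝟘 : ∀ {x y} → x ⊕ ⊖ y ≡ 𝟘 → x ≡ y
    ⊖-≡𝟘 {x} {y} e = trans (solve 2 (λ x y → x := (x :- y) :+ y) refl x y)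
      (trans (cong (_⊕ y) e) (solve 1 (λ y → con 0ℤ :+ y := y) refl y))

    cancel : ∀ {x y} → x ≢ 𝟘 → x ⊙ y ≡ 𝟘 → y ≡ 𝟘
    cancel {x} {y} x≢𝟘 e with inverse x≢𝟘
    ... | z , xz≡𝟙 = begin
      y             ≡⟨ 𝟙⊙ y ⟨
      𝟙 ⊙ y         ≡⟨ cong (_⊙ y) xz≡𝟙 ⟨
      (x ⊙ z) ⊙ y   ≡⟨ solve 3 (λ x y z → (x :* z) :* y := z :* (x :* y)) refl x y z ⟩
      z ⊙ (x ⊙ y)   ≡⟨ cong (z ⊙_) e ⟩
      z ⊙ 𝟘         ≡⟨ solve 1 (λ z → z :* con 0ℤ := con 0ℤ) refl z ⟩
      𝟘             ∎
      where open ≡-Reasoning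

    ⊙-≢𝟘 : ∀ {x y} → x ≢ 𝟘 → y ≢ 𝟘 → x ⊙ y ≢ 𝟘
    ⊙-≢𝟘 x≢𝟘 y≢𝟘 e = y≢𝟘 (cancel x≢𝟘 e)

    affine : ∀ s {r} → r ≢ 𝟘 → Carrier ↔ Carrier
    affine s {r} r≢𝟘 = mk↔ₛ′ (λ a → s ⊕ r ⊙ a) (λ c → z ⊙ (c ⊕ ⊖ s))
      (λ c → trans (solve 4 (λ s r z c → s :+ r :* (z :* (c :- s)) := s :+ (r :* z) :* (c :- s)) refl s r z c)
             (trans (cong (λ u → s ⊕ u ⊙ (c ⊕ ⊖ s)) rz≡𝟙)
                    (solve 2 (λ s c → s :+ con 1ℤ :* (c :- s) := c) refl s c)))
      (λ a → trans (solve 4 (λ s r z a → z :* ((s :+ r :* a) :- s) := (r :* z) :* a) refl s r z a)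
             (trans (cong (_⊙ a) rz≡𝟙) (𝟙⊙ a)))
      where
      z = proj₁ (inverse r≢𝟘)
      rz≡𝟙 = proj₂ (inverse r≢𝟘)

    ∑-affine : ∀ s {r} → r ≢ 𝟘 → (f : Carrier → ℤ) → ∑ (λ a → f (s ⊕ r ⊙ a)) ≡ ∑ f
    ∑-affine s r≢𝟘 f = ∑-reindex (affine s r≢𝟘) f

    ∑-scale : ∀ {r} → r ≢ 𝟘 → (f : Carrier → ℤ) → ∑ (λ a → f (r ⊙ a)) ≡ ∑ f
    ∑-scale {r} r≢𝟘 f = trans
      (∑-cong λ a → cong f (solve 2 (λ r a → r :* a := con 0ℤ :+ r :* a) refl r a))
      (∑-affine 𝟘 r≢𝟘 f)

    ∑-translate : ∀ s (f : Carrier → ℤ) → ∑ (λ a → f (a ⊕ s)) ≡ ∑ f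
    ∑-translate s f = trans
      (∑-cong λ a → cong f (solve 2 (λ s a → a :+ s := s :+ con 1ℤ :* a) refl s a))
      (∑-affine s 𝟙≢𝟘 f)

    ⊖𝟙≢𝟘 : ⊖ 𝟙 ≢ 𝟘
    ⊖𝟙≢𝟘 e = 𝟙≢𝟘 (trans (solve 0 (con 1ℤ := :- (:- con 1ℤ)) refl)
                   (trans (cong ⊖_ e) (solve 0 (:- con 0ℤ := con 0ℤ) refl)))

    ∑-reflect : ∀ s (f : Carrier → ℤ) → ∑ (λ a → f (s ⊕ ⊖ a)) ≡ ∑ f
    ∑-reflect s f = trans
      (∑-cong λ a → cong f (solve 2 (λ s a → s :- a := s :+ (:- con 1ℤ) :* a) refl s a))
      (∑-affine s ⊖𝟙≢𝟘 f)

    N : ℤ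
    N = size-of Carrier

    2≤N : + 2 ≤ N
    2≤N = subst₂ _≤_ (trans (∑-+ _ _) (cong₂ _+_ (∑-δ₁ 𝟘) (∑-δ₁ 𝟙)))
                     ∑-1 (∑-mono bound)
      where
      bound : ∀ x → δ x 𝟘 + δ x 𝟙 ≤ 1ℤ
      bound x with x ≟ 𝟘 | x ≟ 𝟙
      ... | yes p | yes q = contradiction (trans (sym q) p) 𝟙≢𝟘
      ... | yes p | no ¬q = ≤-reflexive (cong₂ _+_ (δ-≡ p) (δ-≢ ¬q))
      ... | no ¬p | yes q = ≤-reflexive (cong₂ _+_ (δ-≢ ¬p) (δ-≡ q))
      ... | no ¬p | no ¬q = subst (_≤ 1ℤ) (sym (cong₂ _+_ (δ-≢ ¬p) (δ-≢ ¬q))) (ℤ.+≤+ ℕ.z≤n)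

    N-1-cancel : ∀ {a} → (N - 1ℤ) * a ≡ 0ℤ → a ≡ 0ℤ
    N-1-cancel {a} e with i*j≡0⇒i≡0∨j≡0 (N - 1ℤ) e
    ... | inj₂ a≡0   = a≡0
    ... | inj₁ N-1≡0 = contradiction (subst (+ 2 ≤_) (i-j≡0⇒i≡j N 1ℤ N-1≡0) 2≤N) λ { (ℤ.+≤+ (ℕ.s≤s ())) }

    -- A sum that is invariant under scaling and has total zero is determined by its value at 𝟘; this
    -- evaluates all character sums needed, without Gauss sums.
    constant-off-𝟘 : ∀ (g : Carrier → ℤ) (ε κ : ℤ) → (∀ c → c ≢ 𝟘 → g c ≡ κ) →
      g 𝟘 ≡ ε * (N - 1ℤ) → ∑ g ≡ 0ℤ → ∀ c → g c ≡ ε * (N * δ c 𝟘 - 1ℤ)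
    constant-off-𝟘 g ε κ off at-𝟘 total c with c ≟ 𝟘
    ... | yes p = trans (cong g p) (trans at-𝟘 (cong (λ d → ε * (d - 1ℤ)) (sym (trans (cong (N *_) (δ-≡ p)) (*-identityʳ N)))))
    ... | no ¬p = trans (off c ¬p) (trans κ≡-ε (trans (lemma ε) (cong (λ d → ε * (d - 1ℤ)) (sym (trans (cong (N *_) (δ-≢ ¬p)) (*-zeroʳ N))))))
      where
      lemma : ∀ ε → - ε ≡ ε * (0ℤ - 1ℤ)
      lemma = solve-∀
      decompose : ∀ x → g x ≡ κ + δ x 𝟘 * (g x - κ)
      decompose x with x ≟ 𝟘
      ... | yes q = trans (split κ (g x)) (cong (λ d → κ + d * (g x - κ)) (sym (δ-≡ q)))
        where
        split : ∀ κ h → h ≡ κ + 1ℤ * (h - κ)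
        split = solve-∀
      ... | no ¬q = trans (off x ¬q) (trans (split κ (g x)) (cong (λ d → κ + d * (g x - κ)) (sym (δ-≢ ¬q))))
        where
        split : ∀ κ h → κ ≡ κ + 0ℤ * (h - κ)
        split = solve-∀
      sum-eq : (N - 1ℤ) * (κ + ε) ≡ 0ℤ
      sum-eq = begin
        (N - 1ℤ) * (κ + ε)                       ≡⟨ rearrange N κ ε ⟩
        N * κ + (ε * (N - 1ℤ) - κ)               ≡⟨ cong (λ h → N * κ + (h - κ)) at-𝟘 ⟨
        N * κ + (g 𝟘 - κ)                        ≡⟨ cong₂ _+_ (∑-const κ) (∑-δ 𝟘 (λ x → g x - κ)) ⟨
        ∑ (λ (_ : Carrier) → κ) + ∑ (λ x → δ x 𝟘 * (g x - κ)) ≡⟨ ∑-+ _ _ ⟨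
        ∑ (λ x → κ + δ x 𝟘 * (g x - κ))          ≡⟨ ∑-cong decompose ⟨
        ∑ g                                      ≡⟨ total ⟩
        0ℤ                                       ∎
        where
        open ≡-Reasoning
        rearrange : ∀ N κ ε → (N - 1ℤ) * (κ + ε) ≡ N * κ + (ε * (N - 1ℤ) - κ)
        rearrange = solve-∀
      κ≡-ε : κ ≡ - ε
      κ≡-ε = i-j≡0⇒i≡j κ (- ε) (trans (cong (λ e → κ + e) (neg-involutive ε)) (N-1-cancel sum-eq))

    IsSquare : Carrier → Set
    IsSquare x = ∃[ y ] y ⊙ y ≡ x

    square? : ∀ x → Dec (IsSquare x)
    square? x = search (λ y → y ⊙ y ≟ x)

    η : Carrier → ℤ
    η x = if does (x ≟ 𝟘) then 0ℤ else if does (square? x) then 1ℤ else -1ℤ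

    data η-View (x : Carrier) : Set where
      zero      : x ≡ 𝟘 → η x ≡ 0ℤ → η-View x
      square    : x ≢ 𝟘 → IsSquare x → η x ≡ 1ℤ → η-View x
      nonsquare : x ≢ 𝟘 → ¬ IsSquare x → η x ≡ -1ℤ → η-View x

    η-𝟘 : η 𝟘 ≡ 0ℤ
    η-𝟘 rewrite dec-true (𝟘 ≟ 𝟘) refl = refl

    η-square : ∀ {x} → x ≢ 𝟘 → IsSquare x → η x ≡ 1ℤ
    η-square {x} x≢𝟘 s rewrite dec-false (x ≟ 𝟘) x≢𝟘 | dec-true (square? x) s = refl

    η-nonsquare : ∀ {x} → x ≢ 𝟘 → ¬ IsSquare x → η x ≡ -1ℤ
    η-nonsquare {x} x≢𝟘 s rewrite dec-false (x ≟ 𝟘) x≢𝟘 | dec-false (square? x) s = refl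

    η-view : ∀ x → η-View x
    η-view x with x ≟ 𝟘 | square? x
    ... | yes p | _     = zero p (trans (cong η p) η-𝟘)
    ... | no ¬p | yes s = square ¬p s (η-square ¬p s)
    ... | no ¬p | no ¬s = nonsquare ¬p ¬s (η-nonsquare ¬p ¬s)

    square≡𝟘 : ∀ {y} → y ⊙ y ≡ 𝟘 → y ≡ 𝟘
    square≡𝟘 {y} e with y ≟ 𝟘
    ... | yes p = p
    ... | no ¬p = cancel ¬p e

    -- Characteristic different from 2 enters here: it gives a nonzero square two distinct roots.
    x≢⊖x : ∀ {x} → x ≢ 𝟘 → x ≢ ⊖ x
    x≢⊖x {x} x≢𝟘 e = char≢2 (cancel x≢𝟘 (trans (solve 1 (λ x → x :* (con 1ℤ :+ con 1ℤ) := x :+ x) refl x)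
      (trans (cong (x ⊕_) e) (solve 1 (λ x → x :- x := con 0ℤ) refl x))))

    square-roots : ∀ x → ∑ (λ y → δ (y ⊙ y) x) ≡ 1ℤ + η x
    square-roots x with η-view x
    ... | zero p e = trans (trans (∑-cong root) (∑-δ₁ 𝟘)) (sym (cong (λ z → 1ℤ + z) e))
      where
      root : ∀ y → δ (y ⊙ y) x ≡ δ y 𝟘
      root y with y ≟ 𝟘
      ... | yes q = trans (δ-≡ (trans (trans (cong (_⊙ y) q) (𝟘⊙ y)) (sym p))) (sym (δ-≡ q))
      ... | no ¬q = trans (δ-≢ (λ r → ¬q (square≡𝟘 (trans r p)))) (sym (δ-≢ ¬q))
    ... | nonsquare _ ¬s e = trans (∑-zero (λ y → δ-≢ (λ r → ¬s (y , r)))) (sym (cong (λ z → 1ℤ + z) e))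
    ... | square x≢𝟘 (z , zz≡x) e = trans (trans (∑-cong root) (trans (∑-+ _ _) (cong₂ _+_ (∑-δ₁ z) (∑-δ₁ (⊖ z)))))
                                          (sym (cong (λ z → 1ℤ + z) e))
      where
      z≢𝟘 : z ≢ 𝟘
      z≢𝟘 p = x≢𝟘 (trans (sym zz≡x) (trans (cong (_⊙ z) p) (𝟘⊙ z)))
      root : ∀ y → δ (y ⊙ y) x ≡ δ y z + δ y (⊖ z)
      root y with y ≟ z | y ≟ ⊖ z
      ... | yes p | yes q = contradiction (trans (sym p) q) (x≢⊖x z≢𝟘)
      ... | yes p | no ¬q = trans (δ-≡ (trans (cong₂ _⊙_ p p) zz≡x)) (sym (cong₂ _+_ (δ-≡ p) (δ-≢ ¬q)))
      ... | no ¬p | yes q = trans (δ-≡ (trans (cong₂ _⊙_ q q) (trans (solve 1 (λ z → :- z :* :- z := z :* z) refl z) zz≡x)))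
                                  (sym (cong₂ _+_ (δ-≢ ¬p) (δ-≡ q)))
      ... | no ¬p | no ¬q = trans (δ-≢ ¬root) (sym (cong₂ _+_ (δ-≢ ¬p) (δ-≢ ¬q)))
        where
        ¬root : y ⊙ y ≢ x
        ¬root r = ¬q (⊖-≡𝟘 (trans (solve 2 (λ y z → y :- :- z := y :+ z) refl y z) (cancel (¬p ∘ ⊖-≡𝟘)
          (trans (solve 2 (λ y z → (y :- z) :* (y :+ z) := y :* y :- z :* z) refl y z)
          (trans (cong₂ (λ a b → a ⊕ ⊖ b) r zz≡x) (solve 1 (λ x → x :- x := con 0ℤ) refl x))))))

    -- Every y has exactly one square, so the root counts `1 + η x` add up to the number `N` of
    -- elements.
    ∑-η : ∑ η ≡ 0ℤ
    ∑-η = +-cancelˡ N (∑ η) 0ℤ (begin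
      N + ∑ η                              ≡⟨ cong (λ z → z + ∑ η) ∑-1 ⟨
      ∑ (λ (_ : Carrier) → 1ℤ) + ∑ η       ≡⟨ ∑-+ _ _ ⟨
      ∑ (λ x → 1ℤ + η x)                   ≡⟨ ∑-cong square-roots ⟨
      ∑ (λ x → ∑ (λ y → δ (y ⊙ y) x))      ≡⟨ ∑-comm (λ x y → δ (y ⊙ y) x) ⟩
      ∑ (λ y → ∑ (λ x → δ (y ⊙ y) x))      ≡⟨ ∑-cong (λ y → trans (∑-cong (λ x → δ-sym (y ⊙ y) x)) (∑-δ₁ (y ⊙ y))) ⟩
      ∑ (λ (_ : Carrier) → 1ℤ)             ≡⟨ ∑-1 ⟩
      N                                    ≡⟨ +-identityʳ N ⟨
      N + 0ℤ                               ∎)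
      where
      open ≡-Reasoning
      +-cancelˡ : ∀ a b c → a + b ≡ a + c → b ≡ c
      +-cancelˡ a b c e = trans (lemma a b) (trans (cong (λ z → z - a) e) (sym (lemma a c)))
        where
        lemma : ∀ a b → b ≡ a + b - a
        lemma = solve-∀

    -- A root of `x ⊙ y` divided by a root of `x` is a root of `y`.
    square-cancel : ∀ {x y} → x ≢ 𝟘 → IsSquare x → IsSquare (x ⊙ y) → IsSquare y
    square-cancel {x} {y} x≢𝟘 (z , zz≡x) (c , cc≡xy) = w ⊙ c , (begin
      (w ⊙ c) ⊙ (w ⊙ c)      ≡⟨ solve 2 (λ w c → (w :* c) :* (w :* c) := (w :* w) :* (c :* c)) refl w c ⟩
      (w ⊙ w) ⊙ (c ⊙ c)      ≡⟨ cong ((w ⊙ w) ⊙_) (trans cc≡xy (cong (_⊙ y) (sym zz≡x))) ⟩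
      (w ⊙ w) ⊙ ((z ⊙ z) ⊙ y) ≡⟨ solve 3 (λ w z y → (w :* w) :* ((z :* z) :* y) := (z :* w) :* (z :* w) :* y) refl w z y ⟩
      (z ⊙ w) ⊙ (z ⊙ w) ⊙ y  ≡⟨ cong (λ u → u ⊙ u ⊙ y) zw≡𝟙 ⟩
      𝟙 ⊙ 𝟙 ⊙ y              ≡⟨ solve 1 (λ y → con 1ℤ :* con 1ℤ :* y := y) refl y ⟩
      y                      ∎)
      where
      open ≡-Reasoning
      z≢𝟘 : z ≢ 𝟘
      z≢𝟘 p = x≢𝟘 (trans (sym zz≡x) (trans (cong (_⊙ z) p) (𝟘⊙ z)))
      w = proj₁ (inverse z≢𝟘)
      zw≡𝟙 = proj₂ (inverse z≢𝟘)

    η-square-* : ∀ {x} y → x ≢ 𝟘 → IsSquare x → η (x ⊙ y) ≡ η y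
    η-square-* {x} y x≢𝟘 s@(z , zz≡x) with η-view y
    ... | zero p e = trans (cong η (trans (cong (x ⊙_) p) (solve 1 (λ x → x :* con 0ℤ := con 0ℤ) refl x))) (trans η-𝟘 (sym e))
    ... | square y≢𝟘 (c , cc≡y) e = trans (η-square (⊙-≢𝟘 x≢𝟘 y≢𝟘)
      (z ⊙ c , trans (solve 2 (λ w c → (w :* c) :* (w :* c) := (w :* w) :* (c :* c)) refl z c) (cong₂ _⊙_ zz≡x cc≡y))) (sym e)
    ... | nonsquare y≢𝟘 ¬s e = trans (η-nonsquare (⊙-≢𝟘 x≢𝟘 y≢𝟘) (¬s ∘ square-cancel x≢𝟘 s)) (sym e)

    η≤1 : ∀ x → η x ≤ 1ℤ
    η≤1 x with η-view x
    ... | zero _ e        = subst (_≤ 1ℤ) (sym e) (ℤ.+≤+ ℕ.z≤n)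
    ... | square _ _ e    = ≤-reflexive e
    ... | nonsquare _ _ e = subst (_≤ 1ℤ) (sym e) ℤ.-≤+

    -- If x is not a square, then y ↦ η (x y) + η y sums to zero and is nowhere positive.
    η-nonsquare-* : ∀ {x} y → x ≢ 𝟘 → ¬ IsSquare x → η (x ⊙ y) ≡ - η y
    η-nonsquare-* {x} y x≢𝟘 ¬s = trans (negate (η (x ⊙ y)) (η y))
      (trans (cong (λ z → - (z + η y)) (∑-nonneg-zero f f-nonneg f-total y)) (cong -_ (+-identityˡ (η y))))
      where
      negate : ∀ a b → a ≡ - ((- (a + b)) + b)
      negate = solve-∀
      f : Carrier → ℤ
      f y = - (η (x ⊙ y) + η y)
      f-total : ∑ f ≡ 0ℤ
      f-total = trans (∑-neg _) (cong -_ (trans (∑-+ _ _) (cong₂ _+_ (trans (∑-scale x≢𝟘 η) ∑-η) ∑-η)))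
      f-nonneg : ∀ y → 0ℤ ≤ f y
      f-nonneg y with η-view y
      ... | zero p e = ≤-reflexive (sym (cong -_ (cong₂ _+_ (trans (cong η (trans (cong (x ⊙_) p)
                         (solve 1 (λ x → x :* con 0ℤ := con 0ℤ) refl x))) η-𝟘) e)))
      ... | square y≢𝟘 t e = ≤-reflexive (sym (cong -_ (cong₂ _+_ (trans (cong η (⊙-comm x y))
                         (trans (η-square-* x y≢𝟘 t) (η-nonsquare x≢𝟘 ¬s))) e)))
      ... | nonsquare y≢𝟘 _ e = neg-mono-≤ (subst (λ z → η (x ⊙ y) + z ≤ 0ℤ) (sym e) (+-monoˡ-≤ -1ℤ (η≤1 (x ⊙ y))))

    η-* : ∀ x y → η (x ⊙ y) ≡ η x * η y
    η-* x y with η-view x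
    ... | zero p e = trans (cong η (trans (cong (_⊙ y) p) (𝟘⊙ y))) (trans η-𝟘 (trans (sym (*-zeroˡ (η y))) (cong (_* η y) (sym e))))
    ... | square x≢𝟘 s e = trans (η-square-* y x≢𝟘 s) (trans (sym (*-identityˡ (η y))) (cong (_* η y) (sym e)))
    ... | nonsquare x≢𝟘 ¬s e = trans (η-nonsquare-* y x≢𝟘 ¬s) (trans (sym (-1*i≡-i (η y))) (cong (_* η y) (sym e)))

    η-² : ∀ x → η x * η x ≡ 1ℤ - δ x 𝟘
    η-² x with η-view x
    ... | zero p e           = trans (cong₂ _*_ e e) (cong (λ d → 1ℤ - d) (sym (δ-≡ p)))
    ... | square x≢𝟘 _ e     = trans (cong₂ _*_ e e) (cong (λ d → 1ℤ - d) (sym (δ-≢ x≢𝟘)))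
    ... | nonsquare x≢𝟘 _ e  = trans (cong₂ _*_ e e) (cong (λ d → 1ℤ - d) (sym (δ-≢ x≢𝟘)))

    η-𝟙 : η 𝟙 ≡ 1ℤ
    η-𝟙 = η-square 𝟙≢𝟘 (𝟙 , 𝟙⊙ 𝟙)

    -- Otherwise η would be nonnegative with total zero, hence zero everywhere, against `η 𝟙 ≡ 1ℤ`.
    ∃-nonsquare : ∃[ w ] η w ≡ -1ℤ
    ∃-nonsquare with search (λ w → η w ℤP.≟ -1ℤ)
    ... | yes found = found
    ... | no ¬found = contradiction (trans (sym η-𝟙) (∑-nonneg-zero η nonneg ∑-η 𝟙)) λ ()
      where
      nonneg : ∀ x → 0ℤ ≤ η x
      nonneg x with η-view x
      ... | zero _ e        = ≤-reflexive (sym e)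
      ... | square _ _ e    = subst (0ℤ ≤_) (sym e) (ℤ.+≤+ ℕ.z≤n)
      ... | nonsquare _ _ e = contradiction (x , e) ¬found

    -- Substituting c t for t takes out the square c², so the sum is the same for all nonzero c. Its
    -- value at `𝟘` and its total, which is zero because that of η is, then determine it.
    autocorrelation : ∀ c → ∑ (λ t → η t * η (c ⊕ ⊖ t)) ≡ η (⊖ 𝟙) * (N * δ c 𝟘 - 1ℤ)
    autocorrelation = constant-off-𝟘 S (η (⊖ 𝟙)) (S 𝟙) invariant at-𝟘 total
      where
      open ≡-Reasoning
      S : Carrier → ℤ
      S c = ∑ (λ t → η t * η (c ⊕ ⊖ t))
      invariant : ∀ c → c ≢ 𝟘 → S c ≡ S 𝟙
      invariant c c≢𝟘 = trans (sym (∑-scale c≢𝟘 (λ t → η t * η (c ⊕ ⊖ t)))) (∑-cong λ t → begin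
        η (c ⊙ t) * η (c ⊕ ⊖ (c ⊙ t))        ≡⟨ η-* (c ⊙ t) _ ⟨
        η ((c ⊙ t) ⊙ (c ⊕ ⊖ (c ⊙ t)))        ≡⟨ cong η (solve 2 (λ c t → (c :* t) :* (c :- c :* t) := (c :* c) :* (t :* (con 1ℤ :- t))) refl c t) ⟩
        η ((c ⊙ c) ⊙ (t ⊙ (𝟙 ⊕ ⊖ t)))        ≡⟨ η-square-* _ (⊙-≢𝟘 c≢𝟘 c≢𝟘) (c , refl) ⟩
        η (t ⊙ (𝟙 ⊕ ⊖ t))                    ≡⟨ η-* t _ ⟩
        η t * η (𝟙 ⊕ ⊖ t)                    ∎)
      at-𝟘 : S 𝟘 ≡ η (⊖ 𝟙) * (N - 1ℤ)
      at-𝟘 = begin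
        S 𝟘                                  ≡⟨ ∑-cong (λ t → begin
           η t * η (𝟘 ⊕ ⊖ t)                   ≡⟨ cong (λ u → η t * η u) (solve 1 (λ t → con 0ℤ :- t := (:- con 1ℤ) :* t) refl t) ⟩
           η t * η (⊖ 𝟙 ⊙ t)                   ≡⟨ cong (λ u → η t * u) (η-* (⊖ 𝟙) t) ⟩
           η t * (η (⊖ 𝟙) * η t)               ≡⟨ shuffle (η t) (η (⊖ 𝟙)) ⟩
           η (⊖ 𝟙) * (η t * η t)               ≡⟨ cong (η (⊖ 𝟙) *_) (η-² t) ⟩
           η (⊖ 𝟙) * (1ℤ - δ t 𝟘)              ∎) ⟩
        ∑ (λ t → η (⊖ 𝟙) * (1ℤ - δ t 𝟘))     ≡⟨ ∑-*ˡ (η (⊖ 𝟙)) _ ⟩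
        η (⊖ 𝟙) * ∑ (λ t → 1ℤ - δ t 𝟘)       ≡⟨ cong (η (⊖ 𝟙) *_) (trans (∑-minus _ _) (cong₂ _-_ ∑-1 (∑-δ₁ 𝟘))) ⟩
        η (⊖ 𝟙) * (N - 1ℤ)                   ∎
        where
        shuffle : ∀ a b → a * (b * a) ≡ b * (a * a)
        shuffle = solve-∀
      total : ∑ S ≡ 0ℤ
      total = begin
        ∑ (λ c → ∑ (λ t → η t * η (c ⊕ ⊖ t)))  ≡⟨ ∑-comm _ ⟩
        ∑ (λ t → ∑ (λ c → η t * η (c ⊕ ⊖ t)))  ≡⟨ ∑-zero (λ t → trans (∑-*ˡ (η t) _)
                                                     (trans (cong (η t *_) (trans (∑-translate (⊖ t) η) ∑-η)) (*-zeroʳ (η t)))) ⟩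
        0ℤ                                     ∎

  -- The prime field

  module Residues (p : ℕ) (p-prime : Prime p) (2<p : 2 ℕ.< p) where
    instance
      p-nonZero : NonZero p
      p-nonZero = prime⇒nonZero p-prime

    opaque
      [_] : ℤ → Fin p
      [ z ] = fromℕ< (n%ℕd<d z p)

      ⟨_⟩ : Fin p → ℤ
      ⟨ x ⟩ = + toℕ x

    -- The two remainders differ by less than p, so the multiple of p between them is zero.
    remainder-unique : ∀ {r s} k → r ℕ.< p → s ℕ.< p → + r ≡ + s + k * + p → r ≡ s
    remainder-unique {r} {s} k r<p s<p e = +-injective (trans e (trans (cong (λ k → + s + k * + p) k≡0) (+-identityʳ (+ s))))
      where
      difference : + r - + s ≡ k * + p
      difference = trans (cong (_- + s) e) (lemma (+ s) (k * + p))
        where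
        lemma : ∀ a b → a + b - a ≡ b
        lemma = solve-∀
      bound : ∣ k ∣ ℕ.* p ℕ.< 1 ℕ.* p
      bound = subst₂ ℕ._<_ (trans (cong ∣_∣ difference) (abs-* k (+ p))) (sym (ℕP.*-identityˡ p))
        (ℕP.≤-<-trans (subst (ℕ._≤ r ℕ.⊔ s) (cong ∣_∣ (sym (m-n≡m⊖n r s))) (∣m⊝n∣≤m⊔n r s)) (ℕP.⊔-pres-<m r<p s<p))
      k≡0 : k ≡ 0ℤ
      k≡0 = ∣i∣≡0⇒i≡0 (ℕP.n<1⇒n≡0 (ℕP.*-cancelʳ-< p ∣ k ∣ 1 bound))

    opaque
      unfolding [_] ⟨_⟩

      ⟨[_]⟩ : ∀ z → ⟨ [ z ] ⟩ ≡ z - (z /ℕ p) * + p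
      ⟨[ z ]⟩ = trans (cong +_ (toℕ-fromℕ< (n%ℕd<d z p)))
        (trans (lemma (+ (z %ℕ p)) ((z /ℕ p) * + p)) (cong (_- (z /ℕ p) * + p) (sym (a≡a%ℕn+[a/ℕn]*n z p))))
        where
        lemma : ∀ a b → a ≡ a + b - b
        lemma = solve-∀

      -- The quotient `k` is passed explicitly, so that each law for residues reduces to an identity
      -- between integers.
      []-cong : ∀ {a b} k → a ≡ b + k * + p → [ a ] ≡ [ b ]
      []-cong {a} {b} k e = toℕ-injective (remainder-unique (k + b /ℕ p - a /ℕ p) (toℕ<n [ a ]) (toℕ<n [ b ])
        (trans ⟨[ a ]⟩ (trans (cong (λ a′ → a′ - (a /ℕ p) * + p) e)
          (trans (lemma b k (b /ℕ p) (a /ℕ p) (+ p)) (cong (λ z → z + (k + b /ℕ p - a /ℕ p) * + p) (sym ⟨[ b ]⟩))))))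
        where
        lemma : ∀ b k x y p → b + k * p - y * p ≡ b - x * p + (k + x - y) * p
        lemma = solve-∀

      [⟨_⟩] : ∀ x → [ ⟨ x ⟩ ] ≡ x
      [⟨ x ⟩] = toℕ-injective (trans (toℕ-fromℕ< _) (m<n⇒m%n≡m (toℕ<n x)))

      ⟨⟩-toℕ : ∀ x → ⟨ x ⟩ ≡ + toℕ x
      ⟨⟩-toℕ x = refl

      []-small : ∀ {n} → n ℕ.< p → toℕ [ + n ] ≡ n
      []-small n<p = trans (toℕ-fromℕ< _) (m<n⇒m%n≡m n<p)

    infixl 7 _⊙_
    infixl 6 _⊕_
    infix  8 ⊖_

    _⊕_ _⊙_ : Fin p → Fin p → Fin p
    x ⊕ y = [ ⟨ x ⟩ + ⟨ y ⟩ ]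
    x ⊙ y = [ ⟨ x ⟩ * ⟨ y ⟩ ]

    ⊖_ : Fin p → Fin p
    ⊖ x = [ - ⟨ x ⟩ ]

    []-+ : ∀ a b → [ a + b ] ≡ [ a ] ⊕ [ b ]
    []-+ a b = []-cong (a /ℕ p + b /ℕ p) (trans (lemma a b (a /ℕ p) (b /ℕ p) (+ p))
      (cong (λ z → z + (a /ℕ p + b /ℕ p) * + p) (cong₂ _+_ (sym ⟨[ a ]⟩) (sym ⟨[ b ]⟩))))
      where
      lemma : ∀ a b x y p → a + b ≡ (a - x * p) + (b - y * p) + (x + y) * p
      lemma = solve-∀

    []-* : ∀ a b → [ a * b ] ≡ [ a ] ⊙ [ b ]
    []-* a b = []-cong k (trans (lemma a b (a /ℕ p) (b /ℕ p) (+ p))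
      (cong (λ z → z + k * + p) (cong₂ _*_ (sym ⟨[ a ]⟩) (sym ⟨[ b ]⟩))))
      where
      k = (a - (a /ℕ p) * + p) * (b /ℕ p) + (a /ℕ p) * b
      lemma : ∀ a b x y p → a * b ≡ (a - x * p) * (b - y * p) + ((a - x * p) * y + x * b) * p
      lemma = solve-∀

    []-neg : ∀ a → [ - a ] ≡ ⊖ [ a ]
    []-neg a = []-cong (- (a /ℕ p)) (trans (lemma a (a /ℕ p) (+ p))
      (cong (λ z → - z + (- (a /ℕ p)) * + p) (sym ⟨[ a ]⟩)))
      where
      lemma : ∀ a x p → - a ≡ - (a - x * p) + (- x) * p
      lemma = solve-∀

    private
      ⊕[] : ∀ x b → x ⊕ [ b ] ≡ [ ⟨ x ⟩ + b ]
      ⊕[] x b = trans (cong (_⊕ [ b ]) (sym [⟨ x ⟩])) (sym ([]-+ ⟨ x ⟩ b))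

      []⊕ : ∀ a y → [ a ] ⊕ y ≡ [ a + ⟨ y ⟩ ]
      []⊕ a y = trans (cong ([ a ] ⊕_) (sym [⟨ y ⟩])) (sym ([]-+ a ⟨ y ⟩))

      ⊙[] : ∀ x b → x ⊙ [ b ] ≡ [ ⟨ x ⟩ * b ]
      ⊙[] x b = trans (cong (_⊙ [ b ]) (sym [⟨ x ⟩])) (sym ([]-* ⟨ x ⟩ b))

      []⊙ : ∀ a y → [ a ] ⊙ y ≡ [ a * ⟨ y ⟩ ]
      []⊙ a y = trans (cong ([ a ] ⊙_) (sym [⟨ y ⟩])) (sym ([]-* a ⟨ y ⟩))

      []-via : ∀ {a} x → a ≡ ⟨ x ⟩ → [ a ] ≡ x
      []-via x e = trans (cong [_] e) [⟨ x ⟩]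

      ⊕-comm : ∀ x y → x ⊕ y ≡ y ⊕ x
      ⊕-comm x y = cong [_] (+-comm ⟨ x ⟩ ⟨ y ⟩)

      ⊙-comm : ∀ x y → x ⊙ y ≡ y ⊙ x
      ⊙-comm x y = cong [_] (*-comm ⟨ x ⟩ ⟨ y ⟩)

      ⊕-identityˡ : ∀ x → [ 0ℤ ] ⊕ x ≡ x
      ⊕-identityˡ x = trans ([]⊕ 0ℤ x) ([]-via x (+-identityˡ ⟨ x ⟩))

      ⊙-identityˡ : ∀ x → [ 1ℤ ] ⊙ x ≡ x
      ⊙-identityˡ x = trans ([]⊙ 1ℤ x) ([]-via x (*-identityˡ ⟨ x ⟩))

      ⊕-inverseˡ : ∀ x → ⊖ x ⊕ x ≡ [ 0ℤ ]
      ⊕-inverseˡ x = trans ([]⊕ (- ⟨ x ⟩) x) (cong [_] (+-inverseˡ ⟨ x ⟩))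

      distribˡ : ∀ x y z → x ⊙ (y ⊕ z) ≡ x ⊙ y ⊕ x ⊙ z
      distribˡ x y z = trans (⊙[] x _) (trans (cong [_] (*-distribˡ-+ ⟨ x ⟩ ⟨ y ⟩ ⟨ z ⟩)) ([]-+ _ _))

      distribʳ : ∀ x y z → (y ⊕ z) ⊙ x ≡ y ⊙ x ⊕ z ⊙ x
      distribʳ x y z = trans ([]⊙ _ x) (trans (cong [_] (*-distribʳ-+ ⟨ x ⟩ ⟨ y ⟩ ⟨ z ⟩)) ([]-+ _ _))

    isCommutativeRing : IsCommutativeRing _≡_ _⊕_ _⊙_ ⊖_ [ 0ℤ ] [ 1ℤ ]
    isCommutativeRing = record
      { isRing = record
        { +-isAbelianGroup = record
          { isGroup = record
            { isMonoid = record
              { isSemigroup = record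
                { isMagma = record { isEquivalence = isEquivalence ; ∙-cong = cong₂ _⊕_ }
                ; assoc   = λ x y z → trans ([]⊕ _ z) (trans (cong [_] (+-assoc ⟨ x ⟩ ⟨ y ⟩ ⟨ z ⟩)) (sym (⊕[] x _)))
                }
              ; identity = ⊕-identityˡ , λ x → trans (⊕-comm x _) (⊕-identityˡ x)
              }
            ; inverse = ⊕-inverseˡ , λ x → trans (⊕-comm x (⊖ x)) (⊕-inverseˡ x)
            ; ⁻¹-cong = cong ⊖_
            }
          ; comm = ⊕-comm
          }
        ; *-cong     = cong₂ _⊙_
        ; *-assoc    = λ x y z → trans ([]⊙ _ z) (trans (cong [_] (*-assoc ⟨ x ⟩ ⟨ y ⟩ ⟨ z ⟩)) (sym (⊙[] x _)))
        ; *-identity = ⊙-identityˡ , λ x → trans (⊙-comm x _) (⊙-identityˡ x)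
        ; distrib    = distribˡ , distribʳ
        }
      ; *-comm = ⊙-comm
      }

    ⊙-inverse : ∀ {x} → x ≢ [ 0ℤ ] → ∃[ y ] x ⊙ y ≡ [ 1ℤ ]
    ⊙-inverse {x} x≢0 with coprime-Bézout (prime⇒coprime p-prime {{ℕ.≢-nonZero toℕx≢0}} (toℕ<n x))
      where
      toℕx≢0 : toℕ x ≢ 0
      toℕx≢0 e = x≢0 (sym ([]-via x (trans (cong +_ (sym e)) (sym (⟨⟩-toℕ x)))))
    -- Here 1 + b x = a p, so -b inverts x modulo p; in the other orientation, 1 + a p = b x, it is
    -- b itself.
    ... | Bézout.+- a b e = [ - + b ] , trans (⊙[] x _) ([]-cong (- + a)
      (trans (cong (_* - + b) (⟨⟩-toℕ x)) (trans (negate (+ toℕ x) (+ b)) (trans (cong (λ z → 1ℤ - z)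
        (trans (cong (λ z → 1ℤ + z) (sym (pos-* b (toℕ x)))) (trans (cong +_ e) (pos-* a p)))) (negate′ (+ a) (+ p))))))
      where
      negate : ∀ x b → x * - b ≡ 1ℤ - (1ℤ + b * x)
      negate = solve-∀
      negate′ : ∀ a p → 1ℤ - a * p ≡ 1ℤ + (- a) * p
      negate′ = solve-∀
    ... | Bézout.-+ a b e = [ + b ] , trans (⊙[] x _) ([]-cong (+ a)
      (trans (cong (_* + b) (⟨⟩-toℕ x)) (trans (*-comm (+ toℕ x) (+ b)) (trans (sym (pos-* b (toℕ x)))
        (trans (cong +_ (sym e)) (cong (λ z → 1ℤ + z) (pos-* a p)))))))

    []≢0 : ∀ {n} → 0 ℕ.< n → n ℕ.< p → [ + n ] ≢ [ 0ℤ ]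
    []≢0 {n} 0<n n<p e = ℕP.<⇒≢ 0<n (sym (trans (sym ([]-small n<p)) (trans (cong toℕ e) ([]-small (ℕP.<-trans 0<n n<p)))))

    primeField : FiniteField
    primeField = record
      { Carrier = Fin p ; _⊕_ = _⊕_ ; _⊙_ = _⊙_ ; ⊖_ = ⊖_ ; fromℤ = [_]
      ; isCommutativeRing = isCommutativeRing
      ; fromℤ-+ = []-+ ; fromℤ-* = []-* ; fromℤ-neg = []-neg
      ; carrier-finite = finite (mk↔ₛ′ id id (λ _ → refl) (λ _ → refl))
      ; inverse = ⊙-inverse
      ; 𝟙≢𝟘 = []≢0 (ℕ.s≤s ℕ.z≤n) (ℕP.<-trans (ℕ.s≤s (ℕ.s≤s ℕ.z≤n)) 2<p)
      ; char≢2 = λ e → []≢0 (ℕ.s≤s ℕ.z≤n) 2<p (trans ([]-+ 1ℤ 1ℤ) e)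
      }

  -- The quadratic extension and its slopes

  module QuadraticExtension (𝔽 : FiniteField) (d : FiniteField.Carrier 𝔽) (d-nonsquare : ¬ FieldProperties.IsSquare 𝔽 d) where
    open FieldProperties 𝔽

    private instance
      Carrier-finite : Finite Carrier
      Carrier-finite = carrier-finite

    K : Set
    K = Carrier × Carrier

    infixl 7 _⊛_
    infixl 6 _⊞_
    infix  8 ⊟_

    _⊞_ _⊛_ : K → K → K
    (a , b) ⊞ (a′ , b′) = a ⊕ a′ , b ⊕ b′
    (a , b) ⊛ (a′ , b′) = a ⊙ a′ ⊕ d ⊙ (b ⊙ b′) , a ⊙ b′ ⊕ b ⊙ a′

    ⊟_ : K → K
    ⊟ (a , b) = ⊖ a , ⊖ b

    embed : Carrier → K
    embed a = a , 𝟘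

    norm : K → Carrier
    norm (a , b) = a ⊙ a ⊕ ⊖ (d ⊙ (b ⊙ b))

    isCommutativeRing′ : IsCommutativeRing _≡_ _⊞_ _⊛_ ⊟_ (embed 𝟘) (embed 𝟙)
    isCommutativeRing′ = record
      { isRing = record
        { +-isAbelianGroup = record
          { isGroup = record
            { isMonoid = record
              { isSemigroup = record
                { isMagma = record { isEquivalence = isEquivalence ; ∙-cong = cong₂ _⊞_ }
                ; assoc   = λ (a , b) (a′ , b′) (a″ , b″) → cong₂ _,_ (assoc a a′ a″) (assoc b b′ b″)
                }
              ; identity = (λ (a , b) → cong₂ _,_ (identityˡ a) (identityˡ b))
                         , (λ (a , b) → cong₂ _,_ (identityʳ a) (identityʳ b))
              }
            ; inverse = (λ (a , b) → cong₂ _,_ (inverseˡ a) (inverseˡ b))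
                      , (λ (a , b) → cong₂ _,_ (inverseʳ a) (inverseʳ b))
            ; ⁻¹-cong = cong ⊟_
            }
          ; comm = λ (a , b) (a′ , b′) → cong₂ _,_ (comm a a′) (comm b b′)
          }
        ; *-cong     = cong₂ _⊛_
        ; *-assoc    = λ (a , b) (a′ , b′) (a″ , b″) → cong₂ _,_
            (solve 7 (λ d a b a′ b′ a″ b″ →
               (a :* a′ :+ d :* (b :* b′)) :* a″ :+ d :* ((a :* b′ :+ b :* a′) :* b″)
               := a :* (a′ :* a″ :+ d :* (b′ :* b″)) :+ d :* (b :* (a′ :* b″ :+ b′ :* a″))) refl d a b a′ b′ a″ b″)
            (solve 7 (λ d a b a′ b′ a″ b″ →
               (a :* a′ :+ d :* (b :* b′)) :* b″ :+ (a :* b′ :+ b :* a′) :* a″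
               := a :* (a′ :* b″ :+ b′ :* a″) :+ b :* (a′ :* a″ :+ d :* (b′ :* b″))) refl d a b a′ b′ a″ b″)
        ; *-identity =
              (λ (a , b) → cong₂ _,_
                (solve 3 (λ d a b → con 1ℤ :* a :+ d :* (con 0ℤ :* b) := a) refl d a b)
                (solve 2 (λ a b → con 1ℤ :* b :+ con 0ℤ :* a := b) refl a b))
            , (λ (a , b) → cong₂ _,_
                (solve 3 (λ d a b → a :* con 1ℤ :+ d :* (b :* con 0ℤ) := a) refl d a b)
                (solve 2 (λ a b → a :* con 0ℤ :+ b :* con 1ℤ := b) refl a b))
        ; distrib =
              (λ (a , b) (a′ , b′) (a″ , b″) → cong₂ _,_
                (solve 7 (λ d a b a′ b′ a″ b″ → a :* (a′ :+ a″) :+ d :* (b :* (b′ :+ b″))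
                   := (a :* a′ :+ d :* (b :* b′)) :+ (a :* a″ :+ d :* (b :* b″))) refl d a b a′ b′ a″ b″)
                (solve 6 (λ a b a′ b′ a″ b″ → a :* (b′ :+ b″) :+ b :* (a′ :+ a″)
                   := (a :* b′ :+ b :* a′) :+ (a :* b″ :+ b :* a″)) refl a b a′ b′ a″ b″))
            , (λ (a , b) (a′ , b′) (a″ , b″) → cong₂ _,_
                (solve 7 (λ d a b a′ b′ a″ b″ → (a′ :+ a″) :* a :+ d :* ((b′ :+ b″) :* b)
                   := (a′ :* a :+ d :* (b′ :* b)) :+ (a″ :* a :+ d :* (b″ :* b))) refl d a b a′ b′ a″ b″)
                (solve 6 (λ a b a′ b′ a″ b″ → (a′ :+ a″) :* b :+ (b′ :+ b″) :* a
                   := (a′ :* b :+ b′ :* a) :+ (a″ :* b :+ b″ :* a)) refl a b a′ b′ a″ b″))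
        }
      ; *-comm = λ (a , b) (a′ , b′) → cong₂ _,_
          (solve 5 (λ d a b a′ b′ → a :* a′ :+ d :* (b :* b′) := a′ :* a :+ d :* (b′ :* b)) refl d a b a′ b′)
          (solve 4 (λ a b a′ b′ → a :* b′ :+ b :* a′ := a′ :* b :+ b′ :* a) refl a b a′ b′)
      }
      where
      open IsCommutativeRing isCommutativeRing using ()
        renaming (+-assoc to assoc; +-identityˡ to identityˡ; +-identityʳ to identityʳ; -‿inverseˡ to inverseˡ; -‿inverseʳ to inverseʳ; +-comm to comm)

    -- A zero norm means a² = d b². If b ≠ 0, this makes d a square; if b = 0, it forces a = 0.
    norm≢𝟘 : ∀ {z} → z ≢ embed 𝟘 → norm z ≢ 𝟘
    norm≢𝟘 {a , b} z≢𝟘 e with b ≟ 𝟘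
    ... | yes b≡𝟘 = z≢𝟘 (cong₂ _,_ (square≡𝟘 (trans aa≡dbb (trans (cong (λ b → d ⊙ (b ⊙ b)) b≡𝟘)
                      (solve 1 (λ d → d :* (con 0ℤ :* con 0ℤ) := con 0ℤ) refl d)))) b≡𝟘)
      where
      aa≡dbb : a ⊙ a ≡ d ⊙ (b ⊙ b)
      aa≡dbb = ⊖-≡𝟘 e
    ... | no b≢𝟘 = d-nonsquare (square-cancel (⊙-≢𝟘 b≢𝟘 b≢𝟘) (b , refl) (a , trans (⊖-≡𝟘 e) (⊙-comm d (b ⊙ b))))

    inverse′ : ∀ {z} → z ≢ embed 𝟘 → ∃[ z′ ] z ⊛ z′ ≡ embed 𝟙
    -- The conjugate divided by the norm.
    inverse′ {a , b} z≢𝟘 = (a ⊙ r , ⊖ (b ⊙ r)) , cong₂ _,_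
      (trans (solve 4 (λ d a b r → a :* (a :* r) :+ d :* (b :* :- (b :* r)) := (a :* a :- d :* (b :* b)) :* r) refl d a b r)
             (proj₂ (inverse (norm≢𝟘 z≢𝟘))))
      (solve 3 (λ a b r → a :* :- (b :* r) :+ b :* (a :* r) := con 0ℤ) refl a b r)
      where
      r = proj₁ (inverse (norm≢𝟘 z≢𝟘))

    extension : FiniteField
    extension = record
      { Carrier = K ; _⊕_ = _⊞_ ; _⊙_ = _⊛_ ; ⊖_ = ⊟_ ; fromℤ = embed ∘ fromℤ
      ; isCommutativeRing = isCommutativeRing′
      ; fromℤ-+ = λ a b → cong₂ _,_ (fromℤ-+ a b) (solve 0 (con 0ℤ := con 0ℤ :+ con 0ℤ) refl)
      ; fromℤ-* = λ a b → cong₂ _,_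
          (trans (fromℤ-* a b) (solve 3 (λ d x y → x :* y := x :* y :+ d :* (con 0ℤ :* con 0ℤ)) refl d (fromℤ a) (fromℤ b)))
          (solve 2 (λ x y → con 0ℤ := x :* con 0ℤ :+ con 0ℤ :* y) refl (fromℤ a) (fromℤ b))
      ; fromℤ-neg = λ a → cong₂ _,_ (fromℤ-neg a) (solve 0 (con 0ℤ := :- con 0ℤ) refl)
      ; carrier-finite = ×-finite
      ; inverse = inverse′
      ; 𝟙≢𝟘 = 𝟙≢𝟘 ∘ cong proj₁
      ; char≢2 = char≢2 ∘ cong proj₁
      }

    private module 𝕂 = FieldProperties extension

    -- If a is a nonsquare of the base field, then d a, a product of two nonsquares, is a square c²,
    -- and c/d times the adjoined root of d squares to a.
    embed-square : ∀ {a} → a ≢ 𝟘 → 𝕂.IsSquare (embed a)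
    embed-square {a} a≢𝟘 with square? a
    ... | yes (c , cc≡a) = (c , 𝟘) , cong₂ _,_
          (trans (solve 2 (λ d c → c :* c :+ d :* (con 0ℤ :* con 0ℤ) := c :* c) refl d c) cc≡a)
          (solve 1 (λ c → c :* con 0ℤ :+ con 0ℤ :* c := con 0ℤ) refl c)
    ... | no ¬s = (𝟘 , c ⊙ r) , cong₂ _,_
          (begin
            𝟘 ⊙ 𝟘 ⊕ d ⊙ ((c ⊙ r) ⊙ (c ⊙ r))   ≡⟨ solve 3 (λ d c r → con 0ℤ :* con 0ℤ :+ d :* ((c :* r) :* (c :* r)) := d :* (r :* r) :* (c :* c)) refl d c r ⟩
            d ⊙ (r ⊙ r) ⊙ (c ⊙ c)             ≡⟨ cong (d ⊙ (r ⊙ r) ⊙_) cc≡da ⟩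
            d ⊙ (r ⊙ r) ⊙ (d ⊙ a)             ≡⟨ solve 3 (λ d r a → d :* (r :* r) :* (d :* a) := (d :* r) :* (d :* r) :* a) refl d r a ⟩
            (d ⊙ r) ⊙ (d ⊙ r) ⊙ a             ≡⟨ cong (λ u → u ⊙ u ⊙ a) dr≡𝟙 ⟩
            𝟙 ⊙ 𝟙 ⊙ a                         ≡⟨ solve 1 (λ a → con 1ℤ :* con 1ℤ :* a := a) refl a ⟩
            a                                 ∎)
          (solve 2 (λ c r → con 0ℤ :* (c :* r) :+ (c :* r) :* con 0ℤ := con 0ℤ) refl c r)
      where
      open ≡-Reasoning
      d≢𝟘 : d ≢ 𝟘
      d≢𝟘 p = d-nonsquare (𝟘 , trans (𝟘⊙ 𝟘) (sym p))
      r = proj₁ (inverse d≢𝟘)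
      dr≡𝟙 = proj₂ (inverse d≢𝟘)
      da-square : IsSquare (d ⊙ a)
      da-square with η-view (d ⊙ a)
      ... | zero p _        = contradiction (cancel d≢𝟘 p) a≢𝟘
      ... | square _ s _    = s
      ... | nonsquare _ _ e = contradiction (trans (sym e) (trans (η-* d a)
                                (cong₂ _*_ (η-nonsquare d≢𝟘 d-nonsquare) (η-nonsquare a≢𝟘 ¬s)))) λ ()
      c = proj₁ da-square
      cc≡da = proj₂ da-square

    η-embed : ∀ {a} → a ≢ 𝟘 → 𝕂.η (embed a) ≡ 1ℤ
    η-embed a≢𝟘 = 𝕂.η-square (a≢𝟘 ∘ cong proj₁) (embed-square a≢𝟘)

    -- This makes η an even function, from which the symmetry of the matrices comes.
    η-⊖𝟙 : 𝕂.η (⊟ embed 𝟙) ≡ 1ℤ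
    η-⊖𝟙 = trans (cong (λ b → 𝕂.η (⊖ 𝟙 , b)) (solve 0 (:- con 0ℤ := con 0ℤ) refl)) (η-embed ⊖𝟙≢𝟘)

    module Slopes (w₁ w₂ : Carrier) (η-w : 𝕂.η (w₁ , w₂) ≡ -1ℤ) where

      -- On the base field η is never -1, so w lies outside it. Hence 1 and w form a basis, and each
      -- element of 𝕂 is a slope x + y w for exactly one pair.
      w₂≢𝟘 : w₂ ≢ 𝟘
      w₂≢𝟘 p with w₁ ≟ 𝟘
      ... | yes q = contradiction (trans (sym η-w) (trans (cong 𝕂.η (cong₂ _,_ q p)) 𝕂.η-𝟘)) λ ()
      ... | no ¬q = contradiction (trans (sym η-w) (trans (cong (λ b → 𝕂.η (w₁ , b)) p) (η-embed ¬q))) λ ()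

      slope : K → K
      slope (x , y) = x ⊕ y ⊙ w₁ , y ⊙ w₂

      slope↔ : K ↔ K
      slope↔ = mk↔ₛ′ slope (λ (a , b) → a ⊕ ⊖ (b ⊙ r ⊙ w₁) , b ⊙ r)
        (λ (a , b) → cong₂ _,_
          (solve 3 (λ a c w → (a :- c :* w) :+ c :* w := a) refl a (b ⊙ r) w₁)
          (trans (solve 3 (λ b r w → b :* r :* w := w :* r :* b) refl b r w₂) (trans (cong (_⊙ b) wr≡𝟙) (𝟙⊙ b))))
        (λ (x , y) → cong₂ _,_
          (trans (solve 5 (λ x y r v w → (x :+ y :* v) :- y :* w :* r :* v := (x :+ y :* v) :- w :* r :* y :* v) refl x y r w₁ w₂)
            (trans (cong (λ u → (x ⊕ y ⊙ w₁) ⊕ ⊖ (u ⊙ y ⊙ w₁)) wr≡𝟙)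
              (solve 3 (λ x y v → (x :+ y :* v) :- con 1ℤ :* y :* v := x) refl x y w₁)))
          (trans (solve 3 (λ y r w → y :* w :* r := w :* r :* y) refl y r w₂) (trans (cong (_⊙ y) wr≡𝟙) (𝟙⊙ y))))
        where
        r = proj₁ (inverse w₂≢𝟘)
        wr≡𝟙 = proj₂ (inverse w₂≢𝟘)

      slope-sub : ∀ x y x′ y′ → slope (x , y) ⊞ ⊟ slope (x′ , y′) ≡ slope (x ⊕ ⊖ x′ , y ⊕ ⊖ y′)
      slope-sub x y x′ y′ = cong₂ _,_
        (solve 5 (λ x y x′ y′ v → (x :+ y :* v) :- (x′ :+ y′ :* v) := (x :- x′) :+ (y :- y′) :* v) refl x y x′ y′ w₁)
        (solve 3 (λ y y′ w → y :* w :- y′ :* w := (y :- y′) :* w) refl y y′ w₂)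

      η-slope-scale : ∀ {c} → c ≢ 𝟘 → ∀ x y → 𝕂.η (slope (c ⊙ x , c ⊙ y)) ≡ 𝕂.η (slope (x , y))
      η-slope-scale {c} c≢𝟘 x y = trans
        (cong 𝕂.η (cong₂ _,_
          (solve 6 (λ d c x y v w → c :* x :+ c :* y :* v := c :* (x :+ y :* v) :+ d :* (con 0ℤ :* (y :* w))) refl d c x y w₁ w₂)
          (solve 5 (λ c x y v w → c :* y :* w := c :* (y :* w) :+ con 0ℤ :* (x :+ y :* v)) refl c x y w₁ w₂)))
        (𝕂.η-square-* (slope (x , y)) (c≢𝟘 ∘ cong proj₁) (embed-square c≢𝟘))

      ∑-slope : ∀ h → ∑ (λ x → ∑ (λ y → h (slope (x , y)))) ≡ ∑ h
      ∑-slope h = trans (sym (∑-× (h ∘ slope))) (∑-reindex slope↔ h)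

      -- For y = 0 the slopes run over the base field, where η is 1 except at zero. Scaling by the
      -- base field preserves η, so the sums for y ≠ 0 agree with each other, and the zero total of
      -- η gives their value.
      ∑-η-slope₁ : ∀ y → ∑ (λ x → 𝕂.η (slope (x , y))) ≡ N * δ y 𝟘 - 1ℤ
      ∑-η-slope₁ y = trans (constant-off-𝟘 g 1ℤ (g 𝟙) invariant at-𝟘 total y) (*-identityˡ _)
        where
        g : Carrier → ℤ
        g y = ∑ (λ x → 𝕂.η (slope (x , y)))
        invariant : ∀ c → c ≢ 𝟘 → g c ≡ g 𝟙
        invariant c c≢𝟘 = trans (sym (∑-scale c≢𝟘 (λ x → 𝕂.η (slope (x , c))))) (∑-cong λ x →
          trans (cong (λ y → 𝕂.η (slope (c ⊙ x , y))) (solve 1 (λ c → c := c :* con 1ℤ) refl c)) (η-slope-scale c≢𝟘 x 𝟙))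
        at-𝟘 : g 𝟘 ≡ 1ℤ * (N - 1ℤ)
        at-𝟘 = trans (∑-cong pointwise) (trans (∑-minus _ _) (trans (cong₂ _-_ ∑-1 (∑-δ₁ 𝟘)) (sym (*-identityˡ _))))
          where
          pointwise : ∀ x → 𝕂.η (slope (x , 𝟘)) ≡ 1ℤ - δ x 𝟘
          pointwise x with x ≟ 𝟘
          ... | yes p = trans (cong 𝕂.η (cong₂ _,_ (trans (cong (_⊕ 𝟘 ⊙ w₁) p) (solve 1 (λ v → con 0ℤ :+ con 0ℤ :* v := con 0ℤ) refl w₁)) (𝟘⊙ w₂)))
                        (trans 𝕂.η-𝟘 (cong (λ z → 1ℤ - z) (sym (δ-≡ p))))
          ... | no ¬p = trans (cong 𝕂.η (cong₂ _,_ (solve 2 (λ x v → x :+ con 0ℤ :* v := x) refl x w₁) (𝟘⊙ w₂)))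
                        (trans (η-embed ¬p) (cong (λ z → 1ℤ - z) (sym (δ-≢ ¬p))))
        total : ∑ g ≡ 0ℤ
        total = trans (∑-comm _) (trans (∑-slope 𝕂.η) 𝕂.∑-η)

      -- For x = 0 the slopes are the multiples y w, where η is -1 except at zero; this reverses the
      -- sign of the preceding sum.
      ∑-η-slope₂ : ∀ x → ∑ (λ y → 𝕂.η (slope (x , y))) ≡ 1ℤ - N * δ x 𝟘
      ∑-η-slope₂ x = trans (constant-off-𝟘 g -1ℤ (g 𝟙) invariant at-𝟘 total x) (lemma (N * δ x 𝟘))
        where
        lemma : ∀ a → -1ℤ * (a - 1ℤ) ≡ 1ℤ - a
        lemma = solve-∀
        g : Carrier → ℤ
        g x = ∑ (λ y → 𝕂.η (slope (x , y)))
        invariant : ∀ c → c ≢ 𝟘 → g c ≡ g 𝟙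
        invariant c c≢𝟘 = trans (sym (∑-scale c≢𝟘 (λ y → 𝕂.η (slope (c , y))))) (∑-cong λ y →
          trans (cong (λ x → 𝕂.η (slope (x , c ⊙ y))) (solve 1 (λ c → c := c :* con 1ℤ) refl c)) (η-slope-scale c≢𝟘 𝟙 y))
        at-𝟘 : g 𝟘 ≡ -1ℤ * (N - 1ℤ)
        at-𝟘 = trans (∑-cong pointwise) (trans (∑-*ˡ -1ℤ _)
          (cong (-1ℤ *_) (trans (∑-minus _ _) (cong₂ _-_ ∑-1 (∑-δ₁ 𝟘)))))
          where
          pointwise : ∀ y → 𝕂.η (slope (𝟘 , y)) ≡ -1ℤ * (1ℤ - δ y 𝟘)
          pointwise y with y ≟ 𝟘
          ... | yes p = trans (cong 𝕂.η (cong₂ _,_ (trans (cong (λ y → 𝟘 ⊕ y ⊙ w₁) p) (solve 1 (λ v → con 0ℤ :+ con 0ℤ :* v := con 0ℤ) refl w₁))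
                          (trans (cong (_⊙ w₂) p) (𝟘⊙ w₂))))
                        (trans 𝕂.η-𝟘 (cong (λ z → -1ℤ * (1ℤ - z)) (sym (δ-≡ p))))
          ... | no ¬p = trans (trans (cong 𝕂.η (cong₂ _,_
                          (solve 4 (λ d y v w → con 0ℤ :+ y :* v := y :* v :+ d :* (con 0ℤ :* w)) refl d y w₁ w₂)
                          (solve 3 (λ y v w → y :* w := y :* w :+ con 0ℤ :* v) refl y w₁ w₂)))
                          (trans (𝕂.η-square-* (w₁ , w₂) (¬p ∘ cong proj₁) (embed-square ¬p)) η-w))
                        (cong (λ z → -1ℤ * (1ℤ - z)) (sym (δ-≢ ¬p)))
        total : ∑ g ≡ 0ℤ
        total = trans (∑-slope 𝕂.η) 𝕂.∑-η

  -- Lines of the affine plane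

  sgn : Bool → ℤ
  sgn false = 1ℤ
  sgn true  = -1ℤ

  record Coordinates (𝔽 𝕂 : FiniteField) : Set where
    private
      module F = FieldProperties 𝔽
      module K = FieldProperties 𝕂
      instance
        F-finite : Finite F.Carrier
        F-finite = F.carrier-finite
    -- The intended slope x y is x + y w, for a nonsquare w of 𝕂.
    field
      slope↔ : (F.Carrier × F.Carrier) ↔ K.Carrier

    slope : F.Carrier → F.Carrier → K.Carrier
    slope x y = Inverse.to slope↔ (x , y)

    field
      slope-sub  : ∀ x y x′ y′ → slope x y K.⊕ K.⊖ slope x′ y′ ≡ slope (x F.⊕ F.⊖ x′) (y F.⊕ F.⊖ y′)
      ∑-η-slope₁ : ∀ y → ∑ (λ x → K.η (slope x y)) ≡ F.N * δ y F.𝟘 - 1ℤ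
      ∑-η-slope₂ : ∀ x → ∑ (λ y → K.η (slope x y)) ≡ 1ℤ - F.N * δ x F.𝟘
      η-⊖𝟙       : K.η (K.⊖ K.𝟙) ≡ 1ℤ

  -- Weights supported on ε x = ε y involve the factor (1 + ε x ε y) / 2. With the extra sign ν x ν
  -- y their total is half of (Σ ν)² + (Σ εν)², which the last two conditions make 1; without that
  -- sign it would be of the order of the number of slopes.
  record Signs (A : Set) {{F : Finite A}} : Set where
    field
      ε ν  : A → Bool
      ∑-ε  : ∑ (λ x → sgn (ε x)) ≡ 1ℤ
      ∑-ν  : ∑ (λ x → sgn (ν x)) * ∑ (λ x → sgn (ν x)) ≡ 1ℤ
      ∑-εν : ∑ (λ x → sgn (ε x) * sgn (ν x)) * ∑ (λ x → sgn (ε x) * sgn (ν x)) ≡ 1ℤ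

  module Directions (𝔽 𝕂 : FiniteField) (coordinates : Coordinates 𝔽 𝕂) where
    private module F = FieldProperties 𝔽
    open FieldProperties 𝕂
    open Coordinates coordinates

    private instance
      F-finite : Finite F.Carrier
      F-finite = F.carrier-finite
      K-finite : Finite Carrier
      K-finite = carrier-finite

    V : Set
    V = Carrier × Carrier

    Direction : Set
    Direction = Maybe (F.Carrier × F.Carrier)

    infixl 6 _⊟_
    _⊟_ : V → V → V
    (a , b) ⊟ (a′ , b′) = a ⊕ ⊖ a′ , b ⊕ ⊖ b′

    -- One linear form for each direction: its kernel is the vertical line for `nothing`, and the
    -- line through the origin with the given slope otherwise.
    ℓ : Direction → V → Carrier
    ℓ nothing        (a , b) = a
    ℓ (just (x , y)) (a , b) = b ⊕ ⊖ (slope x y ⊙ a)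

    ℓ-⊟ : ∀ j v w → ℓ j (v ⊟ w) ≡ ℓ j v ⊕ ⊖ ℓ j w
    ℓ-⊟ nothing        (a , b) (a′ , b′) = refl
    ℓ-⊟ (just (x , y)) (a , b) (a′ , b′) =
      solve 5 (λ s a b a′ b′ → (b :- b′) :- s :* (a :- a′) := (b :- s :* a) :- (b′ :- s :* a′)) refl (slope x y) a b a′ b′

    ∑-slope : ∀ h → ∑ (λ ((x , y) : F.Carrier × F.Carrier) → h (slope x y)) ≡ ∑ h
    ∑-slope h = ∑-reindex slope↔ h

    q n : ℤ
    q = F.N
    n = N

    n≡q² : n ≡ q * q
    n≡q² = begin
      n                                            ≡⟨ ∑-1 ⟨
      ∑ (λ (_ : Carrier) → 1ℤ)                     ≡⟨ ∑-slope (λ _ → 1ℤ) ⟨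
      ∑ (λ (_ : F.Carrier × F.Carrier) → 1ℤ)       ≡⟨ ∑-× _ ⟩
      ∑ (λ (_ : F.Carrier) → ∑ (λ (_ : F.Carrier) → 1ℤ)) ≡⟨ trans (∑-cong (λ _ → ∑-1)) (∑-const q) ⟩
      q * q                                        ∎
      where open ≡-Reasoning

    ∑-ℓ : ∀ j (h : Carrier → ℤ) → ∑ (h ∘ ℓ j) ≡ n * ∑ h
    ∑-ℓ nothing        h = trans (∑-× _) (trans (∑-cong λ a → ∑-const (h a)) (∑-*ˡ n h))
    ∑-ℓ (just (x , y)) h = trans (∑-× _) (trans (∑-cong λ a → ∑-translate (⊖ (slope x y ⊙ a)) h) (∑-const (∑ h)))

    slope-injective : ∀ {x y x′ y′} → slope x y ≡ slope x′ y′ → (x , y) ≡ (x′ , y′)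
    slope-injective e = trans (sym (Inverse.strictlyInverseʳ slope↔ _)) (trans (cong (Inverse.from slope↔) e) (Inverse.strictlyInverseʳ slope↔ _))

    -- Forms of two different directions are coordinates of the plane, so their values run over all
    -- pairs independently.
    ∑-ℓ-independent : ∀ i j → i ≢ j → ∀ (f g : Carrier → ℤ) c →
      ∑ (λ v → f (ℓ i v) * g (c ⊕ ⊖ ℓ j v)) ≡ ∑ f * ∑ g
    ∑-ℓ-independent nothing nothing i≢j f g c = contradiction refl i≢j
    ∑-ℓ-independent nothing (just (x , y)) _ f g c = trans (∑-× _)
      (trans (∑-cong λ a → trans (∑-*ˡ (f a) _) (cong (f a *_) (trans
        (∑-cong λ b → cong g (solve 3 (λ c b s → c :- (b :- s) := (c :+ s) :- b) refl c b (slope x y ⊙ a)))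
        (∑-reflect (c ⊕ slope x y ⊙ a) g))))
      (∑-*ʳ (∑ g) f))
    ∑-ℓ-independent (just (x , y)) nothing _ f g c = trans (∑-× _)
      (trans (∑-cong λ a → trans (∑-*ʳ (g (c ⊕ ⊖ a)) _) (cong (_* g (c ⊕ ⊖ a)) (∑-translate (⊖ (slope x y ⊙ a)) f)))
      (trans (∑-*ˡ (∑ f) _) (cong (∑ f *_) (∑-reflect c g))))
    ∑-ℓ-independent (just (x , y)) (just (x′ , y′)) i≢j f g c = begin
      ∑ (λ v → f (ℓ (just (x , y)) v) * g (c ⊕ ⊖ ℓ (just (x′ , y′)) v))            ≡⟨ ∑-× _ ⟩
      ∑ (λ a → ∑ (λ b → f (b ⊕ ⊖ (s ⊙ a)) * g (c ⊕ ⊖ (b ⊕ ⊖ (s′ ⊙ a)))))            ≡⟨ ∑-cong (λ a → ∑-cong λ b → cong (λ u → f (b ⊕ ⊖ (s ⊙ a)) * g u)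
                                                                                        (solve 5 (λ c b s s′ a → c :- (b :- s′ :* a) := (c :- (b :- s :* a)) :+ (s′ :- s) :* a) refl c b s s′ a)) ⟩
      -- After the shift of b by s a, the first factor is free of a, while a enters the second one
      -- with the nonzero factor s′ - s.
      ∑ (λ a → ∑ (λ b → f (b ⊕ ⊖ (s ⊙ a)) * g (c ⊕ ⊖ (b ⊕ ⊖ (s ⊙ a)) ⊕ (s′ ⊕ ⊖ s) ⊙ a))) ≡⟨ ∑-cong (λ a → ∑-translate (⊖ (s ⊙ a)) (λ b → f b * g (c ⊕ ⊖ b ⊕ (s′ ⊕ ⊖ s) ⊙ a))) ⟩
      ∑ (λ a → ∑ (λ b → f b * g (c ⊕ ⊖ b ⊕ (s′ ⊕ ⊖ s) ⊙ a)))                         ≡⟨ ∑-comm _ ⟩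
      ∑ (λ b → ∑ (λ a → f b * g (c ⊕ ⊖ b ⊕ (s′ ⊕ ⊖ s) ⊙ a)))                         ≡⟨ ∑-cong (λ b → trans (∑-*ˡ (f b) _) (cong (f b *_) (∑-affine (c ⊕ ⊖ b) s′-s≢𝟘 g))) ⟩
      ∑ (λ b → f b * ∑ g)                                                            ≡⟨ ∑-*ʳ (∑ g) f ⟩
      ∑ f * ∑ g                                                                      ∎
      where
      open ≡-Reasoning
      s = slope x y
      s′ = slope x′ y′
      s′-s≢𝟘 : s′ ⊕ ⊖ s ≢ 𝟘
      s′-s≢𝟘 e = i≢j (cong just (slope-injective (sym (⊖-≡𝟘 e))))

    V-𝟘 : V
    V-𝟘 = 𝟘 , 𝟘

    -- If a ≠ 0, the only line through the point has slope b / a. If a = 0, the vertical line passes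
    -- through it, and the others do so all or not at all, according to b.
    ∑-lines : ∀ v → ∑ (λ j → δ (ℓ j v) 𝟘) ≡ 1ℤ + n * δ v V-𝟘
    ∑-lines (a , b) with a ≟ 𝟘
    ... | no a≢𝟘 = begin
      ∑ (λ j → δ (ℓ j (a , b)) 𝟘)                               ≡⟨ ∑-Maybe _ ⟩
      δ a 𝟘 + ∑ (λ (x , y) → δ (b ⊕ ⊖ (slope x y ⊙ a)) 𝟘)        ≡⟨ cong₂ _+_ (δ-≢ a≢𝟘) (∑-slope (λ s → δ (b ⊕ ⊖ (s ⊙ a)) 𝟘)) ⟩
      0ℤ + ∑ (λ s → δ (b ⊕ ⊖ (s ⊙ a)) 𝟘)                         ≡⟨ cong (λ z → 0ℤ + z) (∑-cong λ s → cong (λ u → δ u 𝟘) (solve 3 (λ a b s → b :- s :* a := b :+ (:- a) :* s) refl a b s)) ⟩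
      0ℤ + ∑ (λ s → δ (b ⊕ (⊖ a) ⊙ s) 𝟘)                         ≡⟨ cong (λ z → 0ℤ + z) (trans (∑-affine b ⊖a≢𝟘 (λ t → δ t 𝟘)) (∑-δ₁ 𝟘)) ⟩
      1ℤ                                                         ≡⟨ cong (λ z → 1ℤ + z) (trans (cong (n *_) (δ-≢ (a≢𝟘 ∘ cong proj₁))) (*-zeroʳ n)) ⟨
      1ℤ + n * δ (a , b) V-𝟘                                     ∎
      where
      open ≡-Reasoning
      ⊖a≢𝟘 : ⊖ a ≢ 𝟘
      ⊖a≢𝟘 e = a≢𝟘 (trans (solve 1 (λ a → a := :- (:- a)) refl a) (trans (cong ⊖_ e) (solve 0 (:- con 0ℤ := con 0ℤ) refl)))
    ... | yes a≡𝟘 = begin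
      ∑ (λ j → δ (ℓ j (a , b)) 𝟘)                               ≡⟨ ∑-Maybe _ ⟩
      δ a 𝟘 + ∑ (λ (x , y) → δ (b ⊕ ⊖ (slope x y ⊙ a)) 𝟘)        ≡⟨ cong₂ _+_ (δ-≡ a≡𝟘) (∑-slope (λ s → δ (b ⊕ ⊖ (s ⊙ a)) 𝟘)) ⟩
      1ℤ + ∑ (λ s → δ (b ⊕ ⊖ (s ⊙ a)) 𝟘)                         ≡⟨ cong (λ z → 1ℤ + z) (∑-cong λ s → cong (λ u → δ u 𝟘)
                                                                      (trans (cong (λ a → b ⊕ ⊖ (s ⊙ a)) a≡𝟘) (solve 2 (λ b s → b :- s :* con 0ℤ := b) refl b s))) ⟩
      1ℤ + ∑ (λ (_ : Carrier) → δ b 𝟘)                           ≡⟨ cong (λ z → 1ℤ + z) (trans (∑-const (δ b 𝟘)) (cong (n *_) (same (b ≟ 𝟘)))) ⟩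
      1ℤ + n * δ (a , b) V-𝟘                                     ∎
      where
      open ≡-Reasoning
      same : Dec (b ≡ 𝟘) → δ b 𝟘 ≡ δ (a , b) V-𝟘
      same (yes e) = trans (δ-≡ e) (sym (δ-≡ (cong₂ _,_ a≡𝟘 e)))
      same (no ¬e) = trans (δ-≢ ¬e) (sym (δ-≢ (¬e ∘ cong proj₂)))

    φ : ℤ → ℤ → Carrier → ℤ
    φ m e t = m * η t + e * δ t 𝟘

    ∑-φ : ∀ m e → ∑ (φ m e) ≡ e
    ∑-φ m e = trans (∑-+ _ _) (trans (cong₂ _+_ (trans (∑-*ˡ m η) (cong (m *_) ∑-η)) (trans (∑-*ˡ e _) (cong (e *_) (∑-δ₁ 𝟘))))
      (lemma m e))
      where
      lemma : ∀ m e → m * 0ℤ + e * 1ℤ ≡ e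
      lemma = solve-∀

    -- The point mass is the unit of convolution, and η convolved with itself is n δ - 1, since η
    -- (-1) = 1.
    φ-convolution : ∀ m e m′ e′ c → ∑ (λ t → φ m e t * φ m′ e′ (c ⊕ ⊖ t)) ≡
      m * m′ * (n * δ c 𝟘 - 1ℤ) + (m * e′ + e * m′) * η c + e * e′ * δ c 𝟘
    φ-convolution m e m′ e′ c = begin
      ∑ (λ t → φ m e t * φ m′ e′ (c ⊕ ⊖ t))
        ≡⟨ ∑-cong (λ t → expand m e m′ e′ (η t) (δ t 𝟘) (η (c ⊕ ⊖ t)) (δ (c ⊕ ⊖ t) 𝟘)) ⟩
      ∑ (λ t → m * m′ * (η t * η (c ⊕ ⊖ t)) + m * e′ * (η t * δ (c ⊕ ⊖ t) 𝟘) + δ t 𝟘 * (e * φ m′ e′ (c ⊕ ⊖ t)))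
        ≡⟨ trans (∑-+ _ _) (cong₂ _+_ (∑-+ _ _) refl) ⟩
      ∑ (λ t → m * m′ * (η t * η (c ⊕ ⊖ t))) + ∑ (λ t → m * e′ * (η t * δ (c ⊕ ⊖ t) 𝟘)) + ∑ (λ t → δ t 𝟘 * (e * φ m′ e′ (c ⊕ ⊖ t)))
        ≡⟨ cong₂ _+_ (cong₂ _+_ (trans (∑-*ˡ (m * m′) _) (cong (m * m′ *_) (trans (autocorrelation c) (trans (cong (_* (n * δ c 𝟘 - 1ℤ)) η-⊖𝟙) (*-identityˡ _)))))
                                (trans (∑-*ˡ (m * e′) _) (cong (m * e′ *_) at-c)))
                     (∑-δ 𝟘 (λ t → e * φ m′ e′ (c ⊕ ⊖ t))) ⟩
      m * m′ * (n * δ c 𝟘 - 1ℤ) + m * e′ * η c + e * φ m′ e′ (c ⊕ ⊖ 𝟘)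
        ≡⟨ cong (λ u → m * m′ * (n * δ c 𝟘 - 1ℤ) + m * e′ * η c + e * φ m′ e′ u) (solve 1 (λ c → c :- con 0ℤ := c) refl c) ⟩
      m * m′ * (n * δ c 𝟘 - 1ℤ) + m * e′ * η c + e * φ m′ e′ c
        ≡⟨ collect m e m′ e′ (n * δ c 𝟘 - 1ℤ) (η c) (δ c 𝟘) ⟩
      m * m′ * (n * δ c 𝟘 - 1ℤ) + (m * e′ + e * m′) * η c + e * e′ * δ c 𝟘 ∎
      where
      open ≡-Reasoning
      expand : ∀ m e m′ e′ h d h′ d′ → (m * h + e * d) * (m′ * h′ + e′ * d′) ≡ m * m′ * (h * h′) + m * e′ * (h * d′) + d * (e * (m′ * h′ + e′ * d′))
      expand = solve-∀
      collect : ∀ m e m′ e′ x h d → m * m′ * x + m * e′ * h + e * (m′ * h + e′ * d) ≡ m * m′ * x + (m * e′ + e * m′) * h + e * e′ * d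
      collect = solve-∀
      at-c : ∑ (λ t → η t * δ (c ⊕ ⊖ t) 𝟘) ≡ η c
      at-c = trans (∑-single c _ λ t t≢c → trans (cong (η t *_) (δ-≢ (λ e → t≢c (sym (⊖-≡𝟘 e))))) (*-zeroʳ (η t)))
        (trans (cong (η c *_) (δ-≡ (solve 1 (λ c → c :- c := con 0ℤ) refl c))) (*-identityʳ (η c)))

    -- Only the terms with equal directions deviate from the product of the totals.
    line-functions-convolution : ∀ (Φ Φ′ : Direction → Carrier → ℤ) w →
      ∑ (λ v → ∑ (λ i → Φ i (ℓ i v)) * ∑ (λ j → Φ′ j (ℓ j (w ⊟ v)))) ≡
      ∑ (λ i → ∑ (Φ i)) * ∑ (λ j → ∑ (Φ′ j)) + ∑ (λ i → n * ∑ (λ t → Φ i t * Φ′ i (ℓ i w ⊕ ⊖ t)) - ∑ (Φ i) * ∑ (Φ′ i))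
    line-functions-convolution Φ Φ′ w = begin
      ∑ (λ v → ∑ (λ i → Φ i (ℓ i v)) * ∑ (λ j → Φ′ j (ℓ j (w ⊟ v))))
        ≡⟨ ∑-cong (λ v → sym (∑-∑-* (λ i → Φ i (ℓ i v)) (λ j → Φ′ j (ℓ j (w ⊟ v))))) ⟩
      ∑ (λ v → ∑ (λ i → ∑ (λ j → Φ i (ℓ i v) * Φ′ j (ℓ j (w ⊟ v)))))
        ≡⟨ trans (∑-comm (λ v i → ∑ (λ j → Φ i (ℓ i v) * Φ′ j (ℓ j (w ⊟ v)))))
                 (∑-cong λ i → ∑-comm (λ v j → Φ i (ℓ i v) * Φ′ j (ℓ j (w ⊟ v)))) ⟩
      ∑ (λ i → ∑ (λ j → ∑ (λ v → Φ i (ℓ i v) * Φ′ j (ℓ j (w ⊟ v)))))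
        ≡⟨ ∑-cong (λ i → ∑-cong λ j → trans (∑-cong λ v → cong (λ u → Φ i (ℓ i v) * Φ′ j u) (ℓ-⊟ j w v)) (term i j)) ⟩
      ∑ (λ i → ∑ (λ j → ∑ (Φ i) * ∑ (Φ′ j) + δ j i * D i))
        ≡⟨ ∑-cong (λ i → trans (∑-+ (λ j → ∑ (Φ i) * ∑ (Φ′ j)) (λ j → δ j i * D i))
                               (cong (λ z → ∑ (λ j → ∑ (Φ i) * ∑ (Φ′ j)) + z) (∑-δ i (λ _ → D i)))) ⟩
      ∑ (λ i → ∑ (λ j → ∑ (Φ i) * ∑ (Φ′ j)) + D i)
        ≡⟨ trans (∑-+ (λ i → ∑ (λ j → ∑ (Φ i) * ∑ (Φ′ j))) D) (cong (λ z → z + ∑ D) (∑-∑-* (λ i → ∑ (Φ i)) (λ j → ∑ (Φ′ j)))) ⟩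
      ∑ (λ i → ∑ (Φ i)) * ∑ (λ j → ∑ (Φ′ j)) + ∑ D ∎
      where
      open ≡-Reasoning
      D : Direction → ℤ
      D i = n * ∑ (λ t → Φ i t * Φ′ i (ℓ i w ⊕ ⊖ t)) - ∑ (Φ i) * ∑ (Φ′ i)
      same : ∀ x y → x ≡ y + 1ℤ * (x - y)
      same = solve-∀
      different : ∀ x y → x ≡ x + 0ℤ * y
      different = solve-∀
      term : ∀ i j → ∑ (λ v → Φ i (ℓ i v) * Φ′ j (ℓ j w ⊕ ⊖ ℓ j v)) ≡ ∑ (Φ i) * ∑ (Φ′ j) + δ j i * D i
      term i j with j ≟ i
      ... | yes refl = trans (∑-ℓ i (λ t → Φ i t * Φ′ i (ℓ i w ⊕ ⊖ t)))
            (trans (same _ (∑ (Φ i) * ∑ (Φ′ i))) (cong (λ d → ∑ (Φ i) * ∑ (Φ′ i) + d * D i) (sym (δ-≡ {x = i} refl))))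
      ... | no j≢i   = trans (∑-ℓ-independent i j (j≢i ∘ sym) (Φ i) (Φ′ j) (ℓ j w))
            (trans (different _ (D i)) (cong (λ d → ∑ (Φ i) * ∑ (Φ′ j) + d * D i) (sym (δ-≢ j≢i))))

  -- With h and d standing for η and δ at a point, this is the contribution of one direction.
  -- Because the point masses are weighted by q, the square root of n, their product g g′ joins m m′
  -- in one coefficient, and only the mixed products go with h. Removing the product of the totals
  -- supplies the missing -1 beside n d.
  spectral-identity : ∀ n q m g m′ g′ h d → n ≡ q * q →
    n * (m * m′ * (n * d - 1ℤ) + (m * (q * g′) + (q * g) * m′) * h + (q * g) * (q * g′) * d) - (q * g) * (q * g′)
    ≡ n * (m * m′ + g * g′) * (n * d - 1ℤ) + n * q * (m * g′ + g * m′) * h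
  spectral-identity n q m g m′ g′ h d n≡q² = trans
    (regroup n q m g m′ g′ h d)
    (trans (cong (λ s → n * (m * m′ * (n * d - 1ℤ) + q * (m * g′ + g * m′) * h + s * (g * g′) * d) - s * (g * g′)) (sym n≡q²))
           (collect n q m g m′ g′ h d))
    where
    regroup : ∀ n q m g m′ g′ h d →
      n * (m * m′ * (n * d - 1ℤ) + (m * (q * g′) + (q * g) * m′) * h + (q * g) * (q * g′) * d) - (q * g) * (q * g′)
      ≡ n * (m * m′ * (n * d - 1ℤ) + q * (m * g′ + g * m′) * h + q * q * (g * g′) * d) - q * q * (g * g′)
    regroup = solve-∀
    collect : ∀ n q m g m′ g′ h d →
      n * (m * m′ * (n * d - 1ℤ) + q * (m * g′ + g * m′) * h + n * (g * g′) * d) - n * (g * g′)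
      ≡ n * (m * m′ + g * g′) * (n * d - 1ℤ) + n * q * (m * g′ + g * m′) * h
    collect = solve-∀

  -- Convolution of weighted combinations of line functions

  module Combinations (𝔽 𝕂 : FiniteField) (coordinates : Coordinates 𝔽 𝕂) where
    open FieldProperties 𝕂
    open Coordinates coordinates
    open Directions 𝔽 𝕂 coordinates

    private instance
      F-finite : Finite (FiniteField.Carrier 𝔽)
      F-finite = FiniteField.carrier-finite 𝔽
      K-finite : Finite Carrier
      K-finite = carrier-finite

    opaque
      combination : (Direction → ℤ) → (Direction → ℤ) → V → ℤ
      combination m γ v = ∑ (λ j → φ (m j) (q * γ j) (ℓ j v))

      combination-def : ∀ m γ v → combination m γ v ≡ ∑ (λ j → m j * η (ℓ j v)) + q * ∑ (λ j → γ j * δ (ℓ j v) 𝟘)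
      combination-def m γ v = trans (∑-+ (λ j → m j * η (ℓ j v)) (λ j → q * γ j * δ (ℓ j v) 𝟘))
        (cong (λ z → ∑ (λ j → m j * η (ℓ j v)) + z)
          (trans (∑-cong (λ j → *-assoc q (γ j) (δ (ℓ j v) 𝟘))) (∑-*ˡ q (λ j → γ j * δ (ℓ j v) 𝟘))))

    combination-diagonal : ∀ m g m′ g′ c →
      n * ∑ (λ t → φ m (q * g) t * φ m′ (q * g′) (c ⊕ ⊖ t)) - ∑ (φ m (q * g)) * ∑ (φ m′ (q * g′))
      ≡ n * (m * m′ + g * g′) * (n * δ c 𝟘 - 1ℤ) + n * q * (m * g′ + g * m′) * η c
    combination-diagonal m g m′ g′ c = trans
      (cong₂ (λ x y → n * x - y) (φ-convolution m (q * g) m′ (q * g′) c) (cong₂ _*_ (∑-φ m (q * g)) (∑-φ m′ (q * g′))))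
      (spectral-identity n q m g m′ g′ (η c) (δ c 𝟘) n≡q²)

    combination-total : ∀ (m γ : Direction → ℤ) → ∑ (λ j → ∑ (φ (m j) (q * γ j))) ≡ q * ∑ γ
    combination-total m γ = trans (∑-cong λ j → ∑-φ (m j) (q * γ j)) (∑-*ˡ q γ)

    totals : ∀ (m γ m′ γ′ : Direction → ℤ) → ∑ (λ j → ∑ (φ (m j) (q * γ j))) * ∑ (λ j → ∑ (φ (m′ j) (q * γ′ j))) ≡ n * (∑ γ * ∑ γ′)
    totals m γ m′ γ′ = trans (cong₂ _*_ (combination-total m γ) (combination-total m′ γ′))
      (trans (regroup q (∑ γ) (∑ γ′)) (cong (_* (∑ γ * ∑ γ′)) (sym n≡q²)))
      where
      regroup : ∀ q g g′ → (q * g) * (q * g′) ≡ q * q * (g * g′)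
      regroup = solve-∀

    opaque
      unfolding combination
      combination-convolution : ∀ (m γ m′ γ′ : Direction → ℤ) w → ∑ (λ v → combination m γ v * combination m′ γ′ (w ⊟ v)) ≡
        n * (∑ γ * ∑ γ′) + ∑ (λ j → n * (m j * m′ j + γ j * γ′ j) * (n * δ (ℓ j w) 𝟘 - 1ℤ) + n * q * (m j * γ′ j + γ j * m′ j) * η (ℓ j w))
      combination-convolution m γ m′ γ′ w = begin
        ∑ (λ v → ∑ (λ j → φ (m j) (q * γ j) (ℓ j v)) * ∑ (λ j → φ (m′ j) (q * γ′ j) (ℓ j (w ⊟ v))))
          ≡⟨ line-functions-convolution (λ j → φ (m j) (q * γ j)) (λ j → φ (m′ j) (q * γ′ j)) w ⟩
        ∑ (λ j → ∑ (φ (m j) (q * γ j))) * ∑ (λ j → ∑ (φ (m′ j) (q * γ′ j)))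
          + ∑ (λ j → n * ∑ (λ t → φ (m j) (q * γ j) t * φ (m′ j) (q * γ′ j) (ℓ j w ⊕ ⊖ t)) - ∑ (φ (m j) (q * γ j)) * ∑ (φ (m′ j) (q * γ′ j)))
          ≡⟨ cong₂ _+_ (totals m γ m′ γ′) (∑-cong λ j → combination-diagonal (m j) (γ j) (m′ j) (γ′ j) (ℓ j w)) ⟩
        n * (∑ γ * ∑ γ′) + ∑ (λ j → n * (m j * m′ j + γ j * γ′ j) * (n * δ (ℓ j w) 𝟘 - 1ℤ) + n * q * (m j * γ′ j + γ j * m′ j) * η (ℓ j w)) ∎
        where open ≡-Reasoning

  -- The coefficients

  ∀-Bool? : {P : Bool → Set} → (∀ b → Dec (P b)) → Dec (∀ b → P b)
  ∀-Bool? P? = map′ (λ { (f , t) false → f ; (f , t) true → t }) (λ h → h false , h true) (P? false ×-dec P? true)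

  decided : {P : Set} (P? : Dec P) {_ : True P?} → P
  decided P? {w} = toWitness w

  opaque
    ∑₂ : (Bool → Bool → ℤ) → ℤ
    ∑₂ f = f false false + f false true + f true false + f true true

    ∑₂-def : ∀ f → ∑₂ f ≡ f false false + f false true + f true false + f true true
    ∑₂-def f = refl

    ∑₂-cong : ∀ {f g : Bool → Bool → ℤ} → (∀ u v → f u v ≡ g u v) → ∑₂ f ≡ ∑₂ g
    ∑₂-cong e = cong₂ _+_ (cong₂ _+_ (cong₂ _+_ (e false false) (e false true)) (e true false)) (e true true)

    ∑-∑₂ : {A : Set} {{_ : Finite A}} (g : Bool → Bool → A → ℤ) → ∑₂ (λ u v → ∑ (g u v)) ≡ ∑ (λ x → ∑₂ (λ u v → g u v x))
    ∑-∑₂ g = sym (trans (∑-+ (λ x → g false false x + g false true x + g true false x) (g true true))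
      (cong (λ z → z + ∑ (g true true)) (trans (∑-+ (λ x → g false false x + g false true x) (g true false))
        (cong (λ z → z + ∑ (g true false)) (∑-+ (g false false) (g false true))))))

    ∑₂-*ˡ : ∀ c (f : Bool → Bool → ℤ) → ∑₂ (λ u v → c * f u v) ≡ c * ∑₂ f
    ∑₂-*ˡ c f = lemma c (f false false) (f false true) (f true false) (f true true)
      where
      lemma : ∀ c a b d e → c * a + c * b + c * d + c * e ≡ c * (a + b + d + e)
      lemma = solve-∀

    ∑₂-+ : ∀ (f g : Bool → Bool → ℤ) → ∑₂ (λ u v → f u v + g u v) ≡ ∑₂ f + ∑₂ g
    ∑₂-+ f g = lemma (f false false) (f false true) (f true false) (f true true) (g false false) (g false true) (g true false) (g true true)
      where
      lemma : ∀ a b c d a′ b′ c′ d′ → a + a′ + (b + b′) + (c + c′) + (d + d′) ≡ a + b + c + d + (a′ + b′ + c′ + d′)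
      lemma = solve-∀

  ∑₂-combine : ∀ (C D : Bool → Bool → ℤ) a x b h {c} → ∑₂ C ≡ c → ∑₂ D ≡ 0ℤ →
    ∑₂ (λ u v → a * C u v * x + b * D u v * h) ≡ a * c * x
  ∑₂-combine C D a x b h {c} ∑C ∑D = trans
    (∑₂-cong (λ u v → cong₂ _+_ (swap a (C u v) x) (swap b (D u v) h)))
    (trans (∑₂-+ (λ u v → a * x * C u v) (λ u v → b * h * D u v))
    (trans (cong₂ _+_ (trans (∑₂-*ˡ (a * x) C) (cong (a * x *_) ∑C)) (trans (∑₂-*ˡ (b * h) D) (cong (b * h *_) ∑D)))
      (finish a x c (b * h))))
    where
    swap : ∀ n c x → n * c * x ≡ n * x * c
    swap = solve-∀
    finish : ∀ a x c b → a * x * c + b * 0ℤ ≡ a * c * x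
    finish = solve-∀

  unit : Bool → Bool → ℤ
  unit s t = if s ∨ t then 0ℤ else 1ℤ

  -- For a slope x + y w, σ and τ are the signs ε x and ε y, and ρ is ν x ν y.  The weights μ and γ
  -- belong to η ∘ ℓ and to the indicator of ℓ = 0; on the line itself, η has the weight α.
  μ-coefficient γ-coefficient α-coefficient : Bool → Bool → Bool × Bool × Bool → ℤ
  μ-coefficient u false (σ , τ , ρ) = if σ xor τ then sgn u * sgn τ else 0ℤ
  μ-coefficient u true  (σ , τ , ρ) = if σ xor τ then 0ℤ else sgn τ
  γ-coefficient u false (σ , τ , ρ) = if σ xor τ then sgn τ else 0ℤ
  γ-coefficient u true  (σ , τ , ρ) = if σ xor τ then 0ℤ else sgn u * sgn ρ
  α-coefficient u false (σ , τ , ρ) = if σ xor τ then 0ℤ else sgn u * sgn τ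
  α-coefficient u true  (σ , τ , ρ) = if σ xor τ then sgn τ else 0ℤ

  -- This is (-1)^(uv), a bent function on pairs of bits. It gives the total weight of the
  -- indicators in `∑-γ`, and by itself the quadruple of order 1 in `trivial`.
  origin-value : Bool → Bool → ℤ
  origin-value u false = 1ℤ
  origin-value u true  = sgn u

  opaque
    unfolding ∑₂

    -- In each direction μ and γ are nonzero for the same single value of v, so nothing survives for
    -- t ≠ 0. For that v one of them changes sign with u and the other does not, so the two products
    -- cancel when s ≠ 0.
    coefficients-even : ∀ s t σ τ ρ →
      ∑₂ (λ u v → μ-coefficient u v (σ , τ , ρ) * μ-coefficient (u xor s) (v xor t) (σ , τ , ρ)
                + γ-coefficient u v (σ , τ , ρ) * γ-coefficient (u xor s) (v xor t) (σ , τ , ρ)) ≡ + 4 * unit s t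
    coefficients-even = decided (∀-Bool? λ s → ∀-Bool? λ t → ∀-Bool? λ σ → ∀-Bool? λ τ → ∀-Bool? λ ρ → _ ℤP.≟ _)

    -- Where μ and γ are nonzero, exactly one of them contains `sgn u`, so the mixed products cancel
    -- in the sum over u; for t ≠ 0 the supports are disjoint.
    coefficients-odd : ∀ s t σ τ ρ →
      ∑₂ (λ u v → μ-coefficient u v (σ , τ , ρ) * γ-coefficient (u xor s) (v xor t) (σ , τ , ρ)
                + γ-coefficient u v (σ , τ , ρ) * μ-coefficient (u xor s) (v xor t) (σ , τ , ρ)) ≡ 0ℤ
    coefficients-odd = decided (∀-Bool? λ s → ∀-Bool? λ t → ∀-Bool? λ σ → ∀-Bool? λ τ → ∀-Bool? λ ρ → _ ℤP.≟ _)

    origin-values : ∀ s t → ∑₂ (λ u v → origin-value u v * origin-value (u xor s) (v xor t)) ≡ + 4 * unit s t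
    origin-values = decided (∀-Bool? λ s → ∀-Bool? λ t → _ ℤP.≟ _)

  -- Doubling removes the halves from identities such as [σ ≠ τ] τ = (τ - σ) / 2. They write a
  -- weight on slopes as a function of y plus a function of x, for which the sums over parallel
  -- lines are known.
  2μ-false : ∀ u σ τ ρ → + 2 * μ-coefficient u false (σ , τ , ρ) ≡ sgn u * (sgn τ - sgn σ)
  2μ-false = decided (∀-Bool? λ u → ∀-Bool? λ σ → ∀-Bool? λ τ → ∀-Bool? λ ρ → _ ℤP.≟ _)

  2μ-true : ∀ u σ τ ρ → + 2 * μ-coefficient u true (σ , τ , ρ) ≡ sgn τ + sgn σ
  2μ-true = decided (∀-Bool? λ u → ∀-Bool? λ σ → ∀-Bool? λ τ → ∀-Bool? λ ρ → _ ℤP.≟ _)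

  2α-false : ∀ u σ τ ρ → + 2 * α-coefficient u false (σ , τ , ρ) ≡ sgn u * (sgn τ + sgn σ)
  2α-false = decided (∀-Bool? λ u → ∀-Bool? λ σ → ∀-Bool? λ τ → ∀-Bool? λ ρ → _ ℤP.≟ _)

  2α-true : ∀ u σ τ ρ → + 2 * α-coefficient u true (σ , τ , ρ) ≡ sgn τ - sgn σ
  2α-true = decided (∀-Bool? λ u → ∀-Bool? λ σ → ∀-Bool? λ τ → ∀-Bool? λ ρ → _ ℤP.≟ _)

  2γ-false : ∀ u σ τ ρ → + 2 * γ-coefficient u false (σ , τ , ρ) ≡ sgn τ - sgn σ
  2γ-false = decided (∀-Bool? λ u → ∀-Bool? λ σ → ∀-Bool? λ τ → ∀-Bool? λ ρ → _ ℤP.≟ _)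

  2γ-true : ∀ u σ τ ρ ρ′ → + 2 * γ-coefficient u true (σ , τ , ρ xor ρ′) ≡
    sgn u * (sgn ρ * sgn ρ′ + (sgn σ * sgn ρ) * (sgn τ * sgn ρ′))
  2γ-true = decided (∀-Bool? λ u → ∀-Bool? λ σ → ∀-Bool? λ τ → ∀-Bool? λ ρ → ∀-Bool? λ ρ′ → _ ℤP.≟ _)

  -- The supports of α and γ are complementary, and both take only the values ±1 there.
  amplitude-sign : ∀ u v c σ τ ρ → (α-coefficient u v (σ , τ , ρ) * sgn c + γ-coefficient u v (σ , τ , ρ) ≡ 1ℤ) ⊎
                                   (α-coefficient u v (σ , τ , ρ) * sgn c + γ-coefficient u v (σ , τ , ρ) ≡ -1ℤ)
  amplitude-sign = decided (∀-Bool? λ u → ∀-Bool? λ v → ∀-Bool? λ c → ∀-Bool? λ σ → ∀-Bool? λ τ → ∀-Bool? λ ρ → (_ ℤP.≟ _) ⊎-dec (_ ℤP.≟ _))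

  2-cancel : ∀ {a b} → + 2 * a ≡ + 2 * b → a ≡ b
  2-cancel {a} {b} = *-cancelˡ-≡ (+ 2) a b

  -- Totals of the coefficients and their transform by η

  module Amplitudes (𝔽 𝕂 : FiniteField) (coordinates : Coordinates 𝔽 𝕂)
                    (signs : Signs (FiniteField.Carrier 𝔽) {{FiniteField.carrier-finite 𝔽}}) where
    private module F = FieldProperties 𝔽
    open FieldProperties 𝕂
    open Coordinates coordinates
    open Directions 𝔽 𝕂 coordinates
    open Combinations 𝔽 𝕂 coordinates

    private instance
      F-finite : Finite F.Carrier
      F-finite = F.carrier-finite
      K-finite : Finite Carrier
      K-finite = carrier-finite

    open Signs signs

    e k : F.Carrier → ℤ
    e x = sgn (ε x)
    k x = sgn (ν x)

    -- The vertical direction has the coefficients of a slope with signs −1 and 1.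
    signs-of : Direction → Bool × Bool × Bool
    signs-of nothing        = true , false , false
    signs-of (just (x , y)) = ε x , ε y , ν x xor ν y

    μ γ α : Bool → Bool → Direction → ℤ
    μ u v j = μ-coefficient u v (signs-of j)
    γ u v j = γ-coefficient u v (signs-of j)
    α u v j = α-coefficient u v (signs-of j)

    F² : Set
    F² = F.Carrier × F.Carrier

    ∑-separate : ∀ (f g : F.Carrier → ℤ) → ∑ (λ ((x , y) : F²) → f x * g y) ≡ ∑ f * ∑ g
    ∑-separate f g = trans (∑-× (λ ((x , y) : F²) → f x * g y)) (∑-∑-* f g)

    ∑-first : ∀ (f : F.Carrier → ℤ) → ∑ (λ ((x , y) : F²) → f x) ≡ q * ∑ f
    ∑-first f = trans (∑-× (λ ((x , y) : F²) → f x)) (trans (∑-cong λ x → ∑-const (f x)) (∑-*ˡ q f))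

    ∑-second : ∀ (f : F.Carrier → ℤ) → ∑ (λ ((x , y) : F²) → f y) ≡ q * ∑ f
    ∑-second f = trans (∑-× (λ ((x , y) : F²) → f y)) (∑-const (∑ f))

    ∑-e₁ : ∑ (λ ((x , y) : F²) → e x) ≡ q
    ∑-e₁ = trans (∑-first e) (trans (cong (q *_) ∑-ε) (*-identityʳ q))

    ∑-e₂ : ∑ (λ ((x , y) : F²) → e y) ≡ q
    ∑-e₂ = trans (∑-second e) (trans (cong (q *_) ∑-ε) (*-identityʳ q))

    double-∑ : ∀ {A : Set} {{_ : Finite A}} (f g : A → ℤ) → (∀ x → + 2 * f x ≡ g x) → ∀ {c} → ∑ g ≡ + 2 * c → ∑ f ≡ c
    double-∑ f g 2f≡g ∑g≡2c = 2-cancel (trans (sym (∑-*ˡ (+ 2) f)) (trans (∑-cong 2f≡g) ∑g≡2c))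

    ∑-difference : ∑ (λ ((x , y) : F²) → e y - e x) ≡ 0ℤ
    ∑-difference = trans (∑-minus (λ ((x , y) : F²) → e y) (λ (x , y) → e x)) (trans (cong₂ _-_ ∑-e₂ ∑-e₁) (+-inverseʳ q))

    ∑-μ-false : ∀ u → ∑ (λ j → μ u false (just j)) ≡ 0ℤ
    ∑-μ-false u = double-∑ (λ j → μ u false (just j)) (λ (x , y) → sgn u * (e y - e x))
      (λ (x , y) → 2μ-false u (ε x) (ε y) (ν x xor ν y))
      (trans (∑-*ˡ (sgn u) (λ (x , y) → e y - e x)) (trans (cong (sgn u *_) ∑-difference) (*-zeroʳ (sgn u))))

    ∑-μ-true : ∀ u → ∑ (λ j → μ u true (just j)) ≡ q
    ∑-μ-true u = double-∑ (λ j → μ u true (just j)) (λ (x , y) → e y + e x)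
      (λ (x , y) → 2μ-true u (ε x) (ε y) (ν x xor ν y))
      (trans (∑-+ (λ ((x , y) : F²) → e y) (λ (x , y) → e x)) (trans (cong₂ _+_ ∑-e₂ ∑-e₁) (lemma q)))
      where
      lemma : ∀ q → q + q ≡ + 2 * q
      lemma = solve-∀

    ∑-γ-false : ∀ u → ∑ (λ j → γ u false (just j)) ≡ 0ℤ
    ∑-γ-false u = double-∑ (λ j → γ u false (just j)) (λ (x , y) → e y - e x)
      (λ (x , y) → 2γ-false u (ε x) (ε y) (ν x xor ν y)) ∑-difference

    ∑-γ-true : ∀ u → ∑ (λ j → γ u true (just j)) ≡ sgn u
    ∑-γ-true u = double-∑ (λ j → γ u true (just j)) (λ (x , y) → sgn u * (k x * k y + (e x * k x) * (e y * k y)))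
      (λ (x , y) → 2γ-true u (ε x) (ε y) (ν x) (ν y))
      (trans (∑-*ˡ (sgn u) (λ (x , y) → k x * k y + (e x * k x) * (e y * k y)))
      (trans (cong (sgn u *_) (trans (∑-+ (λ ((x , y) : F²) → k x * k y) (λ (x , y) → (e x * k x) * (e y * k y)))
        (cong₂ _+_ (trans (∑-separate k k) ∑-ν) (trans (∑-separate (λ x → e x * k x) (λ x → e x * k x)) ∑-εν))))
        (*-comm (sgn u) (+ 2))))

    ∑-γ : ∀ u v → ∑ (γ u v) ≡ origin-value u v
    ∑-γ u false = trans (∑-Maybe (γ u false)) (cong (λ z → 1ℤ + z) (∑-γ-false u))
    ∑-γ u true  = trans (∑-Maybe (γ u true)) (trans (cong (λ z → 0ℤ + z) (∑-γ-true u)) (+-identityˡ (sgn u)))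

    η-slope : F.Carrier → F.Carrier → ℤ
    η-slope x y = η (slope x y)

    δ-shift : ∀ y y′ → δ (y F.⊕ F.⊖ y′) F.𝟘 ≡ δ y′ y
    δ-shift y y′ with y′ ≟ y
    ... | yes e = trans (δ-≡ (trans (cong (λ z → y F.⊕ F.⊖ z) e) (F.solve 1 (λ y → y F.:- y F.:= F.con 0ℤ) refl y))) (sym (δ-≡ e))
    ... | no ¬e = trans (δ-≢ (¬e ∘ sym ∘ F.⊖-≡𝟘)) (sym (δ-≢ ¬e))

    -- Summing over `x′` first leaves the convolution of e with q δ - 1: up to the constant Σ e = 1,
    -- e is an eigenfunction with eigenvalue q.
    ∑-e₂-η : ∀ x y → ∑ (λ ((x′ , y′) : F²) → e y′ * η-slope (x F.⊕ F.⊖ x′) (y F.⊕ F.⊖ y′)) ≡ q * e y - 1ℤ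
    ∑-e₂-η x y = begin
      ∑ (λ ((x′ , y′) : F²) → e y′ * η-slope (x F.⊕ F.⊖ x′) (y F.⊕ F.⊖ y′))
        ≡⟨ ∑-× (λ ((x′ , y′) : F²) → e y′ * η-slope (x F.⊕ F.⊖ x′) (y F.⊕ F.⊖ y′)) ⟩
      ∑ (λ x′ → ∑ (λ y′ → e y′ * η-slope (x F.⊕ F.⊖ x′) (y F.⊕ F.⊖ y′)))
        ≡⟨ ∑-comm (λ x′ y′ → e y′ * η-slope (x F.⊕ F.⊖ x′) (y F.⊕ F.⊖ y′)) ⟩
      ∑ (λ y′ → ∑ (λ x′ → e y′ * η-slope (x F.⊕ F.⊖ x′) (y F.⊕ F.⊖ y′)))
        ≡⟨ ∑-cong (λ y′ → trans (∑-*ˡ (e y′) (λ x′ → η-slope (x F.⊕ F.⊖ x′) (y F.⊕ F.⊖ y′)))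
             (cong (e y′ *_) (trans (F.∑-reflect x (λ x′ → η-slope x′ (y F.⊕ F.⊖ y′))) (∑-η-slope₁ (y F.⊕ F.⊖ y′))))) ⟩
      ∑ (λ y′ → e y′ * (q * δ (y F.⊕ F.⊖ y′) F.𝟘 - 1ℤ))
        ≡⟨ ∑-cong (λ y′ → trans (cong (λ d → e y′ * (q * d - 1ℤ)) (δ-shift y y′)) (expand q (e y′) (δ y′ y))) ⟩
      ∑ (λ y′ → q * (δ y′ y * e y′) - e y′)
        ≡⟨ ∑-minus (λ y′ → q * (δ y′ y * e y′)) e ⟩
      ∑ (λ y′ → q * (δ y′ y * e y′)) - ∑ e
        ≡⟨ cong₂ _-_ (trans (∑-*ˡ q (λ y′ → δ y′ y * e y′)) (cong (q *_) (∑-δ y e))) ∑-ε ⟩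
      q * e y - 1ℤ ∎
      where
      open ≡-Reasoning
      expand : ∀ q e d → e * (q * d - 1ℤ) ≡ q * (d * e) - e
      expand = solve-∀

    -- Here `y′` is summed first, and the opposite sign of the sums along the other family gives the
    -- eigenvalue -q.
    ∑-e₁-η : ∀ x y → ∑ (λ ((x′ , y′) : F²) → e x′ * η-slope (x F.⊕ F.⊖ x′) (y F.⊕ F.⊖ y′)) ≡ 1ℤ - q * e x
    ∑-e₁-η x y = begin
      ∑ (λ ((x′ , y′) : F²) → e x′ * η-slope (x F.⊕ F.⊖ x′) (y F.⊕ F.⊖ y′))
        ≡⟨ ∑-× (λ ((x′ , y′) : F²) → e x′ * η-slope (x F.⊕ F.⊖ x′) (y F.⊕ F.⊖ y′)) ⟩
      ∑ (λ x′ → ∑ (λ y′ → e x′ * η-slope (x F.⊕ F.⊖ x′) (y F.⊕ F.⊖ y′)))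
        ≡⟨ ∑-cong (λ x′ → trans (∑-*ˡ (e x′) (λ y′ → η-slope (x F.⊕ F.⊖ x′) (y F.⊕ F.⊖ y′)))
             (cong (e x′ *_) (trans (F.∑-reflect y (λ y′ → η-slope (x F.⊕ F.⊖ x′) y′)) (∑-η-slope₂ (x F.⊕ F.⊖ x′))))) ⟩
      ∑ (λ x′ → e x′ * (1ℤ - q * δ (x F.⊕ F.⊖ x′) F.𝟘))
        ≡⟨ ∑-cong (λ x′ → trans (cong (λ d → e x′ * (1ℤ - q * d)) (δ-shift x x′)) (expand q (e x′) (δ x′ x))) ⟩
      ∑ (λ x′ → e x′ - q * (δ x′ x * e x′))
        ≡⟨ ∑-minus e (λ x′ → q * (δ x′ x * e x′)) ⟩
      ∑ e - ∑ (λ x′ → q * (δ x′ x * e x′))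
        ≡⟨ cong₂ _-_ ∑-ε (trans (∑-*ˡ q (λ x′ → δ x′ x * e x′)) (cong (q *_) (∑-δ x e))) ⟩
      1ℤ - q * e x ∎
      where
      open ≡-Reasoning
      expand : ∀ q e d → e * (1ℤ - q * d) ≡ e - q * (d * e)
      expand = solve-∀

    -- The eigenvalues q and -q turn the difference of e y and e x into a sum and the sum into a
    -- difference, which exchanges the supports σ ≠ τ and σ = τ. In the doubled equation the
    -- constants -1 and 1 add up to -2 `sgn u` for v = `false`, which the vertical direction
    -- compensates, and to 0 for v = `true`, where its weight is 0.
    μ-transform : ∀ u v x y → μ u v nothing + ∑ (λ ((x′ , y′) : F²) → μ u v (just (x′ , y′)) * η-slope (x F.⊕ F.⊖ x′) (y F.⊕ F.⊖ y′))
      ≡ q * α u v (just (x , y))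
    μ-transform u false x y = 2-cancel (trans (*-distribˡ-+ (+ 2) (sgn u * 1ℤ) _)
      (trans (cong (λ z → + 2 * (sgn u * 1ℤ) + z) (trans (sym (∑-*ˡ (+ 2) (λ ((x′ , y′) : F²) → μ u false (just (x′ , y′)) * η-slope (x F.⊕ F.⊖ x′) (y F.⊕ F.⊖ y′))))
        (trans (∑-cong pointwise)
        (trans (∑-*ˡ (sgn u) (λ (x′ , y′) → e y′ * η-slope (x F.⊕ F.⊖ x′) (y F.⊕ F.⊖ y′) - e x′ * η-slope (x F.⊕ F.⊖ x′) (y F.⊕ F.⊖ y′)))
          (cong (sgn u *_) (trans (∑-minus (λ (x′ , y′) → e y′ * η-slope (x F.⊕ F.⊖ x′) (y F.⊕ F.⊖ y′)) (λ (x′ , y′) → e x′ * η-slope (x F.⊕ F.⊖ x′) (y F.⊕ F.⊖ y′)))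
            (cong₂ _-_ (∑-e₂-η x y) (∑-e₁-η x y))))))))
      (trans (collect (sgn u) q (e x) (e y)) (trans (cong (q *_) (sym (2α-false u (ε x) (ε y) (ν x xor ν y)))) (swap q (α u false (just (x , y))))))))
      where
      expand : ∀ s a b h → s * (a - b) * h ≡ s * (a * h - b * h)
      expand = solve-∀
      pointwise : ∀ ((x′ , y′) : F²) → + 2 * (μ u false (just (x′ , y′)) * η-slope (x F.⊕ F.⊖ x′) (y F.⊕ F.⊖ y′))
        ≡ sgn u * (e y′ * η-slope (x F.⊕ F.⊖ x′) (y F.⊕ F.⊖ y′) - e x′ * η-slope (x F.⊕ F.⊖ x′) (y F.⊕ F.⊖ y′))
      pointwise (x′ , y′) = trans (sym (*-assoc (+ 2) (μ u false (just (x′ , y′))) (η-slope (x F.⊕ F.⊖ x′) (y F.⊕ F.⊖ y′))))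
        (trans (cong (_* η-slope (x F.⊕ F.⊖ x′) (y F.⊕ F.⊖ y′)) (2μ-false u (ε x′) (ε y′) (ν x′ xor ν y′)))
               (expand (sgn u) (e y′) (e x′) (η-slope (x F.⊕ F.⊖ x′) (y F.⊕ F.⊖ y′))))
      collect : ∀ s q a b → + 2 * (s * 1ℤ) + s * (q * b - 1ℤ - (1ℤ - q * a)) ≡ q * (s * (b + a))
      collect = solve-∀
      swap : ∀ q a → q * (+ 2 * a) ≡ + 2 * (q * a)
      swap = solve-∀
    μ-transform u true x y = 2-cancel (trans (cong (+ 2 *_) (+-identityˡ _))
      (trans (sym (∑-*ˡ (+ 2) (λ ((x′ , y′) : F²) → μ u true (just (x′ , y′)) * η-slope (x F.⊕ F.⊖ x′) (y F.⊕ F.⊖ y′))))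
        (trans (∑-cong pointwise)
        (trans (trans (∑-+ (λ (x′ , y′) → e y′ * η-slope (x F.⊕ F.⊖ x′) (y F.⊕ F.⊖ y′)) (λ (x′ , y′) → e x′ * η-slope (x F.⊕ F.⊖ x′) (y F.⊕ F.⊖ y′)))
            (cong₂ _+_ (∑-e₂-η x y) (∑-e₁-η x y)))
      (trans (collect q (e x) (e y)) (trans (cong (q *_) (sym (2α-true u (ε x) (ε y) (ν x xor ν y)))) (swap q (α u true (just (x , y))))))))))
      where
      expand : ∀ a b h → (a + b) * h ≡ a * h + b * h
      expand = solve-∀
      pointwise : ∀ ((x′ , y′) : F²) → + 2 * (μ u true (just (x′ , y′)) * η-slope (x F.⊕ F.⊖ x′) (y F.⊕ F.⊖ y′))
        ≡ e y′ * η-slope (x F.⊕ F.⊖ x′) (y F.⊕ F.⊖ y′) + e x′ * η-slope (x F.⊕ F.⊖ x′) (y F.⊕ F.⊖ y′)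
      pointwise (x′ , y′) = trans (sym (*-assoc (+ 2) (μ u true (just (x′ , y′))) (η-slope (x F.⊕ F.⊖ x′) (y F.⊕ F.⊖ y′))))
        (trans (cong (_* η-slope (x F.⊕ F.⊖ x′) (y F.⊕ F.⊖ y′)) (2μ-true u (ε x′) (ε y′) (ν x′ xor ν y′)))
               (expand (e y′) (e x′) (η-slope (x F.⊕ F.⊖ x′) (y F.⊕ F.⊖ y′))))
      collect : ∀ q a b → q * b - 1ℤ + (1ℤ - q * a) ≡ q * (b - a)
      collect = solve-∀
      swap : ∀ q a → q * (+ 2 * a) ≡ + 2 * (q * a)
      swap = solve-∀

  -- Values of the combinations at the points of the plane

  module Evaluation (𝔽 𝕂 : FiniteField) (coordinates : Coordinates 𝔽 𝕂)
                    (signs : Signs (FiniteField.Carrier 𝔽) {{FiniteField.carrier-finite 𝔽}}) where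
    private module F = FieldProperties 𝔽
    open FieldProperties 𝕂
    open Coordinates coordinates
    open Directions 𝔽 𝕂 coordinates
    open Combinations 𝔽 𝕂 coordinates
    open Amplitudes 𝔽 𝕂 coordinates signs

    private instance
      F-finite : Finite F.Carrier
      F-finite = F.carrier-finite
      K-finite : Finite Carrier
      K-finite = carrier-finite

    point : Direction → Carrier → V
    point nothing        c = 𝟘 , c
    point (just (x , y)) c = c , slope x y ⊙ c

    data Location (w : V) : Set where
      origin  : w ≡ V-𝟘 → Location w
      on-line : ∀ k c → c ≢ 𝟘 → w ≡ point k c → Location w

    locate : ∀ w → Location w
    locate (a , b) with a ≟ 𝟘 | b ≟ 𝟘
    ... | yes a≡𝟘 | yes b≡𝟘 = origin (cong₂ _,_ a≡𝟘 b≡𝟘)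
    ... | yes a≡𝟘 | no b≢𝟘  = on-line nothing b b≢𝟘 (cong (_, b) a≡𝟘)
    ... | no a≢𝟘  | _       = on-line (just (Inverse.from slope↔ (b ⊙ r))) a a≢𝟘 (cong (a ,_) (sym
      (trans (cong (_⊙ a) (Inverse.strictlyInverseˡ slope↔ (b ⊙ r)))
      (trans (solve 3 (λ a b r → b :* r :* a := a :* r :* b) refl a b r) (trans (cong (_⊙ b) (proj₂ (inverse a≢𝟘))) (𝟙⊙ b))))))
      where
      r = proj₁ (inverse a≢𝟘)

    ℓ-origin : ∀ j → ℓ j V-𝟘 ≡ 𝟘
    ℓ-origin nothing        = refl
    ℓ-origin (just (x , y)) = solve 1 (λ s → con 0ℤ :- s :* con 0ℤ := con 0ℤ) refl (slope x y)

    ℓ-just-nothing : ∀ x y c → ℓ (just (x , y)) (point nothing c) ≡ c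
    ℓ-just-nothing x y c = solve 2 (λ s c → c :- s :* con 0ℤ := c) refl (slope x y) c

    ℓ-just-just : ∀ x y x′ y′ c → ℓ (just (x′ , y′)) (point (just (x , y)) c) ≡ slope (x F.⊕ F.⊖ x′) (y F.⊕ F.⊖ y′) ⊙ c
    ℓ-just-just x y x′ y′ c = trans (solve 3 (λ s s′ c → s :* c :- s′ :* c := (s :- s′) :* c) refl (slope x y) (slope x′ y′) c)
      (cong (_⊙ c) (slope-sub x y x′ y′))

    ℓ-own : ∀ k c → ℓ k (point k c) ≡ 𝟘
    ℓ-own nothing        c = refl
    ℓ-own (just (x , y)) c = solve 2 (λ s c → s :* c :- s :* c := con 0ℤ) refl (slope x y) c

    ℓ-other : ∀ j k {c} → c ≢ 𝟘 → j ≢ k → ℓ j (point k c) ≢ 𝟘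
    ℓ-other nothing          nothing        c≢𝟘 j≢k e = j≢k refl
    ℓ-other nothing          (just _)       c≢𝟘 j≢k e = c≢𝟘 e
    ℓ-other (just (x , y))   nothing {c}    c≢𝟘 j≢k e = c≢𝟘 (trans (sym (ℓ-just-nothing x y c)) e)
    ℓ-other (just (x′ , y′)) (just (x , y)) {c} c≢𝟘 j≢k e = j≢k (cong just (slope-injective (sym (⊖-≡𝟘
      (cancel c≢𝟘 (trans (solve 3 (λ s s′ c → c :* (s :- s′) := s :* c :- s′ :* c) refl (slope x y) (slope x′ y′) c) e))))))

    amplitude-at : Bool → Bool → ∀ {w} → Location w → ℤ
    amplitude-at u v (origin _)        = origin-value u v
    amplitude-at u v (on-line k c _ _) = α u v k * η c + γ u v k

    ∑-γ-δ : ∀ u v k {c} → c ≢ 𝟘 → ∑ (λ j → γ u v j * δ (ℓ j (point k c)) 𝟘) ≡ γ u v k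
    ∑-γ-δ u v k {c} c≢𝟘 = trans
      (∑-single k (λ j → γ u v j * δ (ℓ j (point k c)) 𝟘) λ j j≢k →
        trans (cong (γ u v j *_) (δ-≢ (ℓ-other j k c≢𝟘 j≢k))) (*-zeroʳ (γ u v j)))
      (trans (cong (γ u v k *_) (δ-≡ (ℓ-own k c))) (*-identityʳ (γ u v k)))

    ∑-μ : ∀ u v → ∑ (λ j → μ u v (just j)) ≡ q * α u v nothing
    ∑-μ u false = trans (∑-μ-false u) (sym (*-zeroʳ q))
    ∑-μ u true  = trans (∑-μ-true u) (sym (*-identityʳ q))

    -- At a point of the line k the other forms take the value c times a difference of slopes, or c
    -- itself if one of the two directions is vertical. Multiplicativity of η takes out `η c`, and
    -- the rest is `μ-transform` or, for vertical k, the plain total `∑-μ`.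
    ∑-μ-η : ∀ u v k c → ∑ (λ j → μ u v j * η (ℓ j (point k c))) ≡ q * α u v k * η c
    ∑-μ-η u v nothing c = begin
      ∑ (λ j → μ u v j * η (ℓ j (point nothing c)))
        ≡⟨ ∑-Maybe (λ j → μ u v j * η (ℓ j (point nothing c))) ⟩
      μ u v nothing * η 𝟘 + ∑ (λ j → μ u v (just j) * η (ℓ (just j) (point nothing c)))
        ≡⟨ cong₂ _+_ (trans (cong (μ u v nothing *_) η-𝟘) (*-zeroʳ (μ u v nothing)))
                     (trans (∑-cong λ (x , y) → cong (λ z → μ u v (just (x , y)) * η z) (ℓ-just-nothing x y c))
                            (∑-*ʳ (η c) (λ j → μ u v (just j)))) ⟩
      0ℤ + ∑ (λ j → μ u v (just j)) * η c
        ≡⟨ trans (+-identityˡ (∑ (λ j → μ u v (just j)) * η c)) (cong (_* η c) (∑-μ u v)) ⟩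
      q * α u v nothing * η c ∎
      where open ≡-Reasoning
    ∑-μ-η u v (just (x , y)) c = begin
      ∑ (λ j → μ u v j * η (ℓ j (point (just (x , y)) c)))
        ≡⟨ ∑-Maybe (λ j → μ u v j * η (ℓ j (point (just (x , y)) c))) ⟩
      μ u v nothing * η c + ∑ (λ j → μ u v (just j) * η (ℓ (just j) (point (just (x , y)) c)))
        ≡⟨ cong (λ z → μ u v nothing * η c + z) (trans (∑-cong pointwise) (∑-*ʳ (η c) transformed)) ⟩
      μ u v nothing * η c + ∑ transformed * η c
        ≡⟨ *-distribʳ-+ (η c) (μ u v nothing) (∑ transformed) ⟨
      (μ u v nothing + ∑ transformed) * η c
        ≡⟨ cong (_* η c) (μ-transform u v x y) ⟩
      q * α u v (just (x , y)) * η c ∎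
      where
      open ≡-Reasoning
      transformed : F² → ℤ
      transformed (x′ , y′) = μ u v (just (x′ , y′)) * η-slope (x F.⊕ F.⊖ x′) (y F.⊕ F.⊖ y′)
      pointwise : ∀ j → μ u v (just j) * η (ℓ (just j) (point (just (x , y)) c)) ≡ transformed j * η c
      pointwise (x′ , y′) = trans (cong (μ u v (just (x′ , y′)) *_)
        (trans (cong η (ℓ-just-just x y x′ y′ c)) (η-* (slope (x F.⊕ F.⊖ x′) (y F.⊕ F.⊖ y′)) c)))
        (sym (*-assoc (μ u v (just (x′ , y′))) (η-slope (x F.⊕ F.⊖ x′) (y F.⊕ F.⊖ y′)) (η c)))

    opaque
      f : Bool → Bool → V → ℤ
      f u v = combination (μ u v) (γ u v)

      amplitude : Bool → Bool → V → ℤ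
      amplitude u v w = amplitude-at u v (locate w)

      f-def : ∀ u v w → f u v w ≡ ∑ (λ j → μ u v j * η (ℓ j w)) + q * ∑ (λ j → γ u v j * δ (ℓ j w) 𝟘)
      f-def u v = combination-def (μ u v) (γ u v)

      f-origin : ∀ u v → f u v V-𝟘 ≡ q * origin-value u v
      f-origin u v = trans (f-def u v V-𝟘) (trans (cong₂ (λ x y → x + q * y)
        (∑-zero (λ j → trans (cong (λ z → μ u v j * η z) (ℓ-origin j)) (trans (cong (μ u v j *_) η-𝟘) (*-zeroʳ (μ u v j)))))
        (trans (∑-cong (λ j → trans (cong (γ u v j *_) (δ-≡ (ℓ-origin j))) (*-identityʳ (γ u v j)))) (∑-γ u v)))
        (+-identityˡ (q * origin-value u v)))

      f-point : ∀ u v k c → c ≢ 𝟘 → f u v (point k c) ≡ q * (α u v k * η c + γ u v k)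
      f-point u v k c c≢𝟘 = trans (f-def u v (point k c)) (trans (cong₂ (λ x y → x + q * y) (∑-μ-η u v k c) (∑-γ-δ u v k c≢𝟘))
        (collect q (α u v k) (η c) (γ u v k)))
        where
        collect : ∀ q a h g → q * a * h + q * g ≡ q * (a * h + g)
        collect = solve-∀

      f≡q*amplitude : ∀ u v w → f u v w ≡ q * amplitude u v w
      f≡q*amplitude u v w with locate w
      ... | origin e            = trans (cong (f u v) e) (f-origin u v)
      ... | on-line k c c≢𝟘 e = trans (cong (f u v) e) (f-point u v k c c≢𝟘)

      amplitude-±1 : ∀ u v w → amplitude u v w ≡ 1ℤ ⊎ amplitude u v w ≡ -1ℤ
      amplitude-±1 u v w with locate w
      ... | origin _ = origin-±1 u v
        where
        origin-±1 : ∀ u v → origin-value u v ≡ 1ℤ ⊎ origin-value u v ≡ -1ℤ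
        origin-±1 u     false = inj₁ refl
        origin-±1 false true  = inj₁ refl
        origin-±1 true  true  = inj₂ refl
      ... | on-line k c c≢𝟘 _ with η-view c
      ...   | zero p _ = contradiction p c≢𝟘
      ...   | square _ _ e    = subst (λ h → α u v k * h + γ u v k ≡ 1ℤ ⊎ α u v k * h + γ u v k ≡ -1ℤ) (sym e)
                                  (amplitude-sign u v false (proj₁ (signs-of k)) (proj₁ (proj₂ (signs-of k))) (proj₂ (proj₂ (signs-of k))))
      ...   | nonsquare _ _ e = subst (λ h → α u v k * h + γ u v k ≡ 1ℤ ⊎ α u v k * h + γ u v k ≡ -1ℤ) (sym e)
                                  (amplitude-sign u v true (proj₁ (signs-of k)) (proj₁ (proj₂ (signs-of k))) (proj₂ (proj₂ (signs-of k))))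

      -- In the vertical direction α is 0 and γ is 1 for v = `false`. The signs of `nothing` are
      -- chosen for this: it makes the diagonal blocks constant.
      amplitude-vertical : ∀ u b → amplitude u false (𝟘 , b) ≡ 1ℤ
      amplitude-vertical u b with 𝟘 ≟ 𝟘 | b ≟ 𝟘
      ... | yes _  | yes _ = refl
      ... | yes _  | no _  = refl
      ... | no 𝟘≢𝟘 | _     = contradiction refl 𝟘≢𝟘

      amplitude-vertical′ : ∀ u b → amplitude u true (𝟘 , b) ≡ η b + sgn u * δ b 𝟘
      amplitude-vertical′ u b with 𝟘 ≟ 𝟘 | b ≟ 𝟘
      ... | no 𝟘≢𝟘 | _       = contradiction refl 𝟘≢𝟘
      ... | yes _  | yes b≡𝟘 = sym (trans (cong₂ (λ x y → x + sgn u * y) (trans (cong η b≡𝟘) η-𝟘) (δ-≡ b≡𝟘)) (lemma (sgn u)))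
        where
        lemma : ∀ s → 0ℤ + s * 1ℤ ≡ s
        lemma = solve-∀
      ... | yes _  | no b≢𝟘  = sym (trans (cong (λ y → η b + sgn u * y) (δ-≢ b≢𝟘)) (lemma (η b) (sgn u)))
        where
        lemma : ∀ h s → h + s * 0ℤ ≡ 1ℤ * h + 0ℤ
        lemma = solve-∀

  -- Quadruples of matrices

  opaque
    _⊠_ : {I : Set} {{_ : Finite I}} → (I → I → ℤ) → (I → I → ℤ) → I → I → ℤ
    (P ⊠ Q) i k = ∑ (λ j → P i j * Q j k)

    ⊠-def : {I : Set} {{_ : Finite I}} (P Q : I → I → ℤ) → ∀ i k → (P ⊠ Q) i k ≡ ∑ (λ j → P i j * Q j k)
    ⊠-def P Q i k = refl

  -- In a pair (x , y) the first component is the number of the block, the second the position in it.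
  record Quadruple (X : Set) {{F : Finite X}} : Set where
    field
      A          : Bool → Bool → X × X → X × X → ℤ
      entries    : ∀ u v i j → A u v i j ≡ 1ℤ ⊎ A u v i j ≡ -1ℤ
      symmetric  : ∀ u v i j → A u v i j ≡ A u v j i
      commute    : ∀ u v u′ v′ i j → (A u v ⊠ A u′ v′) i j ≡ (A u′ v′ ⊠ A u v) i j
      orthogonal : ∀ s t i j → ∑₂ (λ u v → (A u v ⊠ A (u xor s) (v xor t)) i j) ≡
                               + 4 * (size-of X * size-of X) * unit s t * δ i j
      diagonal   : ∀ u x y y′ → A u false (x , y) (x , y′) ≡ 1ℤ
      row-sums   : ∀ v x y x′ → x ≢ x′ → ∑ (λ y′ → A false v (x , y) (x′ , y′) + A true v (x , y) (x′ , y′)) ≡ 0ℤ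
      row-sums′  : ∀ x y x′ → ∑ (λ y′ → A false true (x , y) (x′ , y′) + A true true (x , y) (x′ , y′)) ≡ 0ℤ

  -- Orthogonality and block sums for the square of an odd prime

  module PrimeQuadruple (𝔽 𝕂 : FiniteField) (coordinates : Coordinates 𝔽 𝕂)
                        (signs : Signs (FiniteField.Carrier 𝔽) {{FiniteField.carrier-finite 𝔽}}) where
    private module F = FieldProperties 𝔽
    open FieldProperties 𝕂
    open Coordinates coordinates
    open Directions 𝔽 𝕂 coordinates
    open Combinations 𝔽 𝕂 coordinates
    open Amplitudes 𝔽 𝕂 coordinates signs
    open Evaluation 𝔽 𝕂 coordinates signs

    private instance
      F-finite : Finite F.Carrier
      F-finite = F.carrier-finite
      K-finite : Finite Carrier
      K-finite = carrier-finite

    q-cancel : ∀ {a b} → q * a ≡ q * b → a ≡ b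
    q-cancel {a} {b} e with i*j≡0⇒i≡0∨j≡0 q (trans (lemma q a b) (trans (cong (_- q * b) e) (+-inverseʳ (q * b))))
      where
      lemma : ∀ q a b → q * (a - b) ≡ q * a - q * b
      lemma = solve-∀
    ... | inj₁ q≡0   = contradiction (subst (+ 2 ℤ.≤_) q≡0 F.2≤N) λ { (ℤ.+≤+ ()) }
    ... | inj₂ a-b≡0 = i-j≡0⇒i≡j a b a-b≡0

    ∑-V-reflect : ∀ w (h : V → ℤ) → ∑ (λ v → h (w ⊟ v)) ≡ ∑ h
    ∑-V-reflect (a , b) h = trans (∑-× (λ v → h ((a , b) ⊟ v)))
      (trans (∑-cong λ a′ → ∑-reflect b (λ b′ → h (a ⊕ ⊖ a′ , b′)))
      (trans (∑-reflect a (λ a′ → ∑ (λ b′ → h (a′ , b′)))) (sym (∑-× h))))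

    ⊟-⊟ : ∀ w w′ v → (w ⊟ w′) ⊟ (w ⊟ v) ≡ v ⊟ w′
    ⊟-⊟ (a , b) (a′ , b′) (a″ , b″) = cong₂ _,_ (lemma a a′ a″) (lemma b b′ b″)
      where
      lemma : ∀ a a′ a″ → (a ⊕ ⊖ a′) ⊕ ⊖ (a ⊕ ⊖ a″) ≡ a″ ⊕ ⊖ a′
      lemma = solve 3 (λ a a′ a″ → (a :- a′) :- (a :- a″) := a″ :- a′) refl

    f-even : ∀ u v w w′ → f u v (w ⊟ w′) ≡ f u v (w′ ⊟ w)
    f-even u v w w′ = trans (f-def u v (w ⊟ w′)) (trans (cong₂ (λ x y → x + q * y)
        (∑-cong λ j → cong (μ u v j *_) (η-swap (ℓ j (w ⊟ w′)) (ℓ j (w′ ⊟ w)) (ℓ-swap j)))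
        (∑-cong λ j → cong (γ u v j *_) (δ-swap (ℓ j (w ⊟ w′)) (ℓ j (w′ ⊟ w)) (ℓ-swap j))))
      (sym (f-def u v (w′ ⊟ w))))
      where
      ℓ-swap : ∀ j → ℓ j (w ⊟ w′) ≡ ⊖ 𝟙 ⊙ ℓ j (w′ ⊟ w)
      ℓ-swap j = trans (ℓ-⊟ j w w′) (trans (solve 2 (λ a b → a :- b := (:- con 1ℤ) :* (b :- a)) refl (ℓ j w) (ℓ j w′))
        (cong (⊖ 𝟙 ⊙_) (sym (ℓ-⊟ j w′ w))))
      η-swap : ∀ a b → a ≡ ⊖ 𝟙 ⊙ b → η a ≡ η b
      η-swap a b e = trans (cong η e) (trans (η-* (⊖ 𝟙) b) (trans (cong (_* η b) η-⊖𝟙) (*-identityˡ (η b))))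
      δ-swap : ∀ a b → a ≡ ⊖ 𝟙 ⊙ b → δ a 𝟘 ≡ δ b 𝟘
      δ-swap a b e with b ≟ 𝟘
      ... | yes b≡𝟘 = trans (δ-≡ (trans e (trans (cong (⊖ 𝟙 ⊙_) b≡𝟘) (solve 0 ((:- con 1ℤ) :* con 0ℤ := con 0ℤ) refl)))) (sym (δ-≡ b≡𝟘))
      ... | no b≢𝟘  = trans (δ-≢ (λ a≡𝟘 → ⊙-≢𝟘 ⊖𝟙≢𝟘 b≢𝟘 (trans (sym e) a≡𝟘))) (sym (δ-≢ b≢𝟘))

    amplitude-even : ∀ u v w w′ → amplitude u v (w ⊟ w′) ≡ amplitude u v (w′ ⊟ w)
    amplitude-even u v w w′ = q-cancel (trans (sym (f≡q*amplitude u v (w ⊟ w′)))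
      (trans (f-even u v w w′) (f≡q*amplitude u v (w′ ⊟ w))))

    even-at : ∀ s t j → ∑₂ (λ u v → μ u v j * μ (u xor s) (v xor t) j + γ u v j * γ (u xor s) (v xor t) j) ≡ + 4 * unit s t
    even-at s t j = coefficients-even s t (proj₁ (signs-of j)) (proj₁ (proj₂ (signs-of j))) (proj₂ (proj₂ (signs-of j)))

    odd-at : ∀ s t j → ∑₂ (λ u v → μ u v j * γ (u xor s) (v xor t) j + γ u v j * μ (u xor s) (v xor t) j) ≡ 0ℤ
    odd-at s t j = coefficients-odd s t (proj₁ (signs-of j)) (proj₁ (proj₂ (signs-of j))) (proj₂ (proj₂ (signs-of j)))

    opaque
      unfolding f
      f-convolution : ∀ u v u′ v′ w → ∑ (λ x → f u v x * f u′ v′ (w ⊟ x)) ≡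
        n * (origin-value u v * origin-value u′ v′) +
        ∑ (λ j → n * (μ u v j * μ u′ v′ j + γ u v j * γ u′ v′ j) * (n * δ (ℓ j w) 𝟘 - 1ℤ)
               + n * q * (μ u v j * γ u′ v′ j + γ u v j * μ u′ v′ j) * η (ℓ j w))
      f-convolution u v u′ v′ w = trans (combination-convolution (μ u v) (γ u v) (μ u′ v′) (γ u′ v′) w)
        (cong (λ z → n * z + ∑ (λ j → n * (μ u v j * μ u′ v′ j + γ u v j * γ u′ v′ j) * (n * δ (ℓ j w) 𝟘 - 1ℤ)
               + n * q * (μ u v j * γ u′ v′ j + γ u v j * μ u′ v′ j) * η (ℓ j w))) (cong₂ _*_ (∑-γ u v) (∑-γ u′ v′)))

    ∑-direction-1 : ∑ (λ (_ : Direction) → 1ℤ) ≡ 1ℤ + n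
    ∑-direction-1 = trans (∑-Maybe (λ _ → 1ℤ)) (cong (λ z → 1ℤ + z) (trans (∑-slope (λ _ → 1ℤ)) ∑-1))

    -- After summation over u and v the coefficient of n δ - 1 is the same in every direction and
    -- the η terms are gone, so only the number of lines through w remains.
    f-orthogonal : ∀ s t w → ∑₂ (λ u v → ∑ (λ x → f u v x * f (u xor s) (v xor t) (w ⊟ x))) ≡
      + 4 * unit s t * (n * n * n) * δ w V-𝟘
    f-orthogonal s t w = begin
      ∑₂ (λ u v → ∑ (λ x → f u v x * f (u xor s) (v xor t) (w ⊟ x)))
        ≡⟨ ∑₂-cong (λ u v → f-convolution u v (u xor s) (v xor t) w) ⟩
      ∑₂ (λ u v → n * (origin-value u v * origin-value (u xor s) (v xor t)) + ∑ (λ j → T u v j))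
        ≡⟨ ∑₂-+ (λ u v → n * (origin-value u v * origin-value (u xor s) (v xor t))) (λ u v → ∑ (λ j → T u v j)) ⟩
      ∑₂ (λ u v → n * (origin-value u v * origin-value (u xor s) (v xor t))) + ∑₂ (λ u v → ∑ (λ j → T u v j))
        ≡⟨ cong₂ _+_ (trans (∑₂-*ˡ n (λ u v → origin-value u v * origin-value (u xor s) (v xor t))) (cong (n *_) (origin-values s t)))
                     (trans (∑-∑₂ T) (∑-cong λ j → ∑₂-combine (C j) (D j) n (n * δ (ℓ j w) 𝟘 - 1ℤ) (n * q) (η (ℓ j w)) (even-at s t j) (odd-at s t j))) ⟩
      n * (+ 4 * unit s t) + ∑ (λ j → n * (+ 4 * unit s t) * (n * δ (ℓ j w) 𝟘 - 1ℤ))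
        ≡⟨ cong (λ z → n * (+ 4 * unit s t) + z) (lines (n * (+ 4 * unit s t))) ⟩
      -- The last factor equals n² δ - 1, and its -1 cancels the leading term, which came from the
      -- values at the origin.
      n * (+ 4 * unit s t) + n * (+ 4 * unit s t) * (n * (1ℤ + n * δ w V-𝟘) - (1ℤ + n))
        ≡⟨ collect n (unit s t) (δ w V-𝟘) ⟩
      + 4 * unit s t * (n * n * n) * δ w V-𝟘 ∎
      where
      open ≡-Reasoning
      C D : Direction → Bool → Bool → ℤ
      C j u v = μ u v j * μ (u xor s) (v xor t) j + γ u v j * γ (u xor s) (v xor t) j
      D j u v = μ u v j * γ (u xor s) (v xor t) j + γ u v j * μ (u xor s) (v xor t) j
      T : Bool → Bool → Direction → ℤ
      T u v j = n * C j u v * (n * δ (ℓ j w) 𝟘 - 1ℤ) + n * q * D j u v * η (ℓ j w)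
      collect : ∀ n U d → n * (+ 4 * U) + n * (+ 4 * U) * (n * (1ℤ + n * d) - (1ℤ + n)) ≡ + 4 * U * (n * n * n) * d
      collect = solve-∀
      lines : ∀ c → ∑ (λ j → c * (n * δ (ℓ j w) 𝟘 - 1ℤ)) ≡ c * (n * (1ℤ + n * δ w V-𝟘) - (1ℤ + n))
      lines c = trans (∑-*ˡ c (λ j → n * δ (ℓ j w) 𝟘 - 1ℤ))
        (cong (c *_) (trans (∑-minus (λ j → n * δ (ℓ j w) 𝟘) (λ _ → 1ℤ))
          (cong₂ _-_ (trans (∑-*ˡ n (λ j → δ (ℓ j w) 𝟘)) (cong (n *_) (∑-lines w))) ∑-direction-1)))

    -- Both factors of a convolution lose one q, which together use up one of the three factors n.
    amplitude-orthogonal : ∀ s t w → ∑₂ (λ u v → ∑ (λ x → amplitude u v x * amplitude (u xor s) (v xor t) (w ⊟ x))) ≡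
      + 4 * (n * n) * unit s t * δ w V-𝟘
    amplitude-orthogonal s t w = q-cancel (q-cancel (begin
      q * (q * ∑₂ R)
        ≡⟨ trans (sym (*-assoc q q (∑₂ R))) (sym (∑₂-*ˡ (q * q) R)) ⟩
      ∑₂ (λ u v → q * q * R u v)
        ≡⟨ ∑₂-cong (λ u v → trans (sym (∑-*ˡ (q * q) (λ x → amplitude u v x * amplitude (u xor s) (v xor t) (w ⊟ x))))
             (∑-cong λ x → trans (distribute q (amplitude u v x) (amplitude (u xor s) (v xor t) (w ⊟ x)))
               (sym (cong₂ _*_ (f≡q*amplitude u v x) (f≡q*amplitude (u xor s) (v xor t) (w ⊟ x)))))) ⟩
      ∑₂ (λ u v → ∑ (λ x → f u v x * f (u xor s) (v xor t) (w ⊟ x)))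
        ≡⟨ f-orthogonal s t w ⟩
      + 4 * unit s t * (n * n * n) * δ w V-𝟘
        ≡⟨ cong (λ z → + 4 * unit s t * (n * n * z) * δ w V-𝟘) n≡q² ⟩
      + 4 * unit s t * (n * n * (q * q)) * δ w V-𝟘
        ≡⟨ regroup q n (unit s t) (δ w V-𝟘) ⟩
      q * (q * (+ 4 * (n * n) * unit s t * δ w V-𝟘)) ∎))
      where
      open ≡-Reasoning
      R : Bool → Bool → ℤ
      R u v = ∑ (λ x → amplitude u v x * amplitude (u xor s) (v xor t) (w ⊟ x))
      distribute : ∀ q a b → q * q * (a * b) ≡ q * a * (q * b)
      distribute = solve-∀
      regroup : ∀ q n U d → + 4 * U * (n * n * (q * q)) * d ≡ q * (q * (+ 4 * (n * n) * U * d))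
      regroup = solve-∀

    -- Along a vertical line the vertical form is constant, and each other form takes every value
    -- once. So η survives only in the vertical direction, and, as c ≠ 0, the indicators only in the
    -- others.
    ∑-f-vertical : ∀ u v c → c ≢ 𝟘 → ∑ (λ b → f u v (c , b)) ≡ μ u v nothing * (n * η c) + q * ∑ (λ j → γ u v (just j))
    ∑-f-vertical u v c c≢𝟘 = begin
      ∑ (λ b → f u v (c , b))
        ≡⟨ trans (∑-cong λ b → f-def u v (c , b)) (∑-+ (λ b → ∑ (λ j → μ u v j * η (ℓ j (c , b)))) (λ b → q * ∑ (λ j → γ u v j * δ (ℓ j (c , b)) 𝟘))) ⟩
      ∑ (λ b → ∑ (λ j → μ u v j * η (ℓ j (c , b)))) + ∑ (λ b → q * ∑ (λ j → γ u v j * δ (ℓ j (c , b)) 𝟘))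
        ≡⟨ cong₂ _+_ (spread (μ u v) η) (trans (∑-*ˡ q (λ b → ∑ (λ j → γ u v j * δ (ℓ j (c , b)) 𝟘))) (cong (q *_) (spread (γ u v) (λ t → δ t 𝟘)))) ⟩
      (μ u v nothing * (n * η c) + ∑ (λ j → μ u v (just j)) * ∑ η) + q * (γ u v nothing * (n * δ c 𝟘) + ∑ (λ j → γ u v (just j)) * ∑ (λ t → δ t 𝟘))
        ≡⟨ cong₂ (λ x y → (μ u v nothing * (n * η c) + ∑ (λ j → μ u v (just j)) * x) + q * y) ∑-η
             (cong₂ (λ x y → γ u v nothing * (n * x) + ∑ (λ j → γ u v (just j)) * y) (δ-≢ c≢𝟘) (∑-δ₁ 𝟘)) ⟩
      (μ u v nothing * (n * η c) + ∑ (λ j → μ u v (just j)) * 0ℤ) + q * (γ u v nothing * (n * 0ℤ) + ∑ (λ j → γ u v (just j)) * 1ℤ)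
        ≡⟨ simplify (μ u v nothing * (n * η c)) (∑ (λ j → μ u v (just j))) q (γ u v nothing) n (∑ (λ j → γ u v (just j))) ⟩
      μ u v nothing * (n * η c) + q * ∑ (λ j → γ u v (just j)) ∎
      where
      open ≡-Reasoning
      simplify : ∀ a b q g n d → (a + b * 0ℤ) + q * (g * (n * 0ℤ) + d * 1ℤ) ≡ a + q * d
      simplify = solve-∀
      spread : ∀ (κ : Direction → ℤ) (h : Carrier → ℤ) → ∑ (λ b → ∑ (λ j → κ j * h (ℓ j (c , b)))) ≡
        κ nothing * (n * h c) + ∑ (λ j → κ (just j)) * ∑ h
      spread κ h = trans (∑-comm (λ b j → κ j * h (ℓ j (c , b))))
        (trans (∑-cong (λ j → ∑-*ˡ (κ j) (λ b → h (ℓ j (c , b)))))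
        (trans (∑-Maybe (λ j → κ j * ∑ (λ b → h (ℓ j (c , b)))))
        (cong₂ _+_ (cong (κ nothing *_) (∑-const (h c)))
          (trans (∑-cong (λ (x , y) → cong (κ (just (x , y)) *_) (∑-translate (⊖ (slope x y ⊙ c)) h))) (∑-*ʳ (∑ h) (λ j → κ (just j)))))))

    -- For v = `false` the totals of γ over the slopes vanish and the vertical weight μ changes sign
    -- with u. For v = `true` that weight vanishes and the totals of γ are `sgn u`.
    ∑-f-blocks : ∀ v c → c ≢ 𝟘 → ∑ (λ b → f false v (c , b) + f true v (c , b)) ≡ 0ℤ
    ∑-f-blocks v c c≢𝟘 = trans (∑-+ (λ b → f false v (c , b)) (λ b → f true v (c , b)))
      (trans (cong₂ _+_ (∑-f-vertical false v c c≢𝟘) (∑-f-vertical true v c c≢𝟘)) (cancels v))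
      where
      zero₁ : ∀ q x → (1ℤ * x + q * 0ℤ) + (-1ℤ * x + q * 0ℤ) ≡ 0ℤ
      zero₁ = solve-∀
      zero₂ : ∀ q x → (0ℤ * x + q * 1ℤ) + (0ℤ * x + q * -1ℤ) ≡ 0ℤ
      zero₂ = solve-∀
      cancels : ∀ v → (μ false v nothing * (n * η c) + q * ∑ (λ j → γ false v (just j))) + (μ true v nothing * (n * η c) + q * ∑ (λ j → γ true v (just j))) ≡ 0ℤ
      cancels false = trans (cong₂ (λ x y → (1ℤ * (n * η c) + q * x) + (-1ℤ * (n * η c) + q * y)) (∑-γ-false false) (∑-γ-false true)) (zero₁ q (n * η c))
      cancels true  = trans (cong₂ (λ x y → (0ℤ * (n * η c) + q * x) + (0ℤ * (n * η c) + q * y)) (∑-γ-true false) (∑-γ-true true)) (zero₂ q (n * η c))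

  module Assembly (𝔽 𝕂 : FiniteField) (coordinates : Coordinates 𝔽 𝕂)
                  (signs : Signs (FiniteField.Carrier 𝔽) {{FiniteField.carrier-finite 𝔽}}) where
    open FieldProperties 𝕂
    open Directions 𝔽 𝕂 coordinates
    open Evaluation 𝔽 𝕂 coordinates signs
    open PrimeQuadruple 𝔽 𝕂 coordinates signs

    private instance
      F-finite : Finite (FiniteField.Carrier 𝔽)
      F-finite = FiniteField.carrier-finite 𝔽
      K-finite : Finite Carrier
      K-finite = carrier-finite

    matrix : Bool → Bool → V → V → ℤ
    matrix u v w w′ = amplitude u v (w ⊟ w′)

    matrix-product : ∀ u v u′ v′ w w′ → (matrix u v ⊠ matrix u′ v′) w w′ ≡
      ∑ (λ x → amplitude u v x * amplitude u′ v′ ((w ⊟ w′) ⊟ x))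
    matrix-product u v u′ v′ w w′ = trans (⊠-def (matrix u v) (matrix u′ v′) w w′) (trans
      (∑-cong λ x → cong (λ y → amplitude u v (w ⊟ x) * amplitude u′ v′ y) (sym (⊟-⊟ w w′ x)))
      (∑-V-reflect w (λ x → amplitude u v x * amplitude u′ v′ ((w ⊟ w′) ⊟ x))))

    ⊟-involutive : ∀ w v → w ⊟ (w ⊟ v) ≡ v
    ⊟-involutive (a , b) (a′ , b′) = cong₂ _,_ (lemma a a′) (lemma b b′)
      where
      lemma : ∀ a a′ → a ⊕ ⊖ (a ⊕ ⊖ a′) ≡ a′
      lemma = solve 2 (λ a a′ → a :- (a :- a′) := a′) refl

    -- Translation-invariant matrices multiply by convolution, and the reflection of the summation
    -- variable exchanges the two functions.
    matrix-commute : ∀ u v u′ v′ w w′ → (matrix u v ⊠ matrix u′ v′) w w′ ≡ (matrix u′ v′ ⊠ matrix u v) w w′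
    matrix-commute u v u′ v′ w w′ = begin
      (matrix u v ⊠ matrix u′ v′) w w′
        ≡⟨ matrix-product u v u′ v′ w w′ ⟩
      ∑ (λ x → amplitude u v x * amplitude u′ v′ ((w ⊟ w′) ⊟ x))
        ≡⟨ ∑-V-reflect (w ⊟ w′) (λ x → amplitude u v x * amplitude u′ v′ ((w ⊟ w′) ⊟ x)) ⟨
      ∑ (λ x → amplitude u v ((w ⊟ w′) ⊟ x) * amplitude u′ v′ ((w ⊟ w′) ⊟ ((w ⊟ w′) ⊟ x)))
        ≡⟨ ∑-cong (λ x → trans (cong (λ y → amplitude u v ((w ⊟ w′) ⊟ x) * amplitude u′ v′ y) (⊟-involutive (w ⊟ w′) x))
             (*-comm (amplitude u v ((w ⊟ w′) ⊟ x)) (amplitude u′ v′ x))) ⟩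
      ∑ (λ x → amplitude u′ v′ x * amplitude u v ((w ⊟ w′) ⊟ x))
        ≡⟨ matrix-product u′ v′ u v w w′ ⟨
      (matrix u′ v′ ⊠ matrix u v) w w′ ∎
      where open ≡-Reasoning

    δ-⊟ : ∀ w w′ → δ (w ⊟ w′) V-𝟘 ≡ δ w w′
    δ-⊟ (a , b) (a′ , b′) with (a , b) ≟ (a′ , b′)
    ... | yes e = trans (δ-≡ (trans (cong (_⊟ (a′ , b′)) e) (cong₂ _,_ (self a′) (self b′)))) (sym (δ-≡ e))
      where
      self : ∀ a → a ⊕ ⊖ a ≡ 𝟘
      self = solve 1 (λ a → a :- a := con 0ℤ) refl
    ... | no ¬e = trans (δ-≢ (λ d → ¬e (cong₂ _,_ (⊖-≡𝟘 (cong proj₁ d)) (⊖-≡𝟘 (cong proj₂ d))))) (sym (δ-≢ ¬e))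

    matrix-orthogonal : ∀ s t w w′ → ∑₂ (λ u v → (matrix u v ⊠ matrix (u xor s) (v xor t)) w w′) ≡ + 4 * (n * n) * unit s t * δ w w′
    matrix-orthogonal s t w w′ = trans (∑₂-cong λ u v → matrix-product u v (u xor s) (v xor t) w w′)
      (trans (amplitude-orthogonal s t (w ⊟ w′)) (cong (+ 4 * (n * n) * unit s t *_) (δ-⊟ w w′)))

    ∑-amplitude-off : ∀ v c → c ≢ 𝟘 → ∑ (λ b → amplitude false v (c , b) + amplitude true v (c , b)) ≡ 0ℤ
    ∑-amplitude-off v c c≢𝟘 = q-cancel (begin
      q * ∑ (λ b → amplitude false v (c , b) + amplitude true v (c , b))
        ≡⟨ ∑-*ˡ q (λ b → amplitude false v (c , b) + amplitude true v (c , b)) ⟨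
      ∑ (λ b → q * (amplitude false v (c , b) + amplitude true v (c , b)))
        ≡⟨ ∑-cong (λ b → trans (*-distribˡ-+ q (amplitude false v (c , b)) (amplitude true v (c , b)))
             (sym (cong₂ _+_ (f≡q*amplitude false v (c , b)) (f≡q*amplitude true v (c , b))))) ⟩
      ∑ (λ b → f false v (c , b) + f true v (c , b))
        ≡⟨ trans (∑-f-blocks v c c≢𝟘) (sym (*-zeroʳ q)) ⟩
      q * 0ℤ ∎)
      where open ≡-Reasoning

    -- This is the case of the diagonal blocks in `row-sums′`. The two values at b = 0 are opposite,
    -- which leaves twice the total of η.
    ∑-amplitude-vertical : ∑ (λ b → amplitude false true (𝟘 , b) + amplitude true true (𝟘 , b)) ≡ 0ℤ
    ∑-amplitude-vertical = trans (∑-cong λ b → trans (cong₂ _+_ (amplitude-vertical′ false b) (amplitude-vertical′ true b)) (lemma (η b) (δ b 𝟘)))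
      (trans (∑-*ˡ (+ 2) η) (trans (cong (+ 2 *_) ∑-η) (*-zeroʳ (+ 2))))
      where
      lemma : ∀ h d → (h + 1ℤ * d) + (h + -1ℤ * d) ≡ + 2 * h
      lemma = solve-∀

    ∑-block : ∀ v x y x′ → ∑ (λ y′ → matrix false v (x , y) (x′ , y′) + matrix true v (x , y) (x′ , y′)) ≡
      ∑ (λ b → amplitude false v (x ⊕ ⊖ x′ , b) + amplitude true v (x ⊕ ⊖ x′ , b))
    ∑-block v x y x′ = ∑-reflect y (λ b → amplitude false v (x ⊕ ⊖ x′ , b) + amplitude true v (x ⊕ ⊖ x′ , b))

    quadruple : Quadruple Carrier
    quadruple = record
      { A          = matrix
      ; entries    = λ u v w w′ → amplitude-±1 u v (w ⊟ w′)
      ; symmetric  = λ u v w w′ → amplitude-even u v w w′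
      ; commute    = matrix-commute
      ; orthogonal = matrix-orthogonal
      ; diagonal   = λ u x y y′ → trans (cong (λ a → amplitude u false (a , y ⊕ ⊖ y′)) (solve 1 (λ a → a :- a := con 0ℤ) refl x))
                                        (amplitude-vertical u (y ⊕ ⊖ y′))
      ; row-sums   = λ v x y x′ x≢x′ → trans (∑-block v x y x′) (∑-amplitude-off v (x ⊕ ⊖ x′) (x≢x′ ∘ ⊖-≡𝟘))
      ; row-sums′  = λ x y x′ → trans (∑-block true x y x′) (any-block (x ⊕ ⊖ x′))
      }
      where
      any-block : ∀ c → ∑ (λ b → amplitude false true (c , b) + amplitude true true (c , b)) ≡ 0ℤ
      any-block c with c ≟ 𝟘
      ... | yes c≡𝟘 = trans (cong (λ c → ∑ (λ b → amplitude false true (c , b) + amplitude true true (c , b))) c≡𝟘) ∑-amplitude-vertical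
      ... | no c≢𝟘  = ∑-amplitude-off true c c≢𝟘

  -- The product construction

  -- The entry ½ (a + a′) b + ½ (a - a′) b′ of Turyn's product for signs a and a′, without division:
  -- exactly one of the two halves is nonzero, and it equals a.
  mix : ℤ → ℤ → ℤ → ℤ → ℤ
  mix a a′ b b′ = if does (a ℤP.≟ a′) then a * b else a * b′

  ±1 : ℤ → Set
  ±1 a = a ≡ 1ℤ ⊎ a ≡ -1ℤ

  ±1-* : ∀ {a b} → ±1 a → ±1 b → ±1 (a * b)
  ±1-* (inj₁ refl) (inj₁ refl) = inj₁ refl
  ±1-* (inj₁ refl) (inj₂ refl) = inj₂ refl
  ±1-* (inj₂ refl) (inj₁ refl) = inj₂ refl
  ±1-* (inj₂ refl) (inj₂ refl) = inj₁ refl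

  2mix : ∀ {a a′} → ±1 a → ±1 a′ → ∀ b b′ → + 2 * mix a a′ b b′ ≡ (a + 1ℤ * a′) * b + (a + -1ℤ * a′) * b′
  2mix (inj₁ refl) (inj₁ refl) = lemma
    where
    lemma : ∀ b b′ → + 2 * (1ℤ * b) ≡ + 2 * b + 0ℤ * b′
    lemma = solve-∀
  2mix (inj₁ refl) (inj₂ refl) = lemma
    where
    lemma : ∀ b b′ → + 2 * (1ℤ * b′) ≡ 0ℤ * b + + 2 * b′
    lemma = solve-∀
  2mix (inj₂ refl) (inj₁ refl) = lemma
    where
    lemma : ∀ b b′ → + 2 * (-1ℤ * b′) ≡ 0ℤ * b + (- + 2) * b′
    lemma = solve-∀
  2mix (inj₂ refl) (inj₂ refl) = lemma
    where
    lemma : ∀ b b′ → + 2 * (-1ℤ * b) ≡ (- + 2) * b + 0ℤ * b′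
    lemma = solve-∀

  mix-±1 : ∀ {a a′ b b′} → ±1 a → ±1 b → ±1 b′ → ±1 (mix a a′ b b′)
  mix-±1 {a} {a′} a-±1 b-±1 b′-±1 with does (a ℤP.≟ a′)
  ... | true  = ±1-* a-±1 b-±1
  ... | false = ±1-* a-±1 b′-±1

  mix-one : ∀ a a′ → mix a a′ 1ℤ 1ℤ ≡ a
  mix-one a a′ with does (a ℤP.≟ a′)
  ... | true  = *-identityʳ a
  ... | false = *-identityʳ a

  opaque
    unfolding ∑₂

    ∑₂-swap : ∀ (f : Bool → Bool → Bool → Bool → ℤ) →
      ∑₂ (λ u v → ∑₂ (λ p r → f u v p r)) ≡ ∑₂ (λ p r → ∑₂ (λ u v → f u v p r))
    ∑₂-swap f = trans (∑₂-+ (λ u v → f u v false false + f u v false true + f u v true false) (λ u v → f u v true true))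
      (cong (λ z → z + ∑₂ (λ u v → f u v true true))
        (trans (∑₂-+ (λ u v → f u v false false + f u v false true) (λ u v → f u v true false))
          (cong (λ z → z + ∑₂ (λ u v → f u v true false)) (∑₂-+ (λ u v → f u v false false) (λ u v → f u v false true)))))

    ∑₂-transpose : ∀ (f : Bool → Bool → ℤ) → ∑₂ f ≡ ∑₂ (λ p r → f r p)
    ∑₂-transpose f = lemma (f false false) (f false true) (f true false) (f true true)
      where
      lemma : ∀ a b c d → a + b + c + d ≡ a + c + b + d
      lemma = solve-∀

    ∑₂-product : ∀ (g h : Bool → ℤ) → ∑₂ (λ u v → g u * h v) ≡ (g false + g true) * (h false + h true)
    ∑₂-product g h = lemma (g false) (g true) (h false) (h true)
      where
      lemma : ∀ a b c d → a * c + a * d + b * c + b * d ≡ (a + b) * (c + d)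
      lemma = solve-∀

  module _ {I : Set} {{_ : Finite I}} where
    opaque
      unfolding _⊠_

      ⊠-bilinear : ∀ (A A′ B B′ : I → I → ℤ) c d i j →
        ((λ i j → A i j + c * A′ i j) ⊠ (λ i j → B i j + d * B′ i j)) i j ≡
        (A ⊠ B) i j + d * (A ⊠ B′) i j + c * (A′ ⊠ B) i j + c * d * (A′ ⊠ B′) i j
      ⊠-bilinear A A′ B B′ c d i j = begin
        ∑ (λ k → (A i k + c * A′ i k) * (B k j + d * B′ k j))
          ≡⟨ ∑-cong (λ k → expand c d (A i k) (A′ i k) (B k j) (B′ k j)) ⟩
        ∑ (λ k → x k + d * y k + c * z k + c * d * t k)
          ≡⟨ ∑-+ (λ k → x k + d * y k + c * z k) (λ k → c * d * t k) ⟩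
        ∑ (λ k → x k + d * y k + c * z k) + ∑ (λ k → c * d * t k)
          ≡⟨ cong₂ _+_ (trans (∑-+ (λ k → x k + d * y k) (λ k → c * z k))
               (cong₂ _+_ (trans (∑-+ x (λ k → d * y k)) (cong (λ s → ∑ x + s) (∑-*ˡ d y))) (∑-*ˡ c z))) (∑-*ˡ (c * d) t) ⟩
        ∑ x + d * ∑ y + c * ∑ z + c * d * ∑ t ∎
        where
        open ≡-Reasoning
        x y z t : I → ℤ
        x k = A i k * B k j
        y k = A i k * B′ k j
        z k = A′ i k * B k j
        t k = A′ i k * B′ k j
        expand : ∀ c d a a′ b b′ → (a + c * a′) * (b + d * b′) ≡ a * b + d * (a * b′) + c * (a′ * b) + c * d * (a′ * b′)
        expand = solve-∀

  four-terms : ∀ (a b c d : Bool → ℤ) →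
    (a false * b false + a true * b true) * (c false * d false + c true * d true) ≡ ∑₂ (λ p r → (a p * c r) * (b p * d r))
  four-terms a b c d = trans (lemma (a false) (b false) (a true) (b true) (c false) (d false) (c true) (d true))
    (sym (∑₂-def (λ p r → (a p * c r) * (b p * d r))))
    where
    lemma : ∀ a b a′ b′ c d c′ d′ → (a * b + a′ * b′) * (c * d + c′ * d′) ≡
      (a * c) * (b * d) + (a * c′) * (b * d′) + (a′ * c) * (b′ * d) + (a′ * c′) * (b′ * d′)
    lemma = solve-∀

  module Tensor {X Y : Set} {{X-finite : Finite X}} {{Y-finite : Finite Y}} where

    -- The components are interleaved so that a block number of the product is a pair of block
    -- numbers, as the block structure requires.
    Index : Set
    Index = (X × Y) × (X × Y)

    left : Index → X × X
    left ((x , y) , (x′ , y′)) = x , x′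

    right : Index → Y × Y
    right ((x , y) , (x′ , y′)) = y , y′

    index↔ : ((X × X) × (Y × Y)) ↔ Index
    index↔ = mk↔ₛ′ (λ ((x , x′) , (y , y′)) → (x , y) , (x′ , y′)) (λ i → left i , right i) (λ _ → refl) (λ _ → refl)

    ∑-index : ∀ (f : X × X → ℤ) (g : Y × Y → ℤ) → ∑ (λ i → f (left i) * g (right i)) ≡ ∑ f * ∑ g
    ∑-index f g = trans (sym (∑-reindex index↔ (λ i → f (left i) * g (right i))))
      (trans (∑-× (λ (i , j) → f i * g j)) (∑-∑-* f g))

    -- Twice each matrix is a sum of two Kronecker products, so the product, multiplied by 4,
    -- consists of four terms to which the mixed-product rule applies.
    tensor-⊠ : ∀ (C D : Index → Index → ℤ) (P Q : Bool → X × X → X × X → ℤ) (R S : Bool → Y × Y → Y × Y → ℤ) →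
      (∀ i j → + 2 * C i j ≡ P false (left i) (left j) * R false (right i) (right j) + P true (left i) (left j) * R true (right i) (right j)) →
      (∀ i j → + 2 * D i j ≡ Q false (left i) (left j) * S false (right i) (right j) + Q true (left i) (left j) * S true (right i) (right j)) →
      ∀ i j → + 4 * (C ⊠ D) i j ≡ ∑₂ (λ p r → (P p ⊠ Q r) (left i) (left j) * (R p ⊠ S r) (right i) (right j))
    tensor-⊠ C D P Q R S 2C 2D i j = begin
      + 4 * (C ⊠ D) i j
        ≡⟨ cong (+ 4 *_) (⊠-def C D i j) ⟩
      + 4 * ∑ (λ k → C i k * D k j)
        ≡⟨ ∑-*ˡ (+ 4) (λ k → C i k * D k j) ⟨
      ∑ (λ k → + 4 * (C i k * D k j))
        ≡⟨ ∑-cong (λ k → trans (double (C i k) (D k j)) (trans (cong₂ _*_ (2C i k) (2D k j))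
             (four-terms (λ p → P p (left i) (left k)) (λ p → R p (right i) (right k)) (λ r → Q r (left k) (left j)) (λ r → S r (right k) (right j))))) ⟩
      ∑ (λ k → ∑₂ (λ p r → term p r k))
        ≡⟨ ∑-∑₂ term ⟨
      ∑₂ (λ p r → ∑ (λ k → term p r k))
        ≡⟨ ∑₂-cong (λ p r → trans (∑-index (λ k → P p (left i) k * Q r k (left j)) (λ k → R p (right i) k * S r k (right j)))
             (sym (cong₂ _*_ (⊠-def (P p) (Q r) (left i) (left j)) (⊠-def (R p) (S r) (right i) (right j))))) ⟩
      ∑₂ (λ p r → (P p ⊠ Q r) (left i) (left j) * (R p ⊠ S r) (right i) (right j)) ∎
      where
      open ≡-Reasoning
      double : ∀ a b → + 4 * (a * b) ≡ (+ 2 * a) * (+ 2 * b)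
      double = solve-∀
      term : Bool → Bool → Index → ℤ
      term p r k = (P p (left i) (left k) * Q r (left k) (left j)) * (R p (right i) (right k) * S r (right k) (right j))

    size-× : size-of (X × Y) ≡ size-of X * size-of Y
    size-× = trans (sym ∑-1) (trans (∑-× (λ _ → 1ℤ)) (trans (∑-cong λ _ → ∑-1) (∑-const (size-of Y))))

    δ-index : ∀ i j → δ i j ≡ δ (left i) (left j) * δ (right i) (right j)
    δ-index i@((x , y) , (x′ , y′)) j@((z , t) , (z′ , t′)) with left i ≟ left j | right i ≟ right j
    ... | yes p | yes r = trans (δ-≡ (cong₂ _,_ (cong₂ _,_ (cong proj₁ p) (cong proj₁ r)) (cong₂ _,_ (cong proj₂ p) (cong proj₂ r))))
                                (sym (cong₂ _*_ (δ-≡ p) (δ-≡ r)))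
    ... | yes p | no ¬r = trans (δ-≢ (¬r ∘ cong right)) (sym (trans (cong (δ (left i) (left j) *_) (δ-≢ ¬r)) (*-zeroʳ (δ (left i) (left j)))))
    ... | no ¬p | _     = trans (δ-≢ (¬p ∘ cong left)) (sym (trans (cong (_* δ (right i) (right j)) (δ-≢ ¬p)) (*-zeroˡ (δ (right i) (right j)))))

  module Composition {X Y : Set} {{X-finite : Finite X}} {{Y-finite : Finite Y}} (𝒜 : Quadruple X) (ℬ : Quadruple Y) where
    open Tensor {X} {Y}
    open Quadruple 𝒜 using (A)
    open Quadruple ℬ using () renaming (A to B)
    private
      module 𝒜 = Quadruple 𝒜
      module ℬ = Quadruple ℬ

    P : Bool → Bool → X × X → X × X → ℤ
    P u p i j = A u false i j + sgn p * A u true i j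

    C : Bool → Bool → Index → Index → ℤ
    C u v i j = mix (A u false (left i) (left j)) (A u true (left i) (left j)) (B false v (right i) (right j)) (B true v (right i) (right j))

    2C : ∀ u v i j → + 2 * C u v i j ≡ P u false (left i) (left j) * B false v (right i) (right j) + P u true (left i) (left j) * B true v (right i) (right j)
    2C u v i j = 2mix (𝒜.entries u false (left i) (left j)) (𝒜.entries u true (left i) (left j)) (B false v (right i) (right j)) (B true v (right i) (right j))

    4C⊠C : ∀ u v u′ v′ i j → + 4 * (C u v ⊠ C u′ v′) i j ≡
      ∑₂ (λ p r → (P u p ⊠ P u′ r) (left i) (left j) * (B p v ⊠ B r v′) (right i) (right j))
    4C⊠C u v u′ v′ = tensor-⊠ (C u v) (C u′ v′) (P u) (P u′) (λ p → B p v) (λ r → B r v′) (2C u v) (2C u′ v′)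

    P⊠P : ∀ u p u′ r i j → (P u p ⊠ P u′ r) i j ≡
      (A u false ⊠ A u′ false) i j + sgn r * (A u false ⊠ A u′ true) i j + sgn p * (A u true ⊠ A u′ false) i j + sgn p * sgn r * (A u true ⊠ A u′ true) i j
    P⊠P u p u′ r i j = ⊠-bilinear (A u false) (A u true) (A u′ false) (A u′ true) (sgn p) (sgn r) i j

    P-commute : ∀ u p u′ r i j → (P u p ⊠ P u′ r) i j ≡ (P u′ r ⊠ P u p) i j
    P-commute u p u′ r i j = trans (P⊠P u p u′ r i j) (trans
      (rearrange (sgn p) (sgn r) (𝒜.commute u false u′ false i j) (𝒜.commute u false u′ true i j) (𝒜.commute u true u′ false i j) (𝒜.commute u true u′ true i j))
      (sym (P⊠P u′ r u p i j)))
      where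
      rearrange : ∀ c d {a a′ b b′ x x′ y y′} → a ≡ a′ → b ≡ b′ → x ≡ x′ → y ≡ y′ →
        a + d * b + c * x + c * d * y ≡ a′ + c * x′ + d * b′ + d * c * y′
      rearrange c d {a} {b = b} {x = x} {y = y} refl refl refl refl = lemma c d a b x y
        where
        lemma : ∀ c d a b x y → a + d * b + c * x + c * d * y ≡ a + c * x + d * b + d * c * y
        lemma = solve-∀

    4-cancel : ∀ {a b} → + 4 * a ≡ + 4 * b → a ≡ b
    4-cancel {a} {b} = *-cancelˡ-≡ (+ 4) a b

    C-commute : ∀ u v u′ v′ i j → (C u v ⊠ C u′ v′) i j ≡ (C u′ v′ ⊠ C u v) i j
    C-commute u v u′ v′ i j = 4-cancel (trans (4C⊠C u v u′ v′ i j)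
      (trans (∑₂-cong λ p r → cong₂ _*_ (P-commute u p u′ r (left i) (left j)) (ℬ.commute p v r v′ (right i) (right j)))
      (trans (∑₂-transpose (λ p r → (P u′ r ⊠ P u p) (left i) (left j) * (B r v′ ⊠ B p v) (right i) (right j)))
      (sym (4C⊠C u′ v′ u v i j)))))

    n m : ℤ
    n = size-of X
    m = size-of Y

    -- The sum over u of the products of P for u and u + s; in the orthogonality of C it collects
    -- all that depends on the first factor.
    PP : Bool → Bool → Bool → X × X → X × X → ℤ
    PP s p r i j = (P false p ⊠ P s r) i j + (P true p ⊠ P (true xor s) r) i j

    𝒜-orthogonal : ∀ s t i j →
      (A false false ⊠ A s t) i j + (A false true ⊠ A s (true xor t)) i j + (A true false ⊠ A (true xor s) t) i j + (A true true ⊠ A (true xor s) (true xor t)) i j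
      ≡ + 4 * (n * n) * unit s t * δ i j
    𝒜-orthogonal s t i j = trans (sym (∑₂-def (λ u v → (A u v ⊠ A (u xor s) (v xor t)) i j))) (𝒜.orthogonal s t i j)

    -- Expanding P, the products A_uv A_(u+s)v give the orthogonality relation of 𝒜 with t = 0, and
    -- the cross terms, with common sign `sgn p`, the one with t = 1, which is zero.
    PP-equal : ∀ s p i j → PP s p p i j ≡ + 4 * (n * n) * unit s false * δ i j
    PP-equal s p i j = trans (cong₂ _+_ (P⊠P false p s p i j) (P⊠P true p (true xor s) p i j))
      (trans (regroup p ((A false false ⊠ A s false) i j) ((A false false ⊠ A s true) i j) ((A false true ⊠ A s false) i j) ((A false true ⊠ A s true) i j)
                        ((A true false ⊠ A (true xor s) false) i j) ((A true false ⊠ A (true xor s) true) i j) ((A true true ⊠ A (true xor s) false) i j) ((A true true ⊠ A (true xor s) true) i j))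
      (trans (cong₂ (λ x y → x + sgn p * y) (𝒜-orthogonal s false i j) (𝒜-orthogonal s true i j))
        (vanish s)))
      where
      regroup : ∀ p a b c d a′ b′ c′ d′ →
        (a + sgn p * b + sgn p * c + sgn p * sgn p * d) + (a′ + sgn p * b′ + sgn p * c′ + sgn p * sgn p * d′)
        ≡ (a + d + a′ + d′) + sgn p * (b + c + b′ + c′)
      regroup false = lemma
        where
        lemma : ∀ a b c d a′ b′ c′ d′ → (a + 1ℤ * b + 1ℤ * c + 1ℤ * d) + (a′ + 1ℤ * b′ + 1ℤ * c′ + 1ℤ * d′) ≡ (a + d + a′ + d′) + 1ℤ * (b + c + b′ + c′)
        lemma = solve-∀
      regroup true = lemma
        where
        lemma : ∀ a b c d a′ b′ c′ d′ → (a + -1ℤ * b + -1ℤ * c + 1ℤ * d) + (a′ + -1ℤ * b′ + -1ℤ * c′ + 1ℤ * d′) ≡ (a + d + a′ + d′) + -1ℤ * (b + c + b′ + c′)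
        lemma = solve-∀
      zero-term : ∀ a σ x d → a + σ * (x * 0ℤ * d) ≡ a
      zero-term = solve-∀
      vanish : ∀ s → + 4 * (n * n) * unit s false * δ i j + sgn p * (+ 4 * (n * n) * unit s true * δ i j) ≡ + 4 * (n * n) * unit s false * δ i j
      vanish false = zero-term (+ 4 * (n * n) * unit false false * δ i j) (sgn p) (+ 4 * (n * n)) (δ i j)
      vanish true  = zero-term (+ 4 * (n * n) * unit true false * δ i j) (sgn p) (+ 4 * (n * n)) (δ i j)

    -- Commutation interchanges p and r; for s = `true` it also interchanges the two terms of the
    -- sum over u.
    PP-swap : ∀ s i j → PP s false true i j ≡ PP s true false i j
    PP-swap false i j = cong₂ _+_ (P-commute false false false true i j) (P-commute true false true true i j)
    PP-swap true  i j = trans (cong₂ _+_ (P-commute false false true true i j) (P-commute true false false true i j))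
      (+-comm ((P true true ⊠ P false false) i j) ((P false true ⊠ P true false) i j))

    BB : Bool → Bool → Bool → Y × Y → Y × Y → ℤ
    BB t p r i j = (B p false ⊠ B r t) i j + (B p true ⊠ B r (true xor t)) i j

    -- The remaining sum over the first index of B, at fixed difference r, completes the
    -- orthogonality relation of ℬ.
    BB-sum : ∀ r t i j → BB t false r i j + BB t true (true xor r) i j ≡ + 4 * (m * m) * unit r t * δ i j
    BB-sum r t i j = trans (assoc ((B false false ⊠ B r t) i j) _ _ _)
      (trans (sym (∑₂-def (λ u v → (B u v ⊠ B (u xor r) (v xor t)) i j))) (ℬ.orthogonal r t i j))
      where
      assoc : ∀ a b c d → (a + b) + (c + d) ≡ a + b + c + d
      assoc = solve-∀

    -- The sum over u affects only P and the sum over v only B. As `PP` depends on p and r through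
    -- their difference alone, the B-sums can be grouped by that difference; the group with p ≠ r
    -- vanishes by the orthogonality of ℬ, so its unknown factor `PP` does not matter.
    4C-orthogonal : ∀ s t i j → + 4 * ∑₂ (λ u v → (C u v ⊠ C (u xor s) (v xor t)) i j) ≡
      + 4 * (n * n) * unit s false * δ (left i) (left j) * (+ 4 * (m * m) * unit false t * δ (right i) (right j))
    4C-orthogonal s t i j = begin
      + 4 * ∑₂ (λ u v → (C u v ⊠ C (u xor s) (v xor t)) i j)
        ≡⟨ ∑₂-*ˡ (+ 4) (λ u v → (C u v ⊠ C (u xor s) (v xor t)) i j) ⟨
      ∑₂ (λ u v → + 4 * (C u v ⊠ C (u xor s) (v xor t)) i j)
        ≡⟨ ∑₂-cong (λ u v → 4C⊠C u v (u xor s) (v xor t) i j) ⟩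
      ∑₂ (λ u v → ∑₂ (λ p r → g u p r * h v p r))
        ≡⟨ ∑₂-swap (λ u v p r → g u p r * h v p r) ⟩
      ∑₂ (λ p r → ∑₂ (λ u v → g u p r * h v p r))
        ≡⟨ ∑₂-cong (λ p r → ∑₂-product (λ u → g u p r) (λ v → h v p r)) ⟩
      ∑₂ (λ p r → PP s p r (left i) (left j) * BB t p r (right i) (right j))
        ≡⟨ ∑₂-def (λ p r → PP s p r (left i) (left j) * BB t p r (right i) (right j)) ⟩
      pp false false * bb false false + pp false true * bb false true + pp true false * bb true false + pp true true * bb true true
        ≡⟨ collect (PP-equal s false (left i) (left j)) (PP-equal s true (left i) (left j)) (PP-swap s (left i) (left j))
             (BB-sum false t (right i) (right j)) (BB-sum true t (right i) (right j)) ⟩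
      κ * (+ 4 * (m * m) * unit false t * δ (right i) (right j)) + pp true false * (+ 4 * (m * m) * unit true t * δ (right i) (right j))
        ≡⟨ zero-term (κ * (+ 4 * (m * m) * unit false t * δ (right i) (right j))) (pp true false) (+ 4 * (m * m)) (δ (right i) (right j)) ⟩
      κ * (+ 4 * (m * m) * unit false t * δ (right i) (right j)) ∎
      where
      open ≡-Reasoning
      g h : Bool → Bool → Bool → ℤ
      g u p r = (P u p ⊠ P (u xor s) r) (left i) (left j)
      h v p r = (B p v ⊠ B r (v xor t)) (right i) (right j)
      pp bb : Bool → Bool → ℤ
      pp p r = PP s p r (left i) (left j)
      bb p r = BB t p r (right i) (right j)
      κ : ℤ
      κ = + 4 * (n * n) * unit s false * δ (left i) (left j)
      collect : ∀ {a b c d x y z w k l l′} → a ≡ k → d ≡ k → b ≡ c → x + w ≡ l → y + z ≡ l′ →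
        a * x + b * y + c * z + d * w ≡ k * l + c * l′
      collect {a} {b} {x = x} {y} {z} {w} refl refl refl refl refl = lemma a b x y z w
        where
        lemma : ∀ a b x y z w → a * x + b * y + b * z + a * w ≡ a * (x + w) + b * (y + z)
        lemma = solve-∀
      zero-term : ∀ a c x d → a + c * (x * 0ℤ * d) ≡ a
      zero-term = solve-∀

    C-orthogonal : ∀ s t i j → ∑₂ (λ u v → (C u v ⊠ C (u xor s) (v xor t)) i j) ≡
      + 4 * (size-of (X × Y) * size-of (X × Y)) * unit s t * δ i j
    C-orthogonal s t i j = 4-cancel (trans (4C-orthogonal s t i j)
      (trans (regroup n m (unit s false) (unit false t) (δ (left i) (left j)) (δ (right i) (right j)))
      (cong (+ 4 *_) (cong₂ _*_ (cong₂ _*_ (cong (+ 4 *_) (sym (cong₂ _*_ size-× size-×))) (unit-* s t)) (sym (δ-index i j))))))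
      where
      regroup : ∀ n m a b d e → + 4 * (n * n) * a * d * (+ 4 * (m * m) * b * e) ≡ + 4 * (+ 4 * (n * m * (n * m)) * (a * b) * (d * e))
      regroup = solve-∀
      unit-* : ∀ s t → unit s false * unit false t ≡ unit s t
      unit-* false t = *-identityˡ (unit false t)
      unit-* true  t = *-zeroˡ (unit false t)

    -- Adding the matrices for both u pairs A_00 + A_10 with B_0v + B_1v, and A_01 + A_11 with B_0v
    -- - B_1v. The second product drops out because `row-sums′` holds in all blocks of 𝒜, the
    -- diagonal ones included.
    row-total : ∀ v x y z x′ y′ → + 2 * ∑ (λ z′ → C false v ((x , y) , z) ((x′ , y′) , z′) + C true v ((x , y) , z) ((x′ , y′) , z′)) ≡
      ∑ (λ x″ → A false false (x , proj₁ z) (x′ , x″) + A true false (x , proj₁ z) (x′ , x″)) *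
      ∑ (λ y″ → B false v (y , proj₂ z) (y′ , y″) + B true v (y , proj₂ z) (y′ , y″))
    row-total v x y (z₁ , z₂) x′ y′ = begin
      + 2 * ∑ (λ z′ → C false v i (w , z′) + C true v i (w , z′))
        ≡⟨ ∑-*ˡ (+ 2) (λ z′ → C false v i (w , z′) + C true v i (w , z′)) ⟨
      ∑ (λ z′ → + 2 * (C false v i (w , z′) + C true v i (w , z′)))
        ≡⟨ ∑-cong (λ z′ → trans (*-distribˡ-+ (+ 2) (C false v i (w , z′)) (C true v i (w , z′))) (trans (cong₂ _+_ (2C false v i (w , z′)) (2C true v i (w , z′)))
             (regroup (a false false (proj₁ z′)) (a false true (proj₁ z′)) (a true false (proj₁ z′)) (a true true (proj₁ z′)) (b false (proj₂ z′)) (b true (proj₂ z′))))) ⟩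
      ∑ (λ (x″ , y″) → (a false false x″ + a true false x″) * (b false y″ + b true y″) + (a false true x″ + a true true x″) * (b false y″ - b true y″))
        ≡⟨ trans (∑-+ (λ (x″ , y″) → (a false false x″ + a true false x″) * (b false y″ + b true y″)) (λ (x″ , y″) → (a false true x″ + a true true x″) * (b false y″ - b true y″)))
             (cong₂ _+_ (separate (λ x″ → a false false x″ + a true false x″) (λ y″ → b false y″ + b true y″))
                        (separate (λ x″ → a false true x″ + a true true x″) (λ y″ → b false y″ - b true y″))) ⟩
      S * T + ∑ (λ x″ → a false true x″ + a true true x″) * ∑ (λ y″ → b false y″ - b true y″)
        ≡⟨ cong (λ c → S * T + c * ∑ (λ y″ → b false y″ - b true y″)) (𝒜.row-sums′ x z₁ x′) ⟩
      S * T + 0ℤ * ∑ (λ y″ → b false y″ - b true y″)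
        ≡⟨ trans (cong (λ c → S * T + c) (*-zeroˡ (∑ (λ y″ → b false y″ - b true y″)))) (+-identityʳ (S * T)) ⟩
      S * T ∎
      where
      open ≡-Reasoning
      i : Index
      i = (x , y) , (z₁ , z₂)
      w : X × Y
      w = x′ , y′
      a : Bool → Bool → X → ℤ
      a u t x″ = A u t (x , z₁) (x′ , x″)
      b : Bool → Y → ℤ
      b u y″ = B u v (y , z₂) (y′ , y″)
      S T : ℤ
      S = ∑ (λ x″ → a false false x″ + a true false x″)
      T = ∑ (λ y″ → b false y″ + b true y″)
      regroup : ∀ a a′ c c′ b b′ → ((a + 1ℤ * a′) * b + (a + -1ℤ * a′) * b′) + ((c + 1ℤ * c′) * b + (c + -1ℤ * c′) * b′)
        ≡ (a + c) * (b + b′) + (a′ + c′) * (b - b′)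
      regroup = solve-∀
      separate : ∀ (f : X → ℤ) (g : Y → ℤ) → ∑ (λ (x , y) → f x * g y) ≡ ∑ f * ∑ g
      separate f g = trans (∑-× (λ (x , y) → f x * g y)) (∑-∑-* f g)

    row-vanish : ∀ v x y z x′ y′ →
      ∑ (λ x″ → A false false (x , proj₁ z) (x′ , x″) + A true false (x , proj₁ z) (x′ , x″)) ≡ 0ℤ ⊎
      ∑ (λ y″ → B false v (y , proj₂ z) (y′ , y″) + B true v (y , proj₂ z) (y′ , y″)) ≡ 0ℤ →
      ∑ (λ z′ → C false v ((x , y) , z) ((x′ , y′) , z′) + C true v ((x , y) , z) ((x′ , y′) , z′)) ≡ 0ℤ
    row-vanish v x y z x′ y′ = vanish
      where
      S T : ℤ
      S = ∑ (λ x″ → A false false (x , proj₁ z) (x′ , x″) + A true false (x , proj₁ z) (x′ , x″))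
      T = ∑ (λ y″ → B false v (y , proj₂ z) (y′ , y″) + B true v (y , proj₂ z) (y′ , y″))
      vanish : S ≡ 0ℤ ⊎ T ≡ 0ℤ →
        ∑ (λ z′ → C false v ((x , y) , z) ((x′ , y′) , z′) + C true v ((x , y) , z) ((x′ , y′) , z′)) ≡ 0ℤ
      vanish (inj₁ e) = 2-cancel (trans (row-total v x y z x′ y′) (trans (cong (_* T) e) (*-zeroˡ T)))
      vanish (inj₂ e) = 2-cancel (trans (row-total v x y z x′ y′) (trans (cong (S *_) e) (*-zeroʳ S)))

    composition : Quadruple (X × Y)
    composition = record
      { A          = C
      ; entries    = λ u v i j → mix-±1 (𝒜.entries u false (left i) (left j)) (ℬ.entries false v (right i) (right j)) (ℬ.entries true v (right i) (right j))
      ; symmetric  = λ u v i j → cong₄ (𝒜.symmetric u false (left i) (left j)) (𝒜.symmetric u true (left i) (left j))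
                                       (ℬ.symmetric false v (right i) (right j)) (ℬ.symmetric true v (right i) (right j))
      ; commute    = C-commute
      ; orthogonal = C-orthogonal
      ; diagonal   = λ u (x , y) (z , t) (z′ , t′) → trans
          (cong₂ (mix (A u false (x , z) (x , z′)) (A u true (x , z) (x , z′))) (ℬ.diagonal false y t t′) (ℬ.diagonal true y t t′))
          (trans (mix-one (A u false (x , z) (x , z′)) (A u true (x , z) (x , z′))) (𝒜.diagonal u x z z′))
      ; row-sums   = λ v (x , y) z (x′ , y′) ne → row-vanish v x y z x′ y′ (off-diagonal v x y z x′ y′ ne)
      ; row-sums′  = λ (x , y) z (x′ , y′) → row-vanish true x y z x′ y′ (inj₂ (ℬ.row-sums′ y (proj₂ z) y′))
      }
      where
      cong₄ : ∀ {a a′ b b′ c c′ d d′} → a ≡ a′ → b ≡ b′ → c ≡ c′ → d ≡ d′ → mix a b c d ≡ mix a′ b′ c′ d′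
      cong₄ refl refl refl refl = refl
      off-diagonal : ∀ v x y z x′ y′ → (x , y) ≢ (x′ , y′) →
        ∑ (λ x″ → A false false (x , proj₁ z) (x′ , x″) + A true false (x , proj₁ z) (x′ , x″)) ≡ 0ℤ ⊎
        ∑ (λ y″ → B false v (y , proj₂ z) (y′ , y″) + B true v (y , proj₂ z) (y′ , y″)) ≡ 0ℤ
      off-diagonal v x y z x′ y′ ne with x ≟ x′
      ... | no x≢x′ = inj₁ (𝒜.row-sums false x (proj₁ z) x′ x≢x′)
      ... | yes x≡x′ = inj₂ (ℬ.row-sums v y (proj₂ z) y′ (λ y≡y′ → ne (cong₂ _,_ x≡x′ y≡y′)))

  -- The Bush-type matrix

  opaque
    unfolding ∑
    sum-enumeration : ∀ {k} {A : Set} {{F : Finite A}} (π : Fin k ↔ A) (f : A → ℤ) → ΣC.sum (f ∘ Inverse.to π) ≡ ∑ f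
    sum-enumeration {k} π f = ∑-reindex {{finite (mk↔ₛ′ id id (λ _ → refl) (λ _ → refl))}} π f

  opaque
    unfolding ∑₂
    ∑₂-shift : ∀ a b (g : Bool → Bool → ℤ) → ∑₂ (λ u v → g (a xor u) (b xor v)) ≡ ∑₂ g
    ∑₂-shift false false g = refl
    ∑₂-shift false true  g = lemma (g false false) (g false true) (g true false) (g true true)
      where
      lemma : ∀ a b c d → b + a + d + c ≡ a + b + c + d
      lemma = solve-∀
    ∑₂-shift true  false g = lemma (g false false) (g false true) (g true false) (g true true)
      where
      lemma : ∀ a b c d → c + d + a + b ≡ a + b + c + d
      lemma = solve-∀
    ∑₂-shift true  true  g = lemma (g false false) (g false true) (g true false) (g true true)
      where
      lemma : ∀ a b c d → d + c + b + a ≡ a + b + c + d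
      lemma = solve-∀

  xor-shift : ∀ a u b → (a xor u) xor (a xor b) ≡ u xor b
  xor-shift false u     b     = refl
  xor-shift true  false false = refl
  xor-shift true  false true  = refl
  xor-shift true  true  false = refl
  xor-shift true  true  true  = refl

  xor-comm : ∀ a b → a xor b ≡ b xor a
  xor-comm false false = refl
  xor-comm false true  = refl
  xor-comm true  false = refl
  xor-comm true  true  = refl

  xor-self : ∀ a → a xor a ≡ false
  xor-self false = refl
  xor-self true  = refl

  xor-≡ : ∀ a b → a xor b ≡ false → a ≡ b
  xor-≡ false false e = refl
  xor-≡ true  true  e = refl

  module Bush {X : Set} {{X-finite : Finite X}} (𝒜 : Quadruple X) where
    open Quadruple 𝒜

    Half : Set
    Half = Bool × X

    Index : Set
    Index = Half × Half

    n : ℕ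
    n = size X-finite

    half↔ : Fin (2 ℕ.* n) ↔ Half
    half↔ = (2↔Bool ×-↔ enum X-finite) ↔-∘ *↔×

    index↔ : Fin ((2 ℕ.* n) ℕ.* (2 ℕ.* n)) ↔ Index
    index↔ = (half↔ ×-↔ half↔) ↔-∘ *↔×

    -- The pair (v, x) is the number of the block and (u, y) the position in it. So a diagonal block
    -- meets only A_u0, and a row of a block runs over both values of u.
    K : Index → Index → ℤ
    K ((v , x) , (u , y)) ((v′ , x′) , (u′ , y′)) = A (u xor u′) (v xor v′) (x , y) (x′ , y′)

    K-symmetric : ∀ i j → K i j ≡ K j i
    K-symmetric ((v , x) , (u , y)) ((v′ , x′) , (u′ , y′)) =
      trans (symmetric (u xor u′) (v xor v′) (x , y) (x′ , y′)) (cong₂ (λ a b → A a b (x′ , y′) (x , y)) (xor-comm u u′) (xor-comm v v′))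

    shuffle↔ : ((Bool × Bool) × (X × X)) ↔ Index
    shuffle↔ = mk↔ₛ′ (λ ((u , v) , (x , y)) → (v , x) , (u , y)) (λ ((v , x) , (u , y)) → (u , v) , (x , y)) (λ _ → refl) (λ _ → refl)

    ∑-Index : ∀ (h : Index → ℤ) → ∑ h ≡ ∑₂ (λ u v → ∑ (λ (x , y) → h ((v , x) , (u , y))))
    ∑-Index h = trans (sym (∑-reindex shuffle↔ h)) (trans (∑-× (h ∘ Inverse.to shuffle↔)) (trans (∑-× g) (trans (∑-Bool (λ u → ∑ (λ v → g (u , v))))
      (trans (cong₂ _+_ (∑-Bool (λ v → g (false , v))) (∑-Bool (λ v → g (true , v))))
      (trans (lemma (g (false , false)) (g (false , true)) (g (true , false)) (g (true , true))) (sym (∑₂-def (λ u v → g (u , v)))))))))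
      where
      g : Bool × Bool → ℤ
      g (u , v) = ∑ (λ (x , y) → h ((v , x) , (u , y)))
      lemma : ∀ a b c d → a + b + (c + d) ≡ a + b + c + d
      lemma = solve-∀

    κ : Index → Index → ℤ
    κ ((v , x) , (u , y)) ((v′ , x′) , (u′ , y′)) = unit (u xor u′) (v xor v′) * δ (x , y) (x′ , y′)

    -- Shifting the summation bits by u and v turns the sum into the relation of the quadruple with
    -- s = u + u′ and t = v + v′.
    K-orthogonal : ∀ i j → ∑ (λ k → K i k * K k j) ≡ + 4 * (size-of X * size-of X) * κ i j
    K-orthogonal i@((v , x) , (u , y)) j@((v′ , x′) , (u′ , y′)) = begin
      ∑ (λ k → K i k * K k j)
        ≡⟨ ∑-Index (λ k → K i k * K k j) ⟩
      ∑₂ (λ a b → ∑ (λ z → A (u xor a) (v xor b) (x , y) z * A (a xor u′) (b xor v′) z (x′ , y′)))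
        ≡⟨ ∑₂-cong (λ a b → trans (∑-cong λ z → cong₂ (λ p r → A (u xor a) (v xor b) (x , y) z * A p r z (x′ , y′))
             (sym (xor-shift u a u′)) (sym (xor-shift v b v′)))
             (sym (⊠-def (A (u xor a) (v xor b)) (A ((u xor a) xor (u xor u′)) ((v xor b) xor (v xor v′))) (x , y) (x′ , y′)))) ⟩
      ∑₂ (λ a b → g (u xor a) (v xor b))
        ≡⟨ ∑₂-shift u v g ⟩
      ∑₂ g
        ≡⟨ orthogonal (u xor u′) (v xor v′) (x , y) (x′ , y′) ⟩
      + 4 * (size-of X * size-of X) * unit (u xor u′) (v xor v′) * δ (x , y) (x′ , y′)
        ≡⟨ *-assoc (+ 4 * (size-of X * size-of X)) (unit (u xor u′) (v xor v′)) (δ (x , y) (x′ , y′)) ⟩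
      + 4 * (size-of X * size-of X) * κ i j ∎
      where
      open ≡-Reasoning
      g : Bool → Bool → ℤ
      g a b = (A a b ⊠ A (a xor (u xor u′)) (b xor (v xor v′))) (x , y) (x′ , y′)

    κ-self : ∀ i → κ i i ≡ 1ℤ
    κ-self ((v , x) , (u , y)) = cong₂ _*_ (cong₂ unit (xor-self u) (xor-self v)) (δ-≡ refl)

    κ-distinct : ∀ i j → i ≢ j → κ i j ≡ 0ℤ
    κ-distinct ((v , x) , (u , y)) ((v′ , x′) , (u′ , y′)) i≢j with u xor u′ in e | v xor v′ in e′
    ... | true  | _     = *-zeroˡ (δ (x , y) (x′ , y′))
    ... | false | true  = *-zeroˡ (δ (x , y) (x′ , y′))
    ... | false | false = trans (*-identityˡ (δ (x , y) (x′ , y′))) (δ-≢ λ z → i≢j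
      (cong₂ _,_ (cong₂ _,_ (xor-≡ v v′ e′) (cong proj₁ z)) (cong₂ _,_ (xor-≡ u u′ e) (cong proj₂ z))))

    H : SquareMatrix ((2 ℕ.* n) ℕ.* (2 ℕ.* n))
    H r c = K (Inverse.to index↔ r) (Inverse.to index↔ c)

    order-ℤ : + ((2 ℕ.* n) ℕ.* (2 ℕ.* n)) ≡ + 4 * (size-of X * size-of X)
    order-ℤ = trans (pos-* (2 ℕ.* n) (2 ℕ.* n)) (trans (cong₂ _*_ (pos-* 2 n) (pos-* 2 n))
      (trans (lemma (+ n)) (cong (λ s → + 4 * (s * s)) (sym size-of-def))))
      where
      lemma : ∀ n → + 2 * n * (+ 2 * n) ≡ + 4 * (n * n)
      lemma = solve-∀

    H-hadamard : IsHadamard H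
    H-hadamard = record
      { entries    = λ r c → K-entries (Inverse.to index↔ r) (Inverse.to index↔ c)
      ; orthogonal = λ r c → trans (sum-enumeration index↔ (λ k → K (Inverse.to index↔ r) k * K (Inverse.to index↔ c) k))
          (trans (∑-cong λ k → cong (K (Inverse.to index↔ r) k *_) (K-symmetric (Inverse.to index↔ c) k))
          (trans (K-orthogonal (Inverse.to index↔ r) (Inverse.to index↔ c))
            (cong₂ _*_ (sym order-ℤ) (κ-identity r c))))
      }
      where
      K-entries : ∀ i j → K i j ≡ 1ℤ ⊎ K i j ≡ -1ℤ
      K-entries ((v , x) , (u , y)) ((v′ , x′) , (u′ , y′)) = entries (u xor u′) (v xor v′) (x , y) (x′ , y′)
      κ-identity : ∀ r c → κ (Inverse.to index↔ r) (Inverse.to index↔ c) ≡ I _ r c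
      κ-identity r c with r Fin.≟ c
      ... | yes refl = κ-self (Inverse.to index↔ r)
      ... | no r≢c   = κ-distinct (Inverse.to index↔ r) (Inverse.to index↔ c)
        (λ e → r≢c (trans (sym (Inverse.strictlyInverseʳ index↔ r)) (trans (cong (Inverse.from index↔) e) (Inverse.strictlyInverseʳ index↔ c))))

    decode : Fin (2 ℕ.* n) → Half
    decode = Inverse.to half↔

    block-H : ∀ i j a c → block refl H i j a c ≡ K (decode i , decode a) (decode j , decode c)
    block-H i j a c = cong₂ K (index-combine i a) (index-combine j c)
      where
      index-combine : ∀ i a → Inverse.to index↔ (cast refl (combine i a)) ≡ (decode i , decode a)
      index-combine i a = trans (cong (Inverse.to index↔) (cast-is-id refl (combine i a)))
        (cong (λ (k , l) → decode k , decode l) (remQuot-combine i a))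

    decode-injective : ∀ i j → decode i ≡ decode j → i ≡ j
    decode-injective i j e = trans (sym (Inverse.strictlyInverseʳ half↔ i)) (trans (cong (Inverse.from half↔) e) (Inverse.strictlyInverseʳ half↔ j))

    -- The sum over u′ produces A_0t + A_1t with t = v + v′, in one order or the other. For t = 1
    -- all blocks are covered by `row-sums′`; for t = 0 the block numbers differ only if x ≠ x′.
    K-row : ∀ i a j → i ≢ j → ∑ (λ c → K (i , a) (j , c)) ≡ 0ℤ
    K-row (v , x) (u , y) (v′ , x′) i≢j = trans (∑-× (λ c → K ((v , x) , (u , y)) ((v′ , x′) , c)))
      (trans (∑-Bool (λ u′ → ∑ (λ y′ → A (u xor u′) (v xor v′) (x , y) (x′ , y′)))) (by-sign u))
      where
      both : ∑ (λ y′ → A false (v xor v′) (x , y) (x′ , y′) + A true (v xor v′) (x , y) (x′ , y′)) ≡ 0ℤ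
      both with v xor v′ in e
      ... | true  = row-sums′ x y x′
      ... | false = row-sums false x y x′ (λ x≡x′ → i≢j (cong₂ _,_ (xor-≡ v v′ e) x≡x′))
      split : ∑ (λ y′ → A false (v xor v′) (x , y) (x′ , y′)) + ∑ (λ y′ → A true (v xor v′) (x , y) (x′ , y′)) ≡ 0ℤ
      split = trans (sym (∑-+ (λ y′ → A false (v xor v′) (x , y) (x′ , y′)) (λ y′ → A true (v xor v′) (x , y) (x′ , y′)))) both
      by-sign : ∀ u → ∑ (λ y′ → A (u xor false) (v xor v′) (x , y) (x′ , y′)) + ∑ (λ y′ → A (u xor true) (v xor v′) (x , y) (x′ , y′)) ≡ 0ℤ
      by-sign false = split
      by-sign true  = trans (+-comm (∑ (λ y′ → A true (v xor v′) (x , y) (x′ , y′))) (∑ (λ y′ → A false (v xor v′) (x , y) (x′ , y′)))) split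

    block-row : ∀ i j a → i ≢ j → ΣC.sum (λ c → block refl H i j a c) ≡ 0ℤ
    block-row i j a i≢j = trans (ΣC.sum-cong-≗ (block-H i j a))
      (trans (sum-enumeration half↔ (λ c → K (decode i , decode a) (decode j , c)))
        (K-row (decode i) (decode a) (decode j) (i≢j ∘ decode-injective i j)))

    H-symmetric : Symmetric H
    H-symmetric r c = K-symmetric (Inverse.to index↔ r) (Inverse.to index↔ c)

    H-bush : NonZero n → IsBushType n H
    H-bush n≢0 = record
      { positive   = n≢0
      ; order      = refl
      ; isHadamard = H-hadamard
      ; diagonal   = λ i a c → trans (block-H i i a c) (diagonal-block (decode i) (decode a) (decode c))
      ; rowSums    = λ i j i≢j a c → trans (ΣC.sum-cong-≗ (λ k → *-identityʳ (block refl H i j a k))) (block-row i j a i≢j)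
      -- By symmetry the columns of block (i, j) are the rows of block (j, i).
      ; columnSums = λ i j i≢j a c → trans (ΣC.sum-cong-≗ (λ k → trans (*-identityˡ (block refl H i j k c)) (H-symmetric _ _)))
          (block-row j i c (i≢j ∘ sym))
      }
      where
      diagonal-block : ∀ i a c → K (i , a) (i , c) ≡ 1ℤ
      diagonal-block (v , x) (u , y) (u′ , y′) = trans (cong (λ b → A (u xor u′) b (x , y) (x , y′)) (xor-self v)) (diagonal (u xor u′) x y y′)

    bush-matrix : NonZero n → ∀ {k N} → n ≡ k → (2 ℕ.* n) ℕ.* (2 ℕ.* n) ≡ N → ∃ λ (H : SquareMatrix N) → Symmetric H × IsBushType k H
    bush-matrix n≢0 refl refl = H , H-symmetric , H-bush n≢0

  -- Primes and products

  -- The number 2k + 1, defined by steps of two so that sums over `Fin (odd k)` unfold two terms at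
  -- a time.
  odd : ℕ → ℕ
  odd ℕ.zero    = 1
  odd (ℕ.suc k) = 2 ℕ.+ odd k

  not-even⇒odd : ∀ n → ¬ 2 ∣ n → ∃[ k ] n ≡ odd k
  not-even⇒odd 0 ¬even = contradiction (divides 0 refl) ¬even
  not-even⇒odd 1 _     = 0 , refl
  not-even⇒odd (ℕ.suc (ℕ.suc n)) ¬even with not-even⇒odd n (λ (divides r e) → ¬even (divides (ℕ.suc r) (cong (2 ℕ.+_) e)))
  ... | k , e = ℕ.suc k , cong (2 ℕ.+_) e

  odd-not-even : ∀ m → Odd m → ¬ 2 ∣ ∣ m ∣
  odd-not-even m (k , e) 2∣m with Signed.∣⇒∣ᵤ (Signed.∣m+n∣m⇒∣n (subst (+ 2 Signed.∣_) e (Signed.∣ᵤ⇒∣ 2∣m)) (Signed.divides k (*-comm (+ 2) k)))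
  ... | divides (ℕ.suc (ℕ.suc _)) ()

  -- The patterns + - and + + - - of periods 2 and 4; their product has the pattern + - - +. All
  -- three sum to zero over a period of 4, so only a remainder of length 1 or 3 counts.
  alternating periodic : ∀ {n} → Fin n → Bool
  alternating zero          = false
  alternating (suc zero)    = true
  alternating (suc (suc i)) = alternating i
  periodic zero                      = false
  periodic (suc zero)                = false
  periodic (suc (suc zero))          = true
  periodic (suc (suc (suc zero)))    = true
  periodic (suc (suc (suc (suc i)))) = periodic i

  sum-alternating : ∀ k → ΣC.sum {odd k} (λ i → sgn (alternating i)) ≡ 1ℤ
  sum-alternating ℕ.zero    = refl
  sum-alternating (ℕ.suc k) = trans (lemma (ΣC.sum {odd k} (λ i → sgn (alternating i)))) (sum-alternating k)
    where
    lemma : ∀ s → 1ℤ + (-1ℤ + s) ≡ s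
    lemma = solve-∀

  sum-periodic : ∀ k → ΣC.sum {odd k} (λ i → sgn (periodic i)) ≡ 1ℤ
  sum-periodic 0 = refl
  sum-periodic 1 = refl
  sum-periodic (ℕ.suc (ℕ.suc k)) = trans (lemma (ΣC.sum {odd k} (λ i → sgn (periodic i)))) (sum-periodic k)
    where
    lemma : ∀ s → 1ℤ + (1ℤ + (-1ℤ + (-1ℤ + s))) ≡ s
    lemma = solve-∀

  -- The remainder is + or + - -, so both signs occur; this is why `Signs` prescribes the square of
  -- the sum.
  sum-product : ∀ k → ΣC.sum {odd k} (λ i → sgn (alternating i) * sgn (periodic i)) ≡ 1ℤ ⊎
                      ΣC.sum {odd k} (λ i → sgn (alternating i) * sgn (periodic i)) ≡ -1ℤ
  sum-product 0 = inj₁ refl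
  sum-product 1 = inj₂ refl
  sum-product (ℕ.suc (ℕ.suc k)) = subst (λ s → s ≡ 1ℤ ⊎ s ≡ -1ℤ)
    (sym (lemma (ΣC.sum {odd k} (λ i → sgn (alternating i) * sgn (periodic i))))) (sum-product k)
    where
    lemma : ∀ s → 1ℤ + (-1ℤ + (-1ℤ + (1ℤ + s))) ≡ s
    lemma = solve-∀

  sum-product² : ∀ k → ΣC.sum {odd k} (λ i → sgn (alternating i) * sgn (periodic i)) * ΣC.sum {odd k} (λ i → sgn (alternating i) * sgn (periodic i)) ≡ 1ℤ
  sum-product² k with sum-product k
  ... | inj₁ e = cong₂ _*_ e e
  ... | inj₂ e = cong₂ _*_ e e

  Fin-finite : ∀ {n} → Finite (Fin n)
  Fin-finite = finite (mk↔ₛ′ id id (λ _ → refl) (λ _ → refl))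

  Fin-signs : ∀ {n} k → n ≡ odd k → Signs (Fin n) {{Fin-finite}}
  Fin-signs k refl = record
    { ε = alternating ; ν = periodic
    ; ∑-ε  = trans (∑-def {{Fin-finite}} _) (sum-alternating k)
    ; ∑-ν  = cong₂ _*_ (trans (∑-def {{Fin-finite}} _) (sum-periodic k)) (trans (∑-def {{Fin-finite}} _) (sum-periodic k))
    ; ∑-εν = trans (cong₂ _*_ (∑-def {{Fin-finite}} _) (∑-def {{Fin-finite}} _)) (sum-product² k)
    }

  record SizedQuadruple (n : ℕ) : Set₁ where
    field
      X         : Set
      X-finite  : Finite X
      size-X    : size X-finite ≡ n
      quadruple : Quadruple X {{X-finite}}

  opaque
    unfolding ×-finite
    size-×-finite : {A B : Set} {{F : Finite A}} {{G : Finite B}} → size (×-finite {A} {B}) ≡ size F ℕ.* size G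
    size-×-finite = refl

  -- The four signs (-1)^(uv) as matrices of order 1: the start of the product over prime factors,
  -- and the whole construction for m = ±1.
  trivial : SizedQuadruple 1
  trivial = record { X = ⊤ ; X-finite = ⊤-finite ; size-X = refl ; quadruple = record
    { A          = λ u v _ _ → origin-value u v
    ; entries    = λ u v _ _ → decided-sign u v
    ; symmetric  = λ _ _ _ _ → refl
    ; commute    = λ u v u′ v′ i j → trans (entry u v u′ v′ i j) (trans (*-comm (origin-value u v) (origin-value u′ v′)) (sym (entry u′ v′ u v i j)))
    ; orthogonal = λ s t i j → trans (∑₂-cong λ u v → entry u v (u xor s) (v xor t) i j)
        (trans (origin-values s t) (trans (lemma (unit s t)) (cong₂ (λ m d → + 4 * (m * m) * unit s t * d) (sym size-of-def) (sym (δ-≡ {x = i} {y = j} refl)))))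
    ; diagonal   = λ _ _ _ _ → refl
    ; row-sums   = λ _ _ _ _ tt≢tt → contradiction refl tt≢tt
    ; row-sums′  = λ _ _ _ → ∑-zero λ _ → refl
    } }
    where
    instance
      ⊤-finite : Finite ⊤
      ⊤-finite = finite 1↔⊤
    decided-sign : ∀ u v → origin-value u v ≡ 1ℤ ⊎ origin-value u v ≡ -1ℤ
    decided-sign u     false = inj₁ refl
    decided-sign false true  = inj₁ refl
    decided-sign true  true  = inj₂ refl
    entry : ∀ u v u′ v′ (i j : ⊤ × ⊤) → ((λ _ _ → origin-value u v) ⊠ (λ _ _ → origin-value u′ v′)) i j ≡ origin-value u v * origin-value u′ v′
    entry u v u′ v′ i j = trans (⊠-def _ _ i j) (∑-single (tt , tt) (λ _ → origin-value u v * origin-value u′ v′) λ _ ne → contradiction refl ne)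
    lemma : ∀ x → + 4 * x ≡ + 4 * (1ℤ * 1ℤ) * x * 1ℤ
    lemma = solve-∀

  compose : ∀ {m n} → SizedQuadruple m → SizedQuadruple n → SizedQuadruple (m ℕ.* n)
  compose 𝒜 ℬ = record
    { X = 𝒜.X × ℬ.X ; X-finite = ×-finite ; size-X = trans size-×-finite (cong₂ ℕ._*_ 𝒜.size-X ℬ.size-X)
    ; quadruple = Composition.composition 𝒜.quadruple ℬ.quadruple }
    where
    module 𝒜 = SizedQuadruple 𝒜
    module ℬ = SizedQuadruple ℬ
    instance
      𝒜-finite : Finite 𝒜.X
      𝒜-finite = 𝒜.X-finite
      ℬ-finite : Finite ℬ.X
      ℬ-finite = ℬ.X-finite

  prime-quadruple : ∀ {p} → Prime p → ∀ k → p ≡ odd k → SizedQuadruple (p ℕ.* p)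
  prime-quadruple {p} p-prime k p≡odd = record
    { X         = 𝕂.Carrier
    ; X-finite  = 𝕂.carrier-finite
    ; size-X    = size-×-finite {{Fin-finite}} {{Fin-finite}}
    ; quadruple = Assembly.quadruple 𝔽 extension coordinates (Fin-signs k p≡odd)
    }
    where
    2<p : ∀ k → p ≡ odd k → 2 ℕ.< p
    2<p ℕ.zero    e = contradiction (subst Prime e p-prime) ¬prime[1]
    2<p (ℕ.suc k) e = subst (2 ℕ.<_) (sym e) (ℕ.s≤s (ℕ.s≤s (positive k)))
      where
      positive : ∀ k → 0 ℕ.< odd k
      positive ℕ.zero    = ℕ.s≤s ℕ.z≤n
      positive (ℕ.suc k) = ℕ.s≤s ℕ.z≤n
    𝔽 = Residues.primeField p p-prime (2<p k p≡odd)
    module 𝔽 = FieldProperties 𝔽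
    d = proj₁ 𝔽.∃-nonsquare
    d-nonsquare : ¬ 𝔽.IsSquare d
    d-nonsquare s with 𝔽.η-view d
    ... | 𝔽.zero _ e        = contradiction (trans (sym (proj₂ 𝔽.∃-nonsquare)) e) λ ()
    ... | 𝔽.square _ _ e    = contradiction (trans (sym (proj₂ 𝔽.∃-nonsquare)) e) λ ()
    ... | 𝔽.nonsquare _ ¬s _ = ¬s s
    open QuadraticExtension 𝔽 d d-nonsquare using (extension; η-⊖𝟙; module Slopes)
    module 𝕂 = FieldProperties extension
    w = proj₁ 𝕂.∃-nonsquare
    open Slopes (proj₁ w) (proj₂ w) (proj₂ 𝕂.∃-nonsquare)
    coordinates : Coordinates 𝔽 extension
    coordinates = record
      { slope↔ = slope↔ ; slope-sub = slope-sub
      ; ∑-η-slope₁ = ∑-η-slope₁ ; ∑-η-slope₂ = ∑-η-slope₂ ; η-⊖𝟙 = η-⊖𝟙 }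

  product-quadruple : ∀ ps → All Prime ps → ¬ 2 ∣ product ps → SizedQuadruple (product ps ℕ.* product ps)
  product-quadruple []       []       _     = trivial
  product-quadruple (p ∷ ps) (p-prime ∷ primes) ¬even with not-even⇒odd p (¬even ∘ ∣m⇒∣m*n (product ps))
  ... | k , p≡odd = subst SizedQuadruple (interchange p (product ps))
    (compose (prime-quadruple p-prime k p≡odd) (product-quadruple ps primes (¬even ∘ ∣n⇒∣m*n p)))
    where
    interchange : ∀ p r → p ℕ.* p ℕ.* (r ℕ.* r) ≡ p ℕ.* r ℕ.* (p ℕ.* r)
    interchange = ℕSolver.solve-∀

  odd-quadruple : ∀ n → ¬ 2 ∣ n → SizedQuadruple (n ℕ.* n)
  odd-quadruple 0           ¬even = contradiction (divides 0 refl) ¬even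
  odd-quadruple n@(ℕ.suc _) ¬even = subst (λ r → SizedQuadruple (r ℕ.* r)) (sym isFactorisation)
    (product-quadruple factors factorsPrime (subst (λ r → ¬ 2 ∣ r) isFactorisation ¬even))
    where open PrimeFactorisation (factorise n)

  bush-type-matrix : ∀ n → ¬ 2 ∣ n → ∃ λ (H : SquareMatrix (4 ℕ.* n ℕ.^ 4)) → Symmetric H × IsBushType (n ℕ.^ 2) H
  bush-type-matrix n ¬even = Bush.bush-matrix {{X-finite}} quadruple nonZero size≡n² order
    where
    open SizedQuadruple (odd-quadruple n ¬even)
    n²≡nn : ∀ n → n ℕ.* n ≡ n ℕ.^ 2
    n²≡nn n = cong (n ℕ.*_) (sym (ℕP.*-identityʳ n))
    size≡n² : size X-finite ≡ n ℕ.^ 2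
    size≡n² = trans size-X (n²≡nn n)
    nonZero : NonZero (size X-finite)
    nonZero = subst NonZero (sym size-X) (ℕP.m*n≢0 n n {{n≢0}} {{n≢0}})
      where
      n≢0 : NonZero n
      n≢0 = ℕ.≢-nonZero λ { refl → ¬even (divides 0 refl) }
    order : (2 ℕ.* size X-finite) ℕ.* (2 ℕ.* size X-finite) ≡ 4 ℕ.* n ℕ.^ 4
    order = trans (cong (λ s → (2 ℕ.* s) ℕ.* (2 ℕ.* s)) size-X) (lemma n)
      where
      lemma : ∀ n → (2 ℕ.* (n ℕ.* n)) ℕ.* (2 ℕ.* (n ℕ.* n)) ≡ 4 ℕ.* (n ℕ.* (n ℕ.* (n ℕ.* (n ℕ.* 1))))
      lemma = ℕSolver.solve-∀

open import Data.Integer.Base using (ℤ; ∣_∣)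
open import Data.Nat.Base using (_*_; _^_)
open import Data.Product.Base using (_×_; ∃)

theorem3p5 : (m : ℤ) → Odd m →
    ∃ λ (H : SquareMatrix (4 * ∣ m ∣ ^ 4)) → Symmetric H × IsBushType (∣ m ∣ ^ 2) H
theorem3p5 m m-odd = Construction.bush-type-matrix ∣ m ∣ (Construction.odd-not-even m m-odd)
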